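{- Let $n$ be a sufficiently large integer and let $q = q(n)$ be a positive integer. Then, for the $(q:1)$ Waiter-Client game on $E(K_n)$, the following hold: (i) If $q \geq 1.1 n$, then Client has a strategy to keep his graph acyclic throughout the game. (ii) There exists a positive constant $c$ (not depending on $n$) such that, if $q \leq c n$, then Waiter has a strategy to ensure that, at the end of the game, Client's graph is pancyclic.
   Context: The $(q:1)$ Waiter-Client game on $E(K_n)$ (for a positive integer $q$) is the following two-player perfect information game. In each round, Waiter offers Client exactly $q+1$ edges of the complete graph $K_n$ which have not been claimed before; Client chooses one of these edges, which he keeps, and the remaining $q$ edges are claimed by Waiter. If fewer than $q+1$ unclaimed edges remain, all of them are claimed by Waiter. The game ends when all edges of $K_n$ have been claimed. Client's graph is the graph with vertex set $V(K_n)$ whose edges are all the edges claimed by Client. A graph on $n$ vertices is pancyclic if it contains a cycle of length $k$ for every $3 \leq k \leq n$. -}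

module Defs where

open import Data.Nat using (ℕ; suc; _≤_; _<_)
open import Data.Integer using (+_)
open import Data.Rational as ℚ using (ℚ)
open import Data.Fin using (Fin; _<?_; _≟_)
open import Data.Product using (_×_; _,_; proj₁; Σ-syntax)
open import Data.Product.Properties using (≡-dec)
open import Data.Sum using (_⊎_)
open import Data.Unit using (⊤)
open import Data.List using (List; []; _∷_; _++_; _∷ʳ_; length; filter; allFin; cartesianProduct)
open import Data.List.Membership.Propositional using (_∈_)
open import Data.List.Relation.Binary.Subset.Propositional using (_⊆_)
open import Data.List.Relation.Unary.Linked using (Linked)
open import Data.List.Relation.Unary.Unique.Propositional using (Unique)
open import Relation.Binary.Definitions using (DecidableEquality)
open import Relation.Binary.PropositionalEquality using (_≡_; _≢_)
open import Relation.Nullary using (¬_; ¬?)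
import Data.List.Membership.DecPropositional as DecMembership

fromℕ : ℕ → ℚ
fromℕ n = + n ℚ./ 1

-- The edge joining i and j, where i < j, is the pair (i , j); only such
-- pairs occur in K n, so loops and reversed pairs never enter the game.
Edge : ℕ → Set
Edge n = Fin n × Fin n

infix 4 _≟ᴱ_
_≟ᴱ_ : ∀ {n} → DecidableEquality (Edge n)
_≟ᴱ_ = ≡-dec _≟_ _≟_

K : ∀ n → List (Edge n)
K n = filter (λ (i , j) → i <? j) (cartesianProduct (allFin n) (allFin n))

-- Graphs on the vertex set Fin n, given by their edges.
Graph : ℕ → Set
Graph n = List (Edge n)

Adj : ∀ {n} → Graph n → Fin n → Fin n → Set
Adj G u v = (u , v) ∈ G ⊎ (v , u) ∈ G

record Cycle {n} (G : Graph n) (k : ℕ) : Set where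
  field
    first    : Fin n
    others   : List (Fin n)
    distinct : Unique (first ∷ others)
    closed   : Linked (Adj G) (first ∷ others ∷ʳ first)
    size     : length (first ∷ others) ≡ k
    3≤k      : 3 ≤ k

Acyclic : ∀ {n} → Graph n → Set
Acyclic G = ∀ k → ¬ Cycle G k

Pancyclic : ∀ {n} → Graph n → Set
Pancyclic {n} G = ∀ k → 3 ≤ k → k ≤ n → Cycle G k

record Position (n : ℕ) : Set where
  constructor position
  field
    free client waiter : List (Edge n)

open Position public

initial : ∀ n → Position n
initial n = position (K n) [] []

Over : ∀ {n} → Position n → Set
Over P = free P ≡ []

-- A set of q + 1 free edges, listed without repetition.  The order of the
-- list is visible to Client but has no effect on the position reached.
record Offer {n} (q : ℕ) (P : Position n) : Set where
  field
    edges    : List (Edge n)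
    distinct : Unique edges
    size     : length edges ≡ suc q
    ⊆free    : edges ⊆ free P

open Offer public using (edges)

Choice : ∀ {n q} {P : Position n} → Offer q P → Set
Choice {n} O = Σ[ e ∈ Edge n ] e ∈ edges O

afterRound : ∀ {n q} (P : Position n) (O : Offer q P) → Choice O → Position n
afterRound P O (e , _) = position
  (filter (λ f → ¬? (f ∈? edges O)) (free P))
  (e ∷ client P)
  (filter (λ f → ¬? (f ≟ᴱ e)) (edges O) ++ waiter P)
  where open DecMembership _≟ᴱ_ using (_∈?_)

afterSweep : ∀ {n} → Position n → Position n
afterSweep P = position [] (client P) (free P ++ waiter P)

-- Play n q P: a legal, possibly unfinished, sequence of moves of the (q : 1)
-- game on E(K n), leading from the initial position to P.
data Play (n q : ℕ) : Position n → Set where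
  start : Play n q (initial n)
  round : ∀ {P} → Play n q P → suc q ≤ length (free P) →
          (O : Offer q P) (c : Choice O) → Play n q (afterRound P O c)
  sweep : ∀ {P} → Play n q P → length (free P) < suc q → free P ≢ [] →
          Play n q (afterSweep P)

WaiterStrategy : ℕ → ℕ → Set
WaiterStrategy n q = ∀ {P} → Play n q P → suc q ≤ length (free P) → Offer q P

ClientStrategy : ℕ → ℕ → Set
ClientStrategy n q =
  ∀ {P} → Play n q P → suc q ≤ length (free P) → (O : Offer q P) → Choice O

WaiterFollows : ∀ {n q} → WaiterStrategy n q → ∀ {P} → Play n q P → Set
WaiterFollows τ start           = ⊤
WaiterFollows τ (round h m O c) = WaiterFollows τ h × edges O ≡ edges (τ h m)
WaiterFollows τ (sweep h _ _)   = WaiterFollows τ h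

ClientFollows : ∀ {n q} → ClientStrategy n q → ∀ {P} → Play n q P → Set
ClientFollows σ start           = ⊤
ClientFollows σ (round h m O c) = ClientFollows σ h × proj₁ c ≡ proj₁ (σ h m O)
ClientFollows σ (sweep h _ _)   = ClientFollows σ h

ClientCanMaintain : ∀ n → ℕ → (Graph n → Set) → Set
ClientCanMaintain n q Q =
  Σ[ σ ∈ ClientStrategy n q ]
    (∀ {P} (h : Play n q P) → ClientFollows (λ {P} → σ {P}) h → Q (client P))

-- Every play lengthens to one whose final position is Over: each move removes
-- at least one free edge, and some move is available while any is left.
WaiterCanForce : ∀ n → ℕ → (Graph n → Set) → Set
WaiterCanForce n q Q =
  Σ[ τ ∈ WaiterStrategy n q ]
    (∀ {P} (h : Play n q P) → WaiterFollows (λ {P} → τ {P}) h → Over P → Q (client P))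

{-# OPTIONS --safe #-}
module Submission where

{-
Client stays acyclic.  Give a closed walk through c Client edges and otherwise free
edges the weight Qᶜ, where Q = q + 1, and a walk through a Waiter edge the weight 0.
The average over the Q choices of Client does not increase the total weight, scaled
according to the lengths of the walks, so Client picks an edge that does not either.
Writing walks from their largest vertex, there are at most nᵏ / k of length k, each
cycle occurs twice, and the total weight at the start is less than that of a cycle.

Waiter forces pancyclicity.  By offering stars he forces a path x₀ x₁ … ; y₀ y₁ …
whose edges between the x's and the y's are untouched, leaving aside a set W of m
vertices with all edges inside W free.  Stars at the x₂ᵢ force rungs x₂ᵢ y_{f i}, and
then for each s an offer { x₂ᵢ₊₁ y_{f i + s} } forces two crossing chords: they close
a cycle of length s + 3, and in a Hamilton cycle through the path they skip s - 1
vertices.  It remains to force a Hamilton path on W between given ends.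

Inside W, Waiter plays five stars at each vertex.  Derandomising the first moment
bound for random five-out digraphs (each time he offers Q vertices whose danger is at
most four times the average), he forces every S ⊆ W of size at most k to have an
out-neighbour outside any given T of size at most 3 |S|.  Pósa rotations with one end
fixed then either lengthen a path or produce k + 1 end vertices; a star from a vertex
not yet on the path to these ends absorbs it.  He keeps in-degrees of offers bounded,
so that enough of this last star is free.
-}

open import Level using (Level)
open import Data.Nat as ℕ
  using (ℕ; zero; suc; pred; _+_; _*_; _∸_; _^_; _!; _≤_; _<_; z≤n; s≤s; s≤s⁻¹; >-nonZero; ⌊_/2⌋)
open import Data.Nat.Properties hiding (_≟_)
open import Data.Nat.Tactic.RingSolver using (solve-∀)
import Data.Integer as ℤ
import Data.Integer.Properties as ℤₚ
open import Data.Rational as ℚ using (ℚ; 0ℚ; toℚᵘ)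
import Data.Rational.Properties as ℚₚ
open import Data.Rational.Unnormalised as ℚᵘ using (mkℚᵘ; *≤*)
import Data.Rational.Unnormalised.Properties as ℚᵘₚ
open import Data.Fin as Fin using (Fin; toℕ)
open import Data.Fin.Properties as Finₚ using (_≟_)
open import Data.Product using (_×_; _,_; proj₁; proj₂; ∃-syntax)
open import Data.Product.Properties using (,-injectiveʳ) renaming (≡-dec to ×-≡-dec)
open import Data.Sum using (_⊎_; inj₁; inj₂; [_,_]′; swap)
open import Data.Unit using (⊤; tt)
open import Data.Empty using (⊥; ⊥-elim)
open import Data.List
  using (List; []; _∷_; [_]; _++_; _ʳ++_; length; filter; map; concatMap; reverse;
         take; drop; tabulate; allFin; upTo; cartesianProduct)
open import Data.List.Properties
  using (length-++; length-map; length-take; length-reverse; length-tabulate; length-upTo;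
         ++-assoc; ++-identityʳ; ++-ʳ++; unfold-reverse; reverse-++; filter-++;
         take++drop≡id; ∷-injectiveˡ; ≡-dec)
open import Data.List.Membership.Propositional using (_∈_; _∉_; find; lose)
open import Data.List.Membership.Propositional.Properties
import Data.List.Membership.DecPropositional as DecMembership
open import Data.List.Relation.Unary.Any as Any using (here; there)
open import Data.List.Relation.Unary.All as All using (All; []; _∷_)
import Data.List.Relation.Unary.All.Properties as Allₚ
open import Data.List.Relation.Unary.AllPairs using ([]; _∷_)
open import Data.List.Relation.Unary.Linked as Linked using (Linked; []; [-]; _∷_)
open import Data.List.Relation.Unary.Unique.Propositional using (Unique)
import Data.List.Relation.Unary.Unique.Propositional.Properties as Uniqueₚ
import Data.List.Relation.Unary.Unique.DecPropositional as DecUnique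
open import Data.List.Relation.Binary.Subset.Propositional using (_⊆_)
open import Data.List.Relation.Binary.Permutation.Propositional
  using (_↭_; ↭-sym; ↭-trans; ↭-refl; ↭-reflexive; ↭⇒↭ₛ; prep)
open import Data.List.Relation.Binary.Permutation.Propositional.Properties
  using (∈-resp-↭; ↭-length; ↭-reverse; shift; ++⁺; ++⁺ˡ; ++⁺ʳ; ++-comm; ++↭ʳ++)
import Data.List.Relation.Binary.Permutation.Setoid.Properties as Permₚ
open import Relation.Binary.PropositionalEquality hiding ([_])
open import Relation.Binary.Definitions using (DecidableEquality; tri<; tri≈; tri>)
open import Relation.Nullary
open import Relation.Nullary.Decidable using (decidable-stable)
open import Relation.Unary using (Pred; Decidable)
open import Function using (_∘_; id)
open import Defs

-- Client is an adversary, so every offer of Waiter must consist of Q edges that serve equally well.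
-- Hence expansion is obtained with a potential that no answer can raise, a vertex is absorbed only
-- once Pósa's lemma has given more than 46 Q ends, and for each s a chord is offered at all Q rungs
-- at once.
--
-- Five stars per vertex are dictated by counting. There are about (m / s)^(4 s) pairs of a set S of
-- size s and a set T of size at most 3 s, while five arcs from each vertex of S fall into T with
-- probability about (s / m)^(5 s); four would only balance the count. The ratio 3 is that of a set
-- together with its neighbours on a path.
--
-- Cycles through the two chords alone reach lengths up to about n / 2, and Hamilton cycles with a
-- shortcut reach down to about n / 2, so one ladder with t close to n / 2 serves both.
--
-- For Client, put x = n / Q, which is at most 10/11. The initial weight, relative to a finished
-- cycle, is at most x³/3 + x⁴/4 + ..., about 1.08 at x = 10/11. The threshold is 2, one for each
-- direction of a cycle, and this slack permits the crude estimate of the series.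

private variable
  ℓ ℓ₁ ℓ₂ : Level
  A B     : Set ℓ
  n q     : ℕ

-- Finite sums and lists without repetition

*-swapˡ : ∀ x y z → x * (y * z) ≡ y * (x * z)
*-swapˡ = solve-∀

∑ ∏ : List A → (A → ℕ) → ℕ
∑ []       f = 0
∑ (x ∷ xs) f = f x + ∑ xs f
∏ []       f = 1
∏ (x ∷ xs) f = f x * ∏ xs f

∑-++ : ∀ (xs ys : List A) f → ∑ (xs ++ ys) f ≡ ∑ xs f + ∑ ys f
∑-++ []       ys f = refl
∑-++ (x ∷ xs) ys f = trans (cong (f x +_) (∑-++ xs ys f)) (sym (+-assoc (f x) _ _))

∑-mono : ∀ (xs : List A) {f g} → (∀ {x} → x ∈ xs → f x ≤ g x) → ∑ xs f ≤ ∑ xs g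
∑-mono []       h = z≤n
∑-mono (x ∷ xs) h = +-mono-≤ (h (here refl)) (∑-mono xs (h ∘ there))

∑-cong : ∀ (xs : List A) {f g} → (∀ {x} → x ∈ xs → f x ≡ g x) → ∑ xs f ≡ ∑ xs g
∑-cong []       h = refl
∑-cong (x ∷ xs) h = cong₂ _+_ (h (here refl)) (∑-cong xs (h ∘ there))

∑-distrib-+ : ∀ (xs : List A) f g → ∑ xs (λ x → f x + g x) ≡ ∑ xs f + ∑ xs g
∑-distrib-+ []       f g = refl
∑-distrib-+ (x ∷ xs) f g =
  trans (cong (f x + g x +_) (∑-distrib-+ xs f g)) (interchange (f x) (g x) _ _)
  where
  interchange : ∀ a b c d → a + b + (c + d) ≡ a + c + (b + d)
  interchange = solve-∀

∑-*ˡ : ∀ (xs : List A) c f → ∑ xs (λ x → c * f x) ≡ c * ∑ xs f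
∑-*ˡ []       c f = sym (*-zeroʳ c)
∑-*ˡ (x ∷ xs) c f = trans (cong (c * f x +_) (∑-*ˡ xs c f)) (sym (*-distribˡ-+ c (f x) _))

∑-const : ∀ (xs : List A) c → ∑ xs (λ _ → c) ≡ length xs * c
∑-const []       c = refl
∑-const (x ∷ xs) c = cong (c +_) (∑-const xs c)

∑-swap : ∀ (xs : List A) (ys : List B) (f : A → B → ℕ) →
         ∑ xs (λ x → ∑ ys (f x)) ≡ ∑ ys (λ y → ∑ xs (λ x → f x y))
∑-swap []       ys f = sym (trans (∑-const ys 0) (*-zeroʳ (length ys)))
∑-swap (x ∷ xs) ys f = trans (cong (∑ ys (f x) +_) (∑-swap xs ys f))
  (sym (∑-distrib-+ ys (f x) (λ y → ∑ xs (λ x′ → f x′ y))))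

∑-map : ∀ (g : B → A) (xs : List B) f → ∑ (map g xs) f ≡ ∑ xs (f ∘ g)
∑-map g []       f = refl
∑-map g (x ∷ xs) f = cong (f (g x) +_) (∑-map g xs f)

∑-concatMap : ∀ (g : B → List A) (xs : List B) f → ∑ (concatMap g xs) f ≡ ∑ xs (λ x → ∑ (g x) f)
∑-concatMap g []       f = refl
∑-concatMap g (x ∷ xs) f =
  trans (∑-++ (g x) _ f) (cong (∑ (g x) f +_) (∑-concatMap g xs f))

≤-∑ : ∀ {xs : List A} {x} f → x ∈ xs → f x ≤ ∑ xs f
≤-∑ f (here refl) = m≤m+n _ _
≤-∑ f (there i)   = ≤-trans (≤-∑ f i) (m≤n+m _ _)

≤-∑₂ : ∀ {xs : List A} {x y} f → x ∈ xs → y ∈ xs → x ≢ y → f x + f y ≤ ∑ xs f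
≤-∑₂ f (here refl) (here refl) x≢y = ⊥-elim (x≢y refl)
≤-∑₂ f (here refl) (there j)   x≢y = +-monoʳ-≤ _ (≤-∑ f j)
≤-∑₂ {x = x} {y} f (there i) (here refl) x≢y =
  ≤-trans (≤-reflexive (+-comm (f x) (f y))) (+-monoʳ-≤ _ (≤-∑ f i))
≤-∑₂ f (there i)   (there j)   x≢y = ≤-trans (≤-∑₂ f i j x≢y) (m≤n+m _ _)

-- Discarding an entry above `b` leaves a list that still satisfies the hypothesis. Client finds
-- here a choice no worse than the average.
≤-average : ∀ (x : A) xs f b → ∑ (x ∷ xs) f ≤ length (x ∷ xs) * b → ∃[ z ] (z ∈ x ∷ xs × f z ≤ b)
≤-average x []       f b h = x , here refl , +-cancelʳ-≤ 0 _ _ h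
≤-average x (y ∷ ys) f b h with f x ≤? b
... | yes fx≤b = x , here refl , fx≤b
... | no  fx≰b =
  let z , z∈ , fz≤b = ≤-average y ys f b
        (+-cancelˡ-≤ b _ _ (≤-trans (+-monoˡ-≤ _ (<⇒≤ (≰⇒> fx≰b))) h))
  in z , there z∈ , fz≤b

∏-mono : ∀ (xs : List A) {f g} → (∀ {x} → x ∈ xs → f x ≤ g x) → ∏ xs f ≤ ∏ xs g
∏-mono []       h = ≤-refl
∏-mono (x ∷ xs) h = *-mono-≤ (h (here refl)) (∏-mono xs (h ∘ there))

∏-const : ∀ (xs : List A) {f} c → (∀ {x} → x ∈ xs → f x ≡ c) → ∏ xs f ≡ c ^ length xs
∏-const []       c h = refl
∏-const (x ∷ xs) c h = cong₂ _*_ (h (here refl)) (∏-const xs c (h ∘ there))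

∏-++ : ∀ (xs ys : List A) f → ∏ (xs ++ ys) f ≡ ∏ xs f * ∏ ys f
∏-++ []       ys f = sym (+-identityʳ _)
∏-++ (x ∷ xs) ys f = trans (cong (f x *_) (∏-++ xs ys f)) (sym (*-assoc (f x) _ _))

Unique-∉ : ∀ {x : A} {xs} → Unique (x ∷ xs) → x ∉ xs
Unique-∉ (x≢ ∷ _) x∈ = All.lookup x≢ x∈ refl

∉-Unique : ∀ {x : A} {xs} → x ∉ xs → Unique xs → Unique (x ∷ xs)
∉-Unique x∉ u = Allₚ.¬Any⇒All¬ _ x∉ ∷ u

Unique-⊆-length : ∀ {xs ys : List A} → Unique xs → xs ⊆ ys → length xs ≤ length ys
Unique-⊆-length {xs = []}     _        _ = z≤n
Unique-⊆-length {xs = x ∷ xs} {ys} u@(_ ∷ u′) s with ∈-∃++ (s (here refl))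
... | bs , cs , refl = ≤-trans (s≤s (Unique-⊆-length u′ s′)) (≤-reflexive len)
  where
  s′ : xs ⊆ bs ++ cs
  s′ {z} z∈ with ∈-++⁻ bs (s (there z∈))
  ... | inj₁ i           = ∈-++⁺ˡ i
  ... | inj₂ (here refl) = ⊥-elim (Unique-∉ u z∈)
  ... | inj₂ (there i)   = ∈-++⁺ʳ bs i
  len : suc (length (bs ++ cs)) ≡ length (bs ++ x ∷ cs)
  len = trans (cong suc (length-++ bs)) (trans (sym (+-suc (length bs) _)) (sym (length-++ bs)))

Unique-map : ∀ (f : A → B) {xs} → (∀ {x y} → x ∈ xs → y ∈ xs → f x ≡ f y → x ≡ y) →
             Unique xs → Unique (map f xs)
Unique-map f {[]}     inj _          = []
Unique-map f {x ∷ xs} inj u@(_ ∷ u′) = ∉-Unique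
  (λ i → let y , y∈ , eq = ∈-map⁻ f i in Unique-∉ u (subst (_∈ xs) (sym (inj (here refl) (there y∈) eq)) y∈))
  (Unique-map f (λ i j → inj (there i) (there j)) u′)

module _ {P : Pred A ℓ₁} (P? : Decidable P) where

  length-filter-¬ : ∀ xs → length xs ≡ length (filter P? xs) + length (filter (λ x → ¬? (P? x)) xs)
  length-filter-¬ [] = refl
  length-filter-¬ (x ∷ xs) with P? x
  ... | yes _ = cong suc (length-filter-¬ xs)
  ... | no  _ = trans (cong suc (length-filter-¬ xs)) (sym (+-suc _ _))

  module _ {R : Pred A ℓ₂} (R? : Decidable R) where

    -- Imposing one more condition loses at most the elements that violate it. Iterated, this counts
    -- the vertices that are eligible for a star.
    length-filter-×-dec : ∀ xs → length (filter P? xs) ≤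
      length (filter (λ x → P? x ×-dec R? x) xs) + length (filter (λ x → ¬? (R? x)) xs)
    length-filter-×-dec [] = z≤n
    length-filter-×-dec (x ∷ xs) with P? x | R? x
    ... | yes _ | yes _ = s≤s (length-filter-×-dec xs)
    ... | yes _ | no  _ = ≤-trans (s≤s (length-filter-×-dec xs)) (≤-reflexive (sym (+-suc _ _)))
    ... | no  _ | yes _ = length-filter-×-dec xs
    ... | no  _ | no  _ = ≤-trans (length-filter-×-dec xs) (+-monoʳ-≤ _ (n≤1+n _))

  markov : ∀ (xs : List A) f t → (∀ {x} → P x → t ≤ f x) → length (filter P? xs) * t ≤ ∑ xs f
  markov []       f t h = z≤n
  markov (x ∷ xs) f t h with P? x
  ... | yes Px = +-mono-≤ (h Px) (markov xs f t h)
  ... | no  _  = ≤-trans (markov xs f t h) (m≤n+m _ _)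

-- Counting sublists

-- Two terms of the binomial expansion. It acts as a discrete integral of a power, both for counting
-- sublists and for summing powers.
^-suc-lower : ∀ x t → x ^ suc t + suc t * x ^ t ≤ suc x ^ suc t
^-suc-lower x zero    = ≤-reflexive (lem x)
  where
  lem : ∀ x → x * 1 + 1 ≡ suc x * 1
  lem = solve-∀
^-suc-lower x (suc t) = begin
  x ^ suc (suc t) + suc (suc t) * x ^ suc t      ≤⟨ m≤m+n _ (suc t * x ^ t) ⟩
  x * x ^ suc t + suc (suc t) * x ^ suc t + suc t * x ^ t ≡⟨ lem x (x ^ t) t ⟩
  suc x * (x ^ suc t + suc t * x ^ t)            ≤⟨ *-monoʳ-≤ (suc x) (^-suc-lower x t) ⟩
  suc x * suc x ^ suc t                          ∎
  where
  open ≤-Reasoning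
  lem : ∀ x y t → x * (x * y) + suc (suc t) * (x * y) + suc t * y ≡ suc x * (x * y + suc t * y)
  lem = solve-∀

^-suc-upper : ∀ x t → suc x ^ suc t ≤ x ^ suc t + suc t * suc x ^ t
^-suc-upper x zero    = ≤-reflexive (lem x)
  where
  lem : ∀ x → suc x * 1 ≡ x * 1 + 1
  lem = solve-∀
^-suc-upper x (suc t) = begin
  suc x * suc x ^ suc t                                    ≤⟨ *-monoʳ-≤ (suc x) (^-suc-upper x t) ⟩
  suc x * (x ^ suc t + suc t * suc x ^ t)                  ≡⟨ lem x (x ^ suc t) t (suc x ^ t) ⟩
  x * x ^ suc t + suc t * suc x ^ suc t + x ^ suc t        ≤⟨ +-monoʳ-≤ (x * x ^ suc t + suc t * suc x ^ suc t) (^-monoˡ-≤ (suc t) (n≤1+n x)) ⟩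
  x * x ^ suc t + suc t * suc x ^ suc t + suc x ^ suc t    ≡⟨ lem′ (x * x ^ suc t) t (suc x ^ suc t) ⟩
  x ^ suc (suc t) + suc (suc t) * suc x ^ suc t            ∎
  where
  open ≤-Reasoning
  lem : ∀ x y t z → suc x * (y + suc t * z) ≡ x * y + suc t * (suc x * z) + y
  lem = solve-∀
  lem′ : ∀ a t z → a + suc t * z + z ≡ a + suc (suc t) * z
  lem′ = solve-∀

-- A double induction in the manner of Pascal's rule: `^-suc-upper` splits the power into two terms,
-- each worth half of the bound. The case `x = t` is a crude form of Stirling's estimate.
^≤!*2^ : ∀ x t → x ^ t ≤ t ! * 2 ^ (x + t)
^≤!*2^ x       zero    = ≤-trans (m^n>0 2 (x + 0)) (m≤m+n _ 0)
^≤!*2^ zero    (suc t) = z≤n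
^≤!*2^ (suc x) (suc t) = begin
  suc x ^ suc t                                             ≤⟨ ^-suc-upper x t ⟩
  x ^ suc t + suc t * suc x ^ t                             ≤⟨ +-mono-≤ (^≤!*2^ x (suc t)) (*-monoʳ-≤ (suc t) (^≤!*2^ (suc x) t)) ⟩
  suc t ! * 2 ^ (x + suc t) + suc t * (t ! * 2 ^ suc (x + t)) ≡⟨ cong (λ e → suc t ! * 2 ^ e + suc t * (t ! * 2 ^ suc (x + t))) (+-suc x t) ⟩
  suc t * t ! * 2 ^ suc (x + t) + suc t * (t ! * 2 ^ suc (x + t)) ≡⟨ lem (suc t) (t !) (2 ^ suc (x + t)) ⟩
  suc t ! * 2 ^ suc (suc (x + t))                           ≡⟨ cong (λ e → suc t ! * 2 ^ suc e) (sym (+-suc x t)) ⟩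
  suc t ! * 2 ^ (suc x + suc t)                             ∎
  where
  open ≤-Reasoning
  lem : ∀ a b c → a * b * c + a * (b * c) ≡ a * b * (2 * c)
  lem = solve-∀

n^n≤n!*4^n : ∀ t → t ^ t ≤ t ! * 4 ^ t
n^n≤n!*4^n t = ≤-trans (^≤!*2^ t t) (≤-reflexive (cong (t ! *_)
  (trans (cong (2 ^_) (cong (t +_) (sym (+-identityʳ t)))) (sym (^-*-assoc 2 2 t)))))

-- `combs≤` admits all shorter sublists because the target sets of the expansion argument may lose
-- elements when they are restricted to `W`.
combs combs≤ : ℕ → List A → List (List A)
combs  zero    xs       = [ [] ]
combs  (suc s) []       = []
combs  (suc s) (x ∷ xs) = map (x ∷_) (combs s xs) ++ combs (suc s) xs
combs≤ zero    xs       = [ [] ]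
combs≤ (suc s) []       = [ [] ]
combs≤ (suc s) (x ∷ xs) = map (x ∷_) (combs≤ s xs) ++ combs≤ (suc s) xs

length-map-++ : ∀ (f : B → A) xs {ys} → length (map f xs ++ ys) ≡ length xs + length ys
length-map-++ f xs {ys} = trans (length-++ (map f xs)) (cong (_+ length ys) (length-map f xs))

-- Pascal's rule becomes `^-suc-lower`. The summand `t` in the base covers an empty `xs`, where one
-- sublist is still counted.
length-combs≤ : ∀ t (xs : List A) → length (combs≤ t xs) * t ! ≤ (length xs + t) ^ t
length-combs≤ zero    xs       = ≤-refl
length-combs≤ (suc t) []       = begin
  1 * suc t !             ≡⟨ *-identityˡ (suc t !) ⟩
  suc t !                 ≤⟨ n!≤n^n (suc t) ⟩
  suc t ^ suc t           ∎
  where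
  open ≤-Reasoning
  n!≤n^n : ∀ t → t ! ≤ t ^ t
  n!≤n^n zero    = ≤-refl
  n!≤n^n (suc t) = *-monoʳ-≤ (suc t) (≤-trans (n!≤n^n t) (^-monoˡ-≤ t (n≤1+n t)))
length-combs≤ (suc t) (x ∷ xs) = begin
  length (map (x ∷_) (combs≤ t xs) ++ combs≤ (suc t) xs) * suc t !
    ≡⟨ cong (_* suc t !) (length-map-++ (x ∷_) (combs≤ t xs)) ⟩
  (length (combs≤ t xs) + length (combs≤ (suc t) xs)) * suc t !
    ≡⟨ lem (length (combs≤ t xs)) (length (combs≤ (suc t) xs)) t (t !) ⟩
  length (combs≤ (suc t) xs) * suc t ! + suc t * (length (combs≤ t xs) * t !)
    ≤⟨ +-mono-≤ (length-combs≤ (suc t) xs) (*-monoʳ-≤ (suc t) (≤-trans (length-combs≤ t xs) (^-monoˡ-≤ t (+-monoʳ-≤ (length xs) (n≤1+n t))))) ⟩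
  (length xs + suc t) ^ suc t + suc t * (length xs + suc t) ^ t
    ≤⟨ ^-suc-lower (length xs + suc t) t ⟩
  suc (length xs + suc t) ^ suc t ∎
  where
  open ≤-Reasoning
  lem : ∀ a b t f → (a + b) * (suc t * f) ≡ b * (suc t * f) + suc t * (a * f)
  lem = solve-∀

length-combs-≤ : ∀ t (xs : List A) → length (combs t xs) ≤ length (combs≤ t xs)
length-combs-≤ zero    xs       = ≤-refl
length-combs-≤ (suc t) []       = z≤n
length-combs-≤ (suc t) (x ∷ xs)
  = subst₂ _≤_ (sym (length-map-++ (x ∷_) (combs t xs))) (sym (length-map-++ (x ∷_) (combs≤ t xs)))
      (+-mono-≤ (length-combs-≤ t xs) (length-combs-≤ (suc t) xs))

∈-combs-length : ∀ s {xs : List A} {S} → S ∈ combs s xs → length S ≡ s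
∈-combs-length zero    (here refl) = refl
∈-combs-length (suc s) {x ∷ xs} i with ∈-++⁻ (map (x ∷_) (combs s xs)) i
... | inj₂ j = ∈-combs-length (suc s) {xs} j
... | inj₁ j with ∈-map⁻ (x ∷_) j
...   | S , S∈ , refl = cong suc (∈-combs-length s S∈)

∈-combs-⊆ : ∀ s {xs : List A} {S} → S ∈ combs s xs → S ⊆ xs
∈-combs-⊆ zero    (here refl) ()
∈-combs-⊆ (suc s) {x ∷ xs} i z∈ with ∈-++⁻ (map (x ∷_) (combs s xs)) i
... | inj₂ j = there (∈-combs-⊆ (suc s) j z∈)
... | inj₁ j with ∈-map⁻ (x ∷_) j | z∈
...   | S , S∈ , refl | here refl = here refl
...   | S , S∈ , refl | there z∈′ = there (∈-combs-⊆ s S∈ z∈′)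

∈-combs-Unique : ∀ s {xs : List A} {S} → Unique xs → S ∈ combs s xs → Unique S
∈-combs-Unique zero    u (here refl) = []
∈-combs-Unique (suc s) {x ∷ xs} u@(_ ∷ u′) i with ∈-++⁻ (map (x ∷_) (combs s xs)) i
... | inj₂ j = ∈-combs-Unique (suc s) u′ j
... | inj₁ j with ∈-map⁻ (x ∷_) j
...   | S , S∈ , refl = ∉-Unique (Unique-∉ u ∘ ∈-combs-⊆ s S∈) (∈-combs-Unique s u′ S∈)

∈-combs≤-length : ∀ s {xs : List A} {S} → S ∈ combs≤ s xs → length S ≤ s
∈-combs≤-length zero             (here refl) = z≤n
∈-combs≤-length (suc s) {[]}     (here refl) = z≤n
∈-combs≤-length (suc s) {x ∷ xs} i with ∈-++⁻ (map (x ∷_) (combs≤ s xs)) i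
... | inj₂ j = ∈-combs≤-length (suc s) {xs} j
... | inj₁ j with ∈-map⁻ (x ∷_) j
...   | S , S∈ , refl = s≤s (∈-combs≤-length s S∈)

module _ {P : Pred A ℓ₁} (P? : Decidable P) where

  filter∈combs : ∀ xs → filter P? xs ∈ combs (length (filter P? xs)) xs
  filter∈combs [] = here refl
  filter∈combs (x ∷ xs) with P? x
  ... | yes _ = ∈-++⁺ˡ (∈-map⁺ (x ∷_) (filter∈combs xs))
  ... | no  _ with filter P? xs | filter∈combs xs
  ...   | []     | _ = here refl
  ...   | _ ∷ ys | i = ∈-++⁺ʳ (map (x ∷_) (combs (length ys) xs)) i

  filter∈combs≤ : ∀ t xs → length (filter P? xs) ≤ t → filter P? xs ∈ combs≤ t xs
  filter∈combs≤ zero    xs l with filter P? xs | l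
  ... | [] | _ = here refl
  filter∈combs≤ (suc t) [] l = here refl
  filter∈combs≤ (suc t) (x ∷ xs) l with P? x
  ... | yes _ = ∈-++⁺ˡ (∈-map⁺ (x ∷_) (filter∈combs≤ t xs (s≤s⁻¹ l)))
  ... | no  _ = ∈-++⁺ʳ (map (x ∷_) (combs≤ t xs)) (filter∈combs≤ (suc t) xs l)

^-distribʳ-* : ∀ a b t → (a * b) ^ t ≡ a ^ t * b ^ t
^-distribʳ-* a b zero    = refl
^-distribʳ-* a b (suc t) = trans (cong (a * b *_) (^-distribʳ-* a b t)) (lem a b (a ^ t) (b ^ t))
  where
  lem : ∀ a b c d → a * b * (c * d) ≡ a * c * (b * d)
  lem = solve-∀

-- A bound (8 m / s)^t on the number of sublists: `t !` is at least (t / 4)^t, `m + t` is at most 2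
-- m, and `s ≤ t`.
length-combs≤-power : ∀ s t m (xs : List A) → length xs ≡ m → t ≤ m → s ≤ t →
                      length (combs≤ t xs) * s ^ t ≤ (8 * m) ^ t
length-combs≤-power s t m xs refl t≤m s≤t = begin
  L * s ^ t              ≤⟨ *-monoʳ-≤ L (≤-trans (^-monoˡ-≤ t s≤t) (n^n≤n!*4^n t)) ⟩
  L * (t ! * 4 ^ t)      ≡⟨ sym (*-assoc L _ _) ⟩
  L * t ! * 4 ^ t        ≤⟨ *-monoˡ-≤ (4 ^ t) (length-combs≤ t xs) ⟩
  (m + t) ^ t * 4 ^ t    ≤⟨ *-monoˡ-≤ (4 ^ t) (^-monoˡ-≤ t (+-monoʳ-≤ m t≤m)) ⟩
  (m + m) ^ t * 4 ^ t    ≡⟨ sym (^-distribʳ-* (m + m) 4 t) ⟩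
  ((m + m) * 4) ^ t      ≡⟨ cong (_^ t) (lem m) ⟩
  (8 * m) ^ t            ∎
  where
  open ≤-Reasoning
  L = length (combs≤ t xs)
  lem : ∀ m → (m + m) * 4 ≡ 8 * m
  lem = solve-∀

-- κ = 8⁴ · 2 · 12⁵ is what the union bound costs.
abstract
  κ : ℕ
  κ = 4096 * (2 * 248832)

  κ-≡ : κ ≡ 4096 * (2 * 248832)
  κ-≡ = refl

  3≤κ : 3 ≤ κ
  3≤κ = ≤ᵇ⇒≤ 3 κ _

κ*-bound : ∀ {s m} → κ * s ≤ m → s ≤ m
κ*-bound {s} h = ≤-trans (≤-trans (m≤m+n s _) (*-monoˡ-≤ s 3≤κ)) h

module _ (s m : ℕ) (xs : List A) (len : length xs ≡ m) (κs≤m : κ * s ≤ m) where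

  private
    3s≤m : 3 * s ≤ m
    3s≤m = ≤-trans (*-monoˡ-≤ s 3≤κ) κs≤m

    s≤m : s ≤ m
    s≤m = κ*-bound κs≤m

    C₁ C₂ : ℕ
    C₁ = length (combs s xs)
    C₂ = length (combs≤ (3 * s) xs)

    ^5* : ∀ a → a ^ (5 * s) ≡ a ^ s * (a ^ s * (a ^ (3 * s)))
    ^5* a = trans (cong (a ^_) (lem s)) (trans (^-distribˡ-+-* a s (s + 3 * s))
              (cong (a ^ s *_) (^-distribˡ-+-* a s (3 * s))))
      where
      lem : ∀ s → 5 * s ≡ s + (s + 3 * s)
      lem = solve-∀

  -- The pairs number at most (8 m / s)^(4 s), and each is confined with probability (12 s / m)^(5
  -- s). The product is (8⁴ 12⁵ s / m)^s, at most 2^(-s) since κ s ≤ m.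
  union-bound : 2 ^ s * (C₁ * C₂) * (12 * s) ^ (5 * s) ≤ m ^ (5 * s)
  union-bound = begin
    2 ^ s * (C₁ * C₂) * (12 * s) ^ (5 * s)
      ≡⟨ cong (2 ^ s * (C₁ * C₂) *_) (trans (^5* (12 * s)) (cong₂ _*_ (^-distribʳ-* 12 s s)
           (cong₂ _*_ (^-distribʳ-* 12 s s) (^-distribʳ-* 12 s (3 * s))))) ⟩
    2 ^ s * (C₁ * C₂) * (12 ^ s * s ^ s * (12 ^ s * s ^ s * (12 ^ (3 * s) * s ^ (3 * s))))
      ≡⟨ lem₁ (2 ^ s) C₁ C₂ (12 ^ s) (s ^ s) (12 ^ (3 * s)) (s ^ (3 * s)) ⟩
    C₁ * s ^ s * (C₂ * s ^ (3 * s)) * (2 ^ s * (12 ^ s * (12 ^ s * 12 ^ (3 * s))) * s ^ s)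
      ≤⟨ *-monoˡ-≤ (2 ^ s * (12 ^ s * (12 ^ s * 12 ^ (3 * s))) * s ^ s) (*-mono-≤
           (≤-trans (*-monoˡ-≤ (s ^ s) (length-combs-≤ s xs)) (length-combs≤-power s s m xs len s≤m ≤-refl))
           (length-combs≤-power s (3 * s) m xs len 3s≤m (m≤m+n s _))) ⟩
    (8 * m) ^ s * (8 * m) ^ (3 * s) * (2 ^ s * (12 ^ s * (12 ^ s * 12 ^ (3 * s))) * s ^ s)
      ≡⟨ cong₂ _*_ (trans (sym (^-distribˡ-+-* (8 * m) s (3 * s))) (^-distribʳ-* 8 m (4 * s)))
           (cong (λ z → 2 ^ s * z * s ^ s) (sym (^5* 12))) ⟩
    8 ^ (4 * s) * m ^ (4 * s) * (2 ^ s * 12 ^ (5 * s) * s ^ s)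
      ≡⟨ lem₂ (8 ^ (4 * s)) (m ^ (4 * s)) (2 ^ s) (12 ^ (5 * s)) (s ^ s) ⟩
    m ^ (4 * s) * (8 ^ (4 * s) * (2 ^ s * 12 ^ (5 * s)) * s ^ s)
      ≡⟨ cong (λ z → m ^ (4 * s) * (z * s ^ s)) powers ⟩
    m ^ (4 * s) * (κ ^ s * s ^ s)
      ≡⟨ cong (m ^ (4 * s) *_) (sym (^-distribʳ-* κ s s)) ⟩
    m ^ (4 * s) * (κ * s) ^ s
      ≤⟨ *-monoʳ-≤ (m ^ (4 * s)) (^-monoˡ-≤ s κs≤m) ⟩
    m ^ (4 * s) * m ^ s
      ≡⟨ trans (sym (^-distribˡ-+-* m (4 * s) s)) (cong (m ^_) (+-comm (4 * s) s)) ⟩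
    m ^ (5 * s) ∎
    where
    open ≤-Reasoning
    powers : 8 ^ (4 * s) * (2 ^ s * 12 ^ (5 * s)) ≡ κ ^ s
    powers = trans (cong₂ (λ y z → y * (2 ^ s * z)) (sym (^-*-assoc 8 4 s)) (sym (^-*-assoc 12 5 s)))
      (trans (cong (4096 ^ s *_) (sym (^-distribʳ-* 2 248832 s))) (trans (sym (^-distribʳ-* 4096 (2 * 248832) s)) (cong (_^ s) (sym κ-≡))))
    lem₁ : ∀ p c d x y z w → p * (c * d) * (x * y * (x * y * (z * w))) ≡
                             c * y * (d * w) * (p * (x * (x * z)) * y)
    lem₁ = solve-∀
    lem₂ : ∀ a b c d e → a * b * (c * d * e) ≡ b * (a * (c * d) * e)
    lem₂ = solve-∀

-- The first moment method for out-expansion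

𝟙 : ∀ {p} {P : Set p} → Dec P → ℕ
𝟙 (yes _) = 1
𝟙 (no _)  = 0

𝟙-≤1 : ∀ {p} {P : Set p} (d : Dec P) → 𝟙 d ≤ 1
𝟙-≤1 (yes _) = ≤-refl
𝟙-≤1 (no _)  = z≤n

factor : ∀ {p} {P : Set p} → Dec P → ℕ → ℕ → ℕ
factor (yes _) a b = a
factor (no _)  a b = b

module _ {p p′} {P : Set p} {P′ : Set p′} where

  𝟙-mono : (d : Dec P) (d′ : Dec P′) → (P → P′) → 𝟙 d ≤ 𝟙 d′
  𝟙-mono (no _)  d′       _ = z≤n
  𝟙-mono (yes _) (yes _)  _ = ≤-refl
  𝟙-mono (yes x) (no ¬x′) f = ⊥-elim (¬x′ (f x))

  factor-mono : ∀ {a b b′} (d : Dec P) (d′ : Dec P′) → (P → P′) → b ≤ a → b ≤ b′ → factor d a b ≤ factor d′ a b′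
  factor-mono (yes _) (yes _)  _ _ _  = ≤-refl
  factor-mono (yes x) (no ¬x′) f _ _  = ⊥-elim (¬x′ (f x))
  factor-mono (no _)  (yes _)  _ h _  = h
  factor-mono (no _)  (no _)   _ _ h  = h

𝟙-no : ∀ {p} {P : Set p} (d : Dec P) → ¬ P → 𝟙 d ≡ 0
𝟙-no (yes x) ¬x = ⊥-elim (¬x x)
𝟙-no (no _)  _  = refl

factor-no : ∀ {p} {P : Set p} (d : Dec P) {a b} → ¬ P → factor d a b ≡ b
factor-no (yes x) ¬x = ⊥-elim (¬x x)
factor-no (no _)  _  = refl

module _ {a p} {A : Set a} {P : Pred A p} (P? : Decidable P) where

  ∏-factor : ∀ xs a b → ∏ xs (λ x → factor (P? x) a b) ≡
             a ^ length (filter P? xs) * b ^ length (filter (λ x → ¬? (P? x)) xs)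
  ∏-factor []       a b = refl
  ∏-factor (x ∷ xs) a b with P? x
  ... | yes _ = trans (cong (a *_) (∏-factor xs a b)) (sym (*-assoc a _ _))
  ... | no  _ = trans (cong (b *_) (∏-factor xs a b)) (*-swapˡ b (a ^ length (filter P? xs)) _)

  length-filter-≡-∑ : ∀ xs → length (filter P? xs) ≡ ∑ xs (λ x → 𝟙 (P? x))
  length-filter-≡-∑ [] = refl
  length-filter-≡-∑ (x ∷ xs) with P? x
  ... | yes _ = cong suc (length-filter-≡-∑ xs)
  ... | no  _ = length-filter-≡-∑ xs

module Expansion {a} {V : Set a} (_≟_ : DecidableEquality V) (W : List V) (W! : Unique W) where

  open DecMembership _≟_ using (_∈?_)

  m : ℕ
  m = length W

  length-filter-∈ : ∀ {xs} S → Unique xs → length (filter (_∈? S) xs) ≤ length S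
  length-filter-∈ {xs} S u = Unique-⊆-length (Uniqueₚ.filter⁺ (_∈? S) u)
    (λ i → proj₂ (∈-filter⁻ (_∈? S) {xs = xs} i))

  length-filter-∈-≡ : ∀ {S} → Unique S → S ⊆ W → length (filter (_∈? S) W) ≡ length S
  length-filter-∈-≡ {S} u s = ≤-antisym (length-filter-∈ S W!)
    (Unique-⊆-length u (λ i → ∈-filter⁺ (_∈? S) (s i) i))

  -- A triple `(s , S , T)`, with `s` the size of `S`, stands for a possible failure of expansion:
  -- all arcs out of `S` end in `T`.
  Item : Set a
  Item = ℕ × List V × List V

  items-of-size items : ℕ → List Item
  items-of-size s = concatMap (λ S → map (λ T → s , S , T) (combs≤ (3 * s) W)) (combs s W)
  items zero    = []
  items (suc k) = items-of-size (suc k) ++ items k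

  Confined : List (V × V) → Item → Set a
  Confined arcs (_ , S , T) = All (λ (v , y) → v ∈ S → y ∈ T) arcs

  confined? : ∀ arcs it → Dec (Confined arcs it)
  confined? arcs (_ , S , T) = All.all? (λ (v , y) → (v ∈? S) →-dec (y ∈? T)) arcs

  weight : List V → Item → ℕ
  weight cs (s , S , _) = ∏ cs (λ c → factor (c ∈? S) (12 * s) m)

  -- The expected number of confined items, scaled by m ^ length cs, when every
  -- centre still to be processed sends an arc into T with probability at most 12 s / m.
  Φ : List Item → List V → List (V × V) → ℕ
  Φ its cs arcs = ∑ its (λ it → 𝟙 (confined? arcs it) * weight cs it)

  module _ (its : List Item) (v : V) (cs : List V) (arcs : List (V × V)) where

    private
      c : Item → ℕ
      c it = 𝟙 (confined? arcs it) * weight cs it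
      inS : Item → ℕ
      inS (_ , S , _) = 𝟙 (v ∈? S)
      inT : V → Item → ℕ
      inT y (_ , _ , T) = 𝟙 (y ∈? T)
      miss : ℕ
      miss = ∑ its (λ it@(_ , S , _) → factor (v ∈? S) 0 (m * c it))

    -- The weight of the confined items that would survive the arc `(v , y)` although `v` lies in
    -- their `S`.
    danger : V → ℕ
    danger y = ∑ its (λ it → inS it * (inT y it * c it))

    private
      new : V → Item → ℕ
      new y it = 𝟙 (confined? ((v , y) ∷ arcs) it) * weight cs it

      -- An item with `v` outside `S` is indifferent to the new arc, and one with `v` in `S`
      -- survives only if `y ∈ T`. `old-≡` splits the previous potential in the same way, so only
      -- the second parts have to be compared.
      new-≤ : ∀ y it → m * new y it ≤
              factor (v ∈? proj₁ (proj₂ it)) 0 (m * c it) + m * (inS it * (inT y it * c it))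
      new-≤ y (s , S , T) with v ∈? S | y ∈? T | All.all? (λ (v , y) → (v ∈? S) →-dec (y ∈? T)) arcs
      ... | yes _ | yes _ | yes _ = *-monoʳ-≤ m (≤-reflexive (lem (weight cs (s , S , T))))
        where
        lem : ∀ w → w + 0 ≡ w + 0 + 0 + 0
        lem = solve-∀
      ... | yes _ | yes _ | no  _ = ≤-trans (≤-reflexive (*-zeroʳ m)) z≤n
      ... | yes _ | no  _ | yes _ = ≤-trans (≤-reflexive (*-zeroʳ m)) z≤n
      ... | yes _ | no  _ | no  _ = ≤-trans (≤-reflexive (*-zeroʳ m)) z≤n
      ... | no  _ | yes _ | yes _ = m≤m+n _ _
      ... | no  _ | yes _ | no  _ = m≤m+n _ _
      ... | no  _ | no  _ | yes _ = m≤m+n _ _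
      ... | no  _ | no  _ | no  _ = m≤m+n _ _

      old-≡ : ∀ it → 𝟙 (confined? arcs it) * weight (v ∷ cs) it ≡
              factor (v ∈? proj₁ (proj₂ it)) 0 (m * c it) + inS it * (12 * proj₁ it * c it)
      old-≡ it@(s , S , T) with v ∈? S
      ... | yes _ = lem (𝟙 (confined? arcs it)) (12 * s) (weight cs it)
        where
        lem : ∀ a b c → a * (b * c) ≡ b * (a * c) + 0
        lem = solve-∀
      ... | no _ = lem (𝟙 (confined? arcs it)) m (weight cs it)
        where
        lem : ∀ a b c → a * (b * c) ≡ b * (a * c) + 0
        lem = solve-∀

    ∑-danger-≤ : (∀ {it} → it ∈ its → length (proj₂ (proj₂ it)) ≤ 3 * proj₁ it) →
                 4 * ∑ W danger ≤ ∑ its (λ it → inS it * (12 * proj₁ it * c it))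
    ∑-danger-≤ small = begin
      4 * ∑ W danger
        ≡⟨ cong (4 *_) (∑-swap W its (λ y it → inS it * (inT y it * c it))) ⟩
      4 * ∑ its (λ it → ∑ W (λ y → inS it * (inT y it * c it)))
        ≡⟨ sym (∑-*ˡ its 4 _) ⟩
      ∑ its (λ it → 4 * ∑ W (λ y → inS it * (inT y it * c it)))
        ≤⟨ ∑-mono its each ⟩
      ∑ its (λ it → inS it * (12 * proj₁ it * c it)) ∎
      where
      open ≤-Reasoning
      lem : ∀ a b c → a * (b * c) ≡ a * c * b
      lem = solve-∀
      lem′ : ∀ a b c → 4 * (a * b * (3 * c)) ≡ a * (12 * c * b)
      lem′ = solve-∀
      each : ∀ {it} → it ∈ its → 4 * ∑ W (λ y → inS it * (inT y it * c it)) ≤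
                                  inS it * (12 * proj₁ it * c it)
      each {it@(s , S , T)} i = begin
        4 * ∑ W (λ y → inS it * (inT y it * c it))
          ≡⟨ cong (4 *_) (trans (∑-cong W (λ {y} _ → lem (inS it) (inT y it) (c it)))
               (∑-*ˡ W (inS it * c it) (λ y → inT y it))) ⟩
        4 * (inS it * c it * ∑ W (λ y → inT y it))
          ≤⟨ *-monoʳ-≤ 4 (*-monoʳ-≤ (inS it * c it) (≤-trans
               (≤-reflexive (sym (length-filter-≡-∑ (_∈? T) W)))
               (≤-trans (length-filter-∈ T W!) (small i)))) ⟩
        4 * (inS it * c it * (3 * s))
          ≡⟨ lem′ (inS it) (c it) s ⟩
        inS it * (12 * s * c it) ∎

    -- The derandomised step. Any leaf whose danger is at most four times the average costs no more
    -- than what `weight` has charged to the centre `v` beforehand, so it does not matter which safe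
    -- leaf Client keeps.
    Φ-step : (∀ {it} → it ∈ its → length (proj₂ (proj₂ it)) ≤ 3 * proj₁ it) →
             ∀ {y} → m * danger y ≤ 4 * ∑ W danger →
             m * Φ its cs ((v , y) ∷ arcs) ≤ Φ its (v ∷ cs) arcs
    Φ-step small {y} safe = begin
      m * Φ its cs ((v , y) ∷ arcs)
        ≡⟨ sym (∑-*ˡ its m (new y)) ⟩
      ∑ its (λ it → m * new y it)
        ≤⟨ ∑-mono its (λ {it} _ → new-≤ y it) ⟩
      ∑ its (λ it → factor (v ∈? proj₁ (proj₂ it)) 0 (m * c it) + m * (inS it * (inT y it * c it)))
        ≡⟨ trans (∑-distrib-+ its _ _) (cong (miss +_) (∑-*ˡ its m _)) ⟩
      miss + m * danger y
        ≤⟨ +-monoʳ-≤ miss (≤-trans safe (∑-danger-≤ small)) ⟩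
      miss + ∑ its (λ it → inS it * (12 * proj₁ it * c it))
        ≡⟨ sym (∑-distrib-+ its _ _) ⟩
      ∑ its (λ it → factor (v ∈? proj₁ (proj₂ it)) 0 (m * c it) + inS it * (12 * proj₁ it * c it))
        ≡⟨ ∑-cong its (λ {it} _ → sym (old-≡ it)) ⟩
      Φ its (v ∷ cs) arcs ∎
      where open ≤-Reasoning

    safe? : ∀ y → Dec (m * danger y ≤ 4 * ∑ W danger)
    safe? y = m * danger y ≤? 4 * ∑ W danger

    -- Markov's inequality. An unsafe vertex exceeds the threshold strictly, which `suc` records;
    -- thus a total danger of 0 leaves no unsafe vertex.
    few-unsafe : 4 * length (filter (λ y → ¬? (safe? y)) W) ≤ m
    few-unsafe = helper (∑ W danger) (length (filter (λ y → ¬? (safe? y)) W))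
      (subst (λ z → length (filter (λ y → ¬? (safe? y)) W) * suc (4 * ∑ W danger) ≤ z) (∑-*ˡ W m danger)
        (markov (λ y → ¬? (safe? y)) W (λ y → m * danger y) (suc (4 * ∑ W danger)) ≰⇒>))
      where
      helper : ∀ D L → L * suc (4 * D) ≤ m * D → 4 * L ≤ m
      helper zero    zero    h = z≤n
      helper zero    (suc L) h = ⊥-elim (n≮0 (≤-trans h (≤-reflexive (*-zeroʳ m))))
      helper (suc D) L       h = *-cancelʳ-≤ (4 * L) m (suc D)
        (≤-trans (≤-reflexive (lem L (suc D))) (≤-trans (*-monoʳ-≤ L (n≤1+n (4 * suc D))) h))
        where
        lem : ∀ L D → 4 * L * D ≡ L * (4 * D)
        lem = solve-∀

  schedule : List V
  schedule = W ++ W ++ W ++ W ++ W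

  items-small : ∀ k {it} → it ∈ items k → length (proj₂ (proj₂ it)) ≤ 3 * proj₁ it
  items-small (suc k) i with ∈-++⁻ (items-of-size (suc k)) i
  ... | inj₂ j = items-small k j
  ... | inj₁ j with find (∈-concatMap⁻ (λ S → map (λ T → suc k , S , T) (combs≤ (3 * suc k) W))
                            {xs = combs (suc k) W} j)
  ...   | S , S∈ , j′ with ∈-map⁻ (λ T → suc k , S , T) j′
  ...     | T , T∈ , refl = ∈-combs≤-length (3 * suc k) {W} T∈

  ∈-items : ∀ k {s S T} → 1 ≤ s → s ≤ k → S ∈ combs s W → T ∈ combs≤ (3 * s) W → (s , S , T) ∈ items k
  ∈-items zero    () z≤n
  ∈-items (suc k) {s} {S} {T} 1≤s s≤k S∈ T∈ with m≤n⇒m<n∨m≡n s≤k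
  ... | inj₁ s<k  = ∈-++⁺ʳ (items-of-size (suc k)) (∈-items k 1≤s (s≤s⁻¹ s<k) S∈ T∈)
  ... | inj₂ refl = ∈-++⁺ˡ (∈-concatMap⁺ (λ S → map (λ T → suc k , S , T) (combs≤ (3 * suc k) W))
                      (Any.map (λ { refl → ∈-map⁺ _ T∈ }) S∈))

  weight-schedule : ∀ {s S T} → S ∈ combs s W → κ * s ≤ m →
    weight schedule (s , S , T) ≡ (12 * s) ^ (5 * s) * m ^ (5 * (m ∸ s))
  weight-schedule {s} {S} {T} S∈ κs≤m = begin
    ∏ schedule f
      ≡⟨ trans (∏-++ W _ f) (cong (Y *_) (trans (∏-++ W _ f) (cong (Y *_)
           (trans (∏-++ W _ f) (cong (Y *_) (∏-++ W W f)))))) ⟩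
    Y * (Y * (Y * (Y * Y)))
      ≡⟨ lem Y ⟩
    Y ^ 5
      ≡⟨ cong (_^ 5) (∏-factor (_∈? S) W (12 * s) m) ⟩
    ((12 * s) ^ length (filter (_∈? S) W) * m ^ length (filter (λ x → ¬? (x ∈? S)) W)) ^ 5
      ≡⟨ cong (_^ 5) (cong₂ (λ x y → (12 * s) ^ x * m ^ y) len len¬) ⟩
    ((12 * s) ^ s * m ^ (m ∸ s)) ^ 5
      ≡⟨ ^-distribʳ-* ((12 * s) ^ s) _ 5 ⟩
    ((12 * s) ^ s) ^ 5 * (m ^ (m ∸ s)) ^ 5
      ≡⟨ cong₂ _*_ (trans (^-*-assoc (12 * s) s 5) (cong ((12 * s) ^_) (*-comm s 5)))
                   (trans (^-*-assoc m (m ∸ s) 5) (cong (m ^_) (*-comm (m ∸ s) 5))) ⟩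
    (12 * s) ^ (5 * s) * m ^ (5 * (m ∸ s)) ∎
    where
    open ≡-Reasoning
    f : V → ℕ
    f c = factor (c ∈? S) (12 * s) m
    Y : ℕ
    Y = ∏ W f
    lem : ∀ y → y * (y * (y * (y * y))) ≡ y * (y * (y * (y * (y * 1))))
    lem = solve-∀
    len : length (filter (_∈? S) W) ≡ s
    len = trans (length-filter-∈-≡ (∈-combs-Unique s W! S∈) (∈-combs-⊆ s S∈)) (∈-combs-length s S∈)
    len¬ : length (filter (λ x → ¬? (x ∈? S)) W) ≡ m ∸ s
    len¬ = sym (trans (cong (_∸ s) (trans (length-filter-¬ (_∈? S) W) (cong (_+ _) len))) (m+n∸m≡n s _))

  Φ-items-of-size : ∀ s → κ * s ≤ m → 2 ^ s * Φ (items-of-size s) schedule [] ≤ m ^ (5 * m)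
  Φ-items-of-size s κs≤m = begin
    2 ^ s * Φ (items-of-size s) schedule []
      ≡⟨ cong (2 ^ s *_) (∑-concatMap (λ S → map (λ T → s , S , T) (combs≤ (3 * s) W)) (combs s W) _) ⟩
    2 ^ s * ∑ (combs s W) (λ S → ∑ (map (λ T → s , S , T) (combs≤ (3 * s) W)) g)
      ≡⟨ cong (2 ^ s *_) (∑-cong (combs s W) λ {S} S∈ →
           trans (∑-map (λ T → s , S , T) (combs≤ (3 * s) W) g)
             (trans (∑-cong (combs≤ (3 * s) W) (λ {T} _ → trans (*-identityˡ (weight schedule (s , S , T))) (weight-schedule {s} {S} {T} S∈ κs≤m)))
               (∑-const (combs≤ (3 * s) W) w))) ⟩
    2 ^ s * ∑ (combs s W) (λ S → length (combs≤ (3 * s) W) * w)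
      ≡⟨ cong (2 ^ s *_) (∑-const (combs s W) _) ⟩
    2 ^ s * (length (combs s W) * (length (combs≤ (3 * s) W) * w))
      ≡⟨ lem (2 ^ s) (length (combs s W)) (length (combs≤ (3 * s) W)) ((12 * s) ^ (5 * s)) _ ⟩
    2 ^ s * (length (combs s W) * length (combs≤ (3 * s) W)) * (12 * s) ^ (5 * s) * m ^ (5 * (m ∸ s))
      ≤⟨ *-monoˡ-≤ (m ^ (5 * (m ∸ s))) (union-bound s m W refl κs≤m) ⟩
    m ^ (5 * s) * m ^ (5 * (m ∸ s))
      ≡⟨ trans (sym (^-distribˡ-+-* m (5 * s) _)) (cong (m ^_)
           (trans (sym (*-distribˡ-+ 5 s (m ∸ s))) (cong (5 *_) (m+[n∸m]≡n (κ*-bound κs≤m))))) ⟩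
    m ^ (5 * m) ∎
    where
    open ≤-Reasoning
    w : ℕ
    w = (12 * s) ^ (5 * s) * m ^ (5 * (m ∸ s))
    g : Item → ℕ
    g it = 𝟙 (confined? [] it) * weight schedule it
    lem : ∀ p a b c d → p * (a * (b * (c * d))) ≡ p * (a * b) * c * d
    lem = solve-∀

  -- The sizes contribute at most 1/2, 1/4, ... of m^(5 m), in all the fraction 1 - 2^(-k). Keeping
  -- this exact form, written without subtraction, lets the induction close and makes the total
  -- strictly smaller than m^(5 m).
  Φ-items : ∀ k → κ * k ≤ m → 2 ^ k * Φ (items k) schedule [] + m ^ (5 * m) ≤ 2 ^ k * m ^ (5 * m)
  Φ-items zero    _ = m≤m+n _ 0
  Φ-items (suc k) h = begin
    2 ^ suc k * Φ (items (suc k)) schedule [] + M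
      ≡⟨ cong (λ z → 2 ^ suc k * z + M) (∑-++ (items-of-size (suc k)) (items k) _) ⟩
    2 ^ suc k * (F + R) + M
      ≡⟨ lem (2 ^ k) F R M ⟩
    2 ^ suc k * F + (2 * (2 ^ k * R) + M)
      ≤⟨ +-monoˡ-≤ (2 * (2 ^ k * R) + M) (Φ-items-of-size (suc k) h) ⟩
    M + (2 * (2 ^ k * R) + M)
      ≡⟨ lem′ (2 ^ k * R) M ⟩
    2 * (2 ^ k * R + M)
      ≤⟨ *-monoʳ-≤ 2 (Φ-items k (≤-trans (*-monoʳ-≤ κ (n≤1+n k)) h)) ⟩
    2 * (2 ^ k * M)
      ≡⟨ sym (*-assoc 2 (2 ^ k) M) ⟩
    2 ^ suc k * M ∎
    where
    open ≤-Reasoning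
    M F R : ℕ
    M = m ^ (5 * m)
    F = Φ (items-of-size (suc k)) schedule []
    R = Φ (items k) schedule []
    lem : ∀ p f r m → 2 * p * (f + r) + m ≡ 2 * p * f + (2 * (p * r) + m)
    lem = solve-∀
    lem′ : ∀ a m → m + (2 * a + m) ≡ 2 * (a + m)
    lem′ = solve-∀

  length-schedule : length schedule ≡ 5 * m
  length-schedule = trans (length-++ W) (cong (m +_) (trans (length-++ W) (cong (m +_)
    (trans (length-++ W) (cong (m +_) (trans (length-++ W) (cong (m +_) (sym (+-identityʳ m)))))))))

  Φ-start : ∀ k → 1 ≤ m → κ * k ≤ m → Φ (items k) schedule [] < m ^ length schedule
  Φ-start k 1≤m h = subst (λ e → Φ (items k) schedule [] < m ^ e) (sym length-schedule) (≰⇒> λ M≤Φ →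
    <⇒≱ (m^n>0 m {{>-nonZero 1≤m}} (5 * m)) (+-cancelˡ-≤ (2 ^ k * m ^ (5 * m)) _ _
      (≤-trans (+-monoˡ-≤ _ (*-monoʳ-≤ (2 ^ k) M≤Φ)) (≤-trans (Φ-items k h)
        (≤-reflexive (sym (+-identityʳ _)))))))

  Expands : ℕ → List (V × V) → Set a
  Expands k arcs = ∀ {S T} → Unique S → S ⊆ W → 1 ≤ length S → length S ≤ k → length T ≤ 3 * length S →
                   ∃[ v ] ∃[ y ] ((v , y) ∈ arcs × v ∈ S × y ∉ T)

  -- With no centre left, a confined item contributes 1 to the potential, so there is none. The sets
  -- `S` and `T` are replaced by filters of `W`, since `items` lists only sublists in the order of
  -- `W`.
  Φ-end : ∀ k arcs → (∀ {v y} → (v , y) ∈ arcs → y ∈ W) → Φ (items k) [] arcs < 1 → Expands k arcs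
  Φ-end k arcs inW small {S} {T} S! S⊆W 1≤s s≤k T≤ =
    let (v , y) , i , n = find (Allₚ.¬All⇒Any¬ (λ (v , y) → (v ∈? S′) →-dec (y ∈? T′)) arcs ¬conf)
        v∈ = decidable-stable (v ∈? S′) (λ v∉ → n (⊥-elim ∘ v∉))
    in v , y , i , proj₂ (∈-filter⁻ (_∈? S) {xs = W} v∈) ,
       λ y∈T → n (λ _ → ∈-filter⁺ (_∈? T) (inW i) y∈T)
    where
    S′ T′ : List V
    S′ = filter (_∈? S) W
    T′ = filter (_∈? T) W
    len : length S′ ≡ length S
    len = length-filter-∈-≡ S! S⊆W
    item∈ : (length S , S′ , T′) ∈ items k
    item∈ = ∈-items k 1≤s s≤k (subst (λ l → S′ ∈ combs l W) len (filter∈combs (_∈? S) W))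
      (filter∈combs≤ (_∈? T) (3 * length S) W (≤-trans (length-filter-∈ T W!) T≤))
    ¬conf : ¬ Confined arcs (length S , S′ , T′)
    ¬conf conf = <⇒≱ small (≤-trans (one (confined? arcs (length S , S′ , T′)))
      (≤-∑ (λ it → 𝟙 (confined? arcs it) * 1) item∈))
      where
      one : (d : Dec (Confined arcs (length S , S′ , T′))) → 1 ≤ 𝟙 d * 1
      one (yes _) = ≤-refl
      one (no ¬c) = ⊥-elim (¬c conf)

-- Strategy trees for Waiter

edge : Fin n → Fin n → Edge n
edge u v with u Fin.<? v
... | yes _ = u , v
... | no  _ = v , u

edge-cases : (u v : Fin n) → edge u v ≡ (u , v) ⊎ edge u v ≡ (v , u)
edge-cases u v with u Fin.<? v
... | yes _ = inj₁ refl
... | no  _ = inj₂ refl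

edge-< : {u v : Fin n} → u Fin.< v → edge u v ≡ (u , v)
edge-< {u = u} {v} u<v with u Fin.<? v
... | yes _ = refl
... | no ≮ = ⊥-elim (≮ u<v)

edge-≮ : {u v : Fin n} → ¬ u Fin.< v → edge u v ≡ (v , u)
edge-≮ {u = u} {v} ≮ with u Fin.<? v
... | yes u<v = ⊥-elim (≮ u<v)
... | no _ = refl

edge-comm : {u v : Fin n} → u ≢ v → edge u v ≡ edge v u
edge-comm {u = u} {v} u≢v with Finₚ.<-cmp u v
... | tri< u<v _ v≮u = trans (edge-< u<v) (sym (edge-≮ v≮u))
... | tri≈ _ u≡v _   = ⊥-elim (u≢v u≡v)
... | tri> u≮v _ v<u = trans (edge-≮ u≮v) (sym (edge-< v<u))

edge-injective : {u v u′ v′ : Fin n} → edge u v ≡ edge u′ v′ →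
                 (u ≡ u′ × v ≡ v′) ⊎ (u ≡ v′ × v ≡ u′)
edge-injective {u = u} {v} {u′} {v′} eq with edge-cases u v | edge-cases u′ v′
... | inj₁ e | inj₁ e′ with refl ← trans (sym e) (trans eq e′) = inj₁ (refl , refl)
... | inj₁ e | inj₂ e′ with refl ← trans (sym e) (trans eq e′) = inj₂ (refl , refl)
... | inj₂ e | inj₁ e′ with refl ← trans (sym e) (trans eq e′) = inj₂ (refl , refl)
... | inj₂ e | inj₂ e′ with refl ← trans (sym e) (trans eq e′) = inj₁ (refl , refl)

edge-injectiveʳ : {v y y′ : Fin n} → edge v y ≡ edge v y′ → y ≡ y′
edge-injectiveʳ eq with edge-injective eq
... | inj₁ (_ , p)    = p
... | inj₂ (refl , p) = p

∈-K : {u v : Fin n} → u Fin.< v → (u , v) ∈ K n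
∈-K {n} u<v = ∈-filter⁺ (λ (i , j) → i Fin.<? j)
  (∈-cartesianProduct⁺ (∈-allFin _) (∈-allFin _)) u<v

edge∈K : {u v : Fin n} → u ≢ v → edge u v ∈ K n
edge∈K {u = u} {v} u≢v with Finₚ.<-cmp u v
... | tri< u<v _ _   = subst (_∈ K _) (sym (edge-< u<v)) (∈-K u<v)
... | tri≈ _ u≡v _   = ⊥-elim (u≢v u≡v)
... | tri> u≮v _ v<u = subst (_∈ K _) (sym (edge-≮ u≮v)) (∈-K v<u)

Adj-sym : {H : Graph n} {u v : Fin n} → Adj H u v → Adj H v u
Adj-sym = swap

edge⇒Adj : {H : Graph n} {u v : Fin n} → edge u v ∈ H → Adj H u v
edge⇒Adj {H = H} {u} {v} i with edge-cases u v
... | inj₁ e = inj₁ (subst (_∈ H) e i)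
... | inj₂ e = inj₂ (subst (_∈ H) e i)

Adj-⊆ : {H H′ : Graph n} → H ⊆ H′ → {u v : Fin n} → Adj H u v → Adj H′ u v
Adj-⊆ s (inj₁ i) = inj₁ (s i)
Adj-⊆ s (inj₂ i) = inj₂ (s i)

Free : Position n → Fin n → Fin n → Set
Free P u v = edge u v ∈ free P

Free-sym : {P : Position n} {u v : Fin n} → u ≢ v → Free P u v → Free P v u
Free-sym {P = P} u≢v = subst (_∈ free P) (edge-comm u≢v)

-- A finite tree of offers that branches over the choices of Client and has `R` at its leaves.
-- Stages of Waiter's play compose by `_>>=_`, with no mention of histories; `ask` records that a
-- full round is still possible.
data Force (q : ℕ) (R : Position n → Set) (P : Position n) : Set where
  done : R P → Force q R P
  ask  : suc q ≤ length (free P) → (O : Offer q P) →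
         ((c : Choice O) → Force q R (afterRound P O c)) → Force q R P

infixl 1 _>>=_
_>>=_ : {R R′ : Position n → Set} {P : Position n} →
        Force q R P → (∀ {P′} → R P′ → Force q R′ P′) → Force q R′ P
done r    >>= f = f r
ask m O k >>= f = ask m O (λ c → k c >>= f)

force-map : {R R′ : Position n → Set} {P : Position n} →
            (∀ {P′} → R P′ → R′ P′) → Force q R P → Force q R′ P
force-map f t = t >>= λ r → done (f r)

record AfterOffer {n} (P : Position n) (es : List (Edge n)) (P′ : Position n) : Set where
  constructor afterOffer
  field
    {choice} : Edge n
    choice∈  : choice ∈ es
    client≡  : client P′ ≡ choice ∷ client P
    keeps    : ∀ {f} → f ∈ free P → f ∉ es → f ∈ free P′

  client-⊆ : client P ⊆ client P′
  client-⊆ i = subst (_ ∈_) (sym client≡) (there i)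

module _ {n : ℕ} where
  open DecMembership (_≟ᴱ_ {n}) using (_∈?_)

  force-offer : {P : Position n} (es : List (Edge n)) → Unique es → length es ≡ suc q →
                es ⊆ free P → Force q (AfterOffer P es) P
  force-offer {P = P} es u l s = ask
    (subst (_≤ length (free P)) l (Unique-⊆-length u s))
    (record { edges = es ; distinct = u ; size = l ; ⊆free = s })
    (λ (e , e∈) → done (afterOffer e∈ refl λ f∈ f∉ → ∈-filter⁺ (λ f → ¬? (f ∈? es)) f∈ f∉))

record AfterStar {n} (P : Position n) (v : Fin n) (ys : List (Fin n)) (P′ : Position n) : Set where
  field
    {leaf}   : Fin n
    leaf∈    : leaf ∈ ys
    adjacent : Adj (client P′) v leaf
    client-⊆ : client P ⊆ client P′
    keeps    : ∀ {u w} → Free P u w → ¬ (u ≡ v × w ∈ ys) → ¬ (w ≡ v × u ∈ ys) → Free P′ u w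

force-star : {P : Position n} (v : Fin n) (ys : List (Fin n)) → Unique ys → length ys ≡ suc q →
             (∀ {y} → y ∈ ys → Free P v y) → Force q (AfterStar P v ys) P
force-star {n} {P = P} v ys u l h =
  force-map f (force-offer (map (edge v) ys) (Uniqueₚ.map⁺ edge-injectiveʳ u)
                 (trans (length-map (edge v) ys) l) sub)
  where
  sub : map (edge v) ys ⊆ free P
  sub i with ∈-map⁻ (edge v) i
  ... | y , y∈ , refl = h y∈
  f : ∀ {P′ : Position n} → AfterOffer P (map (edge v) ys) P′ → AfterStar P v ys P′
  f {P′} a with ∈-map⁻ (edge v) (AfterOffer.choice∈ a)
  ... | y , y∈ , refl = record
    { leaf∈    = y∈
    ; adjacent = edge⇒Adj (subst (edge v y ∈_) (sym (AfterOffer.client≡ a)) (here refl))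
    ; client-⊆ = AfterOffer.client-⊆ a
    ; keeps    = kp
    }
    where
    kp : ∀ {u w} → Free P u w → ¬ (u ≡ v × w ∈ ys) → ¬ (w ≡ v × u ∈ ys) → Free P′ u w
    kp {u} {w} fr n₁ n₂ = AfterOffer.keeps a fr bad
      where
      bad : edge u w ∉ map (edge v) ys
      bad i with ∈-map⁻ (edge v) i
      ... | z , z∈ , eq′ with edge-injective eq′
      ...   | inj₁ (refl , refl) = n₁ (refl , z∈)
      ...   | inj₂ (refl , refl) = n₂ (refl , z∈)

-- From strategy trees to strategies in the game

K-Unique : ∀ n → Unique (K n)
K-Unique n = Uniqueₚ.filter⁺ (λ (i , j) → i Fin.<? j)
  (Uniqueₚ.cartesianProduct⁺ (Uniqueₚ.allFin⁺ n) (Uniqueₚ.allFin⁺ n))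

free-Unique : {P : Position n} → Play n q P → Unique (free P)
free-Unique {n} start = K-Unique n
free-Unique {n} (round h _ O _) = Uniqueₚ.filter⁺ (λ f → ¬? (f ∈? edges O)) (free-Unique h)
  where open DecMembership (_≟ᴱ_ {n}) using (_∈?_)
free-Unique (sweep h _ _) = []

some-offer : {P : Position n} → Play n q P → suc q ≤ length (free P) → Offer q P
some-offer {q = q} {P} h m = record
  { edges    = take (suc q) (free P)
  ; distinct = Uniqueₚ.take⁺ (suc q) (free-Unique h)
  ; size     = trans (length-take (suc q) (free P)) (m≤n⇒m⊓n≡m m)
  ; ⊆free    = λ i → subst (_ ∈_) (take++drop≡id (suc q) (free P)) (∈-++⁺ˡ i)
  }

-- Following a strategy fixes only the list of offered edges and not the proofs in the `Offer`. The
-- position depends on that list and on the chosen edge alone, so the subtree can be transported.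
afterRound-cong : {P : Position n} (O O′ : Offer q P) (c : Choice O) (c′ : Choice O′) →
  edges O ≡ edges O′ → proj₁ c ≡ proj₁ c′ → afterRound P O c ≡ afterRound P O′ c′
afterRound-cong {n} {P = P} O O′ c c′ eq refl =
  cong (λ es → position (filter (λ f → ¬? (f ∈? es)) (free P)) (proj₁ c ∷ client P)
                        (filter (λ f → ¬? (f ≟ᴱ proj₁ c)) es ++ waiter P)) eq
  where open DecMembership (_≟ᴱ_ {n}) using (_∈?_)

module _ {n q : ℕ} (Q : Graph n → Set) (Q-∷ : ∀ {e H} → Q H → Q (e ∷ H))
         (t₀ : Force q (Q ∘ client) (initial n)) where

  private
    -- A strategy must answer every history. `pending` holds the current node of the tree, after
    -- `achieved` any legal offer will do, and `lost` marks histories in which Waiter has already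
    -- left the tree.
    data Status (P : Position n) : Set where
      pending  : Force q (Q ∘ client) P → Status P
      achieved : Q (client P) → Status P
      lost     : Status P

    move : {P : Position n} → Status P → Play n q P → suc q ≤ length (free P) → Offer q P
    move (pending (ask _ O _)) _ _ = O
    move _                     h m = some-offer h m

    advance : {P : Position n} → Status P → (O : Offer q P) (c : Choice O) →
              Status (afterRound P O c)
    advance (pending (done x)) O c = achieved (Q-∷ x)
    advance {P} (pending (ask m O k)) O′ (e , e∈) with ≡-dec _≟ᴱ_ (edges O′) (edges O)
    ... | yes eq = pending (subst (Force q (Q ∘ client))
                     (sym (afterRound-cong O′ O (e , e∈) (e , subst (e ∈_) eq e∈) eq refl))
                     (k (e , subst (e ∈_) eq e∈)))
    ... | no  _  = lost
    advance (achieved x) O c = achieved (Q-∷ x)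
    advance lost         O c = lost

    after-sweep : {P : Position n} → Status P → length (free P) < suc q → Status (afterSweep P)
    after-sweep (pending (done x))    _ = achieved x
    -- A node `ask` certifies q + 1 free edges, so the final sweep cannot come before a leaf of the
    -- tree.
    after-sweep (pending (ask m _ _)) l = ⊥-elim (<⇒≱ l m)
    after-sweep (achieved x)          _ = achieved x
    after-sweep lost                  _ = lost

    status : {P : Position n} → Play n q P → Status P
    status start           = pending t₀
    status {P} (round h m O c) = advance (status h) O c
    status (sweep h l _)   = after-sweep (status h) l

    NotLost : {P : Position n} → Status P → Set
    NotLost lost = ⊥
    NotLost _    = ⊤

    advance-NotLost : {P : Position n} (s : Status P) (h : Play n q P) (m : suc q ≤ length (free P))
      (O : Offer q P) (c : Choice O) → edges O ≡ edges (move s h m) → NotLost s →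
      NotLost (advance s O c)
    advance-NotLost (pending (done x)) _ _ _ _ _ _ = tt
    advance-NotLost (pending (ask m O k)) _ _ O′ c eq _ with ≡-dec _≟ᴱ_ (edges O′) (edges O)
    ... | yes _ = tt
    ... | no ≢  = ⊥-elim (≢ eq)
    advance-NotLost (achieved x) _ _ _ _ _ _ = tt

    τ : WaiterStrategy n q
    τ h m = move (status h) h m

    status-NotLost : {P : Position n} (h : Play n q P) → WaiterFollows (λ {P} → τ {P}) h →
                     NotLost (status h)
    status-NotLost start _ = tt
    status-NotLost (round h m O c) (w , eq) =
      advance-NotLost (status h) h m O c eq (status-NotLost h w)
    status-NotLost (sweep h l _) w with status h | status-NotLost h w
    ... | pending (done x)    | _ = tt
    ... | pending (ask m _ _) | _ = ⊥-elim (<⇒≱ l m)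
    ... | achieved x          | _ = tt

    conclude : {P : Position n} (s : Status P) → NotLost s → Over P → Q (client P)
    conclude (pending (done x))    _ _ = x
    conclude (pending (ask m _ _)) _ o with () ← subst (λ f → suc q ≤ length f) o m
    conclude (achieved x)          _ _ = x

  -- When no edge is free the status can no longer be an `ask`, so a leaf has been reached; `Q-∷`
  -- carries its property through the rest of the game.
  force⇒canForce : WaiterCanForce n q Q
  force⇒canForce = (λ {P} → τ {P}) , wins
    where
    wins : {P : Position n} (h : Play n q P) → WaiterFollows (λ {P} → τ {P}) h → Over P → Q (client P)
    wins h w o = conclude (status h) (status-NotLost h w) o

-- Forcing an expander

take-⊆ : ∀ {a} {A : Set a} k (xs : List A) → take k xs ⊆ xs
take-⊆ k xs i = subst (_ ∈_) (take++drop≡id k xs) (∈-++⁺ˡ i)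

Unique-all-≡ : ∀ {a} {A : Set a} {xs : List A} {x} → Unique xs → (∀ {z} → z ∈ xs → z ≡ x) → length xs ≤ 1
Unique-all-≡ {x = x} u h = Unique-⊆-length {ys = [ x ]} u (λ i → here (h i))

-- The losses are at most 1 + 5 Q + 40 Q + m/8 + m/4. As m ≥ 100 Q, the remaining 5 m / 8 is at
-- least 62.5 Q, which leaves more than `Q`. A factor 8 clears the fractions.
many-left : ∀ Q m c b₁ b₂ b₃ b₄ b₅ → 1 ≤ Q → m ≤ c + b₅ + b₄ + b₃ + b₂ + b₁ → b₁ ≤ 1 → b₂ ≤ 5 * Q →
            b₃ ≤ 40 * Q → 8 * b₄ ≤ m → 4 * b₅ ≤ m → 100 * Q ≤ m → Q ≤ c
many-left Q m c b₁ b₂ b₃ b₄ b₅ 1≤Q m≤ b₁≤ b₂≤ b₃≤ b₄≤ b₅≤ large =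
  ≮⇒≥ λ c<Q → <⇒≱ (arith c<Q) (*-monoʳ-≤ 5 large)
  where
  open ≤-Reasoning
  lem₁ : ∀ m → 8 * m ≡ 5 * m + 3 * m
  lem₁ = solve-∀
  lem₂ : ∀ c b₅ b₄ b₃ b₂ b₁ → 8 * (c + b₅ + b₄ + b₃ + b₂ + b₁) ≡
             8 * c + 8 * b₁ + 8 * b₂ + 8 * b₃ + (8 * b₄ + 2 * (4 * b₅))
  lem₂ = solve-∀
  lem₃ : ∀ Q m → 8 * Q + 8 * Q + 8 * (5 * Q) + 8 * (40 * Q) + (m + 2 * m) + 124 * Q ≡ 5 * (100 * Q) + 3 * m
  lem₃ = solve-∀
  arith : c < Q → 5 * m < 5 * (100 * Q)
  arith c<Q = +-cancelʳ-< (3 * m) _ _ (begin-strict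
    5 * m + 3 * m
      ≡⟨ sym (lem₁ m) ⟩
    8 * m
      ≤⟨ *-monoʳ-≤ 8 m≤ ⟩
    8 * (c + b₅ + b₄ + b₃ + b₂ + b₁)
      ≡⟨ lem₂ c b₅ b₄ b₃ b₂ b₁ ⟩
    8 * c + 8 * b₁ + 8 * b₂ + 8 * b₃ + (8 * b₄ + 2 * (4 * b₅))
      ≤⟨ +-mono-≤ (+-mono-≤ (+-mono-≤ (+-mono-≤ (*-monoʳ-≤ 8 (<⇒≤ c<Q)) (*-monoʳ-≤ 8 (≤-trans b₁≤ 1≤Q)))
           (*-monoʳ-≤ 8 b₂≤)) (*-monoʳ-≤ 8 b₃≤))
           (+-mono-≤ b₄≤ (*-monoʳ-≤ 2 b₅≤)) ⟩
    8 * Q + 8 * Q + 8 * (5 * Q) + 8 * (40 * Q) + (m + 2 * m)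
      <⟨ m<m+n _ (≤-trans 1≤Q (m≤m+n Q _)) ⟩
    8 * Q + 8 * Q + 8 * (5 * Q) + 8 * (40 * Q) + (m + 2 * m) + 124 * Q
      ≡⟨ lem₃ Q m ⟩
    5 * (100 * Q) + 3 * m ∎)

module ExpanderGame {n : ℕ} (q : ℕ) (W : List (Fin n)) (W! : Unique W)
                (k : ℕ) (k-small : κ * k ≤ length W) (W-large : 100 * suc q ≤ length W) where

  open Expansion _≟_ W W!

  private
    Q : ℕ
    Q = suc q

    _≟²_ = ×-≡-dec (_≟_ {n}) (_≟_ {n})
    open DecMembership _≟²_ using (_∈?_)

  Arcs : Set
  Arcs = List (Fin n × Fin n)

  indeg outdeg : Arcs → Fin n → ℕ
  indeg  offs y = length (filter (λ a → proj₂ a ≟ y) offs)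
  outdeg offs v = length (filter (λ a → proj₁ a ≟ v) offs)

  out-star : ∀ v ys → outdeg (map (v ,_) ys) v ≡ length ys
  out-star v [] = refl
  out-star v (y ∷ ys) with v ≟ v
  ... | yes _ = cong suc (out-star v ys)
  ... | no ≢ = ⊥-elim (≢ refl)

  out-star-≢ : ∀ {v u} ys → v ≢ u → outdeg (map (v ,_) ys) u ≡ 0
  out-star-≢ [] _ = refl
  out-star-≢ {v} {u} (y ∷ ys) v≢u with v ≟ u
  ... | yes eq = ⊥-elim (v≢u eq)
  ... | no _ = out-star-≢ ys v≢u

  in-star : ∀ v {ys} → Unique ys → ∀ y → indeg (map (v ,_) ys) y ≤ 1
  in-star v {ys} u y = Unique-all-≡ {x = v , y}
    (Uniqueₚ.filter⁺ (λ a → proj₂ a ≟ y) (Uniqueₚ.map⁺ (λ { refl → refl }) u)) h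
    where
    h : ∀ {z} → z ∈ filter (λ a → proj₂ a ≟ y) (map (v ,_) ys) → z ≡ (v , y)
    h i with ∈-filter⁻ (λ a → proj₂ a ≟ y) {xs = map (v ,_) ys} i
    ... | i′ , refl with ∈-map⁻ (v ,_) i′
    ...   | _ , _ , refl = refl

  in-star-∉ : ∀ v {ys y} → y ∉ ys → indeg (map (v ,_) ys) y ≡ 0
  in-star-∉ v {[]} _ = refl
  in-star-∉ v {z ∷ ys} {y} y∉ with z ≟ y
  ... | yes refl = ⊥-elim (y∉ (here refl))
  ... | no _ = in-star-∉ v (y∉ ∘ there)

  indeg-++ : ∀ xs ys y → indeg (xs ++ ys) y ≡ indeg xs y + indeg ys y
  indeg-++ xs ys y = trans (cong length (filter-++ (λ a → proj₂ a ≟ y) xs ys)) (length-++ (filter _ xs))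

  outdeg-++ : ∀ xs ys y → outdeg (xs ++ ys) y ≡ outdeg xs y + outdeg ys y
  outdeg-++ xs ys y = trans (cong length (filter-++ (λ a → proj₁ a ≟ y) xs ys)) (length-++ (filter _ xs))

  out-hits : ∀ offs v {xs} → Unique xs → length (filter (λ x → ¬? (¬? ((v , x) ∈? offs))) xs) ≤ outdeg offs v
  out-hits offs v {xs} xs! = ≤-trans (≤-reflexive (sym (length-map (v ,_) (filter hit? xs))))
    (Unique-⊆-length (Uniqueₚ.map⁺ (λ { refl → refl }) (Uniqueₚ.filter⁺ hit? xs!)) sub)
    where
    hit? : ∀ x → Dec (¬ ¬ ((v , x) ∈ offs))
    hit? x = ¬? (¬? ((v , x) ∈? offs))
    sub : map (v ,_) (filter hit? xs) ⊆ filter (λ a → proj₁ a ≟ v) offs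
    sub i with ∈-map⁻ (v ,_) i
    ... | z , z∈ , refl = ∈-filter⁺ (λ a → proj₁ a ≟ v)
      (decidable-stable ((v , z) ∈? offs) (proj₂ (∈-filter⁻ hit? {xs = xs} z∈))) refl

  in-hits : ∀ offs v {xs} → Unique xs → length (filter (λ x → ¬? (¬? ((x , v) ∈? offs))) xs) ≤ indeg offs v
  in-hits offs v {xs} xs! = ≤-trans (≤-reflexive (sym (length-map (_, v) (filter hit? xs))))
    (Unique-⊆-length (Uniqueₚ.map⁺ (λ { refl → refl }) (Uniqueₚ.filter⁺ hit? xs!)) sub)
    where
    hit? : ∀ x → Dec (¬ ¬ ((x , v) ∈ offs))
    hit? x = ¬? (¬? ((x , v) ∈? offs))
    sub : map (_, v) (filter hit? xs) ⊆ filter (λ a → proj₂ a ≟ v) offs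
    sub i with ∈-map⁻ (_, v) i
    ... | z , z∈ , refl = ∈-filter⁺ (λ a → proj₂ a ≟ v)
      (decidable-stable ((z , v) ∈? offs) (proj₂ (∈-filter⁻ hit? {xs = xs} z∈))) refl

  ∑-indeg : ∀ offs → ∑ W (indeg offs) ≤ length offs
  ∑-indeg offs = begin
    ∑ W (indeg offs)
      ≡⟨ ∑-cong W (λ {y} _ → length-filter-≡-∑ (λ a → proj₂ a ≟ y) offs) ⟩
    ∑ W (λ y → ∑ offs (λ a → 𝟙 (proj₂ a ≟ y)))
      ≡⟨ ∑-swap W offs _ ⟩
    ∑ offs (λ a → ∑ W (λ y → 𝟙 (proj₂ a ≟ y)))
      ≤⟨ ∑-mono offs (λ {a} _ → ≤-trans (≤-reflexive (sym (length-filter-≡-∑ (proj₂ a ≟_) W)))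
           (Unique-all-≡ {x = proj₂ a} (Uniqueₚ.filter⁺ (proj₂ a ≟_) W!)
              (λ i → sym (proj₂ (∈-filter⁻ (proj₂ a ≟_) {xs = W} i))))) ⟩
    ∑ offs (λ _ → 1)
      ≡⟨ trans (∑-const offs 1) (*-identityʳ _) ⟩
    length offs ∎
    where open ≤-Reasoning

  count : Fin n → List (Fin n) → ℕ
  count v cs = length (filter (_≟ v) cs)

  -- `arcs` are the edges kept by Client and `offs` all the pairs offered, both directed from the
  -- centre. `out≤` and `total≤` count the offers made together with those still due for `cs`, so a
  -- star leaves both sums unchanged; `in≤` survives because saturated vertices are no longer
  -- offered.
  record State (P₀ : Position n) (cs : List (Fin n)) (P : Position n) : Set where
    field
      arcs offs : Arcs
      adjacent  : ∀ {v y} → (v , y) ∈ arcs → Adj (client P) v y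
      targets   : ∀ {v y} → (v , y) ∈ arcs → y ∈ W
      unoffered : ∀ {u w} → u ∈ W → w ∈ W → u ≢ w → (u , w) ∉ offs → (w , u) ∉ offs → Free P u w
      in≤       : ∀ y → indeg offs y ≤ 40 * Q
      out≤      : ∀ v → outdeg offs v + Q * count v cs ≤ 5 * Q
      total≤    : length offs + Q * length cs ≤ Q * (5 * m)
      centres   : cs ⊆ W
      potential : Φ (items k) cs arcs < m ^ length cs
      client-⊆  : client P₀ ⊆ client P
      keeps     : ∀ {u w} → Free P₀ u w → ¬ (u ∈ W × w ∈ W) → Free P u w

  module Candidates {P₀ P v cs} (st : State P₀ (v ∷ cs) P) where
    open State st

    private
      W₁ W₂ W₃ W₄ W₅ : Fin n → Set
      W₁ y = y ≢ v
      W₂ y = (v , y) ∉ offs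
      W₃ y = (y , v) ∉ offs
      W₄ y = indeg offs y < 40 * Q
      W₅ y = m * danger (items k) v cs arcs y ≤ 4 * ∑ W (danger (items k) v cs arcs)
      W₁? : Decidable W₁
      W₁? y = ¬? (y ≟ v)
      W₂? : Decidable W₂
      W₂? y = ¬? ((v , y) ∈? offs)
      W₃? : Decidable W₃
      W₃? y = ¬? ((y , v) ∈? offs)
      W₄? : Decidable W₄
      W₄? y = indeg offs y ℕ.<? 40 * Q
      W₅? : Decidable W₅
      W₅? = safe? (items k) v cs arcs

    Cand : Fin n → Set
    Cand y = (((W₁ y × W₂ y) × W₃ y) × W₄ y) × W₅ y

    cand? : Decidable Cand
    cand? y = (((W₁? y ×-dec W₂? y) ×-dec W₃? y) ×-dec W₄? y) ×-dec W₅? y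

    cands : List (Fin n)
    cands = filter cand? W

    private
      b₁ b₂ b₃ b₄ b₅ : ℕ
      b₁ = length (filter (λ x → ¬? (W₁? x)) W)
      b₂ = length (filter (λ x → ¬? (W₂? x)) W)
      b₃ = length (filter (λ x → ¬? (W₃? x)) W)
      b₄ = length (filter (λ x → ¬? (W₄? x)) W)
      b₅ = length (filter (λ x → ¬? (W₅? x)) W)

      b₁≤ : b₁ ≤ 1
      b₁≤ = Unique-all-≡ {x = v} (Uniqueₚ.filter⁺ (λ x → ¬? (W₁? x)) W!)
        (λ {z} i → decidable-stable (z ≟ v) (proj₂ (∈-filter⁻ (λ x → ¬? (W₁? x)) {xs = W} i)))

      b₂≤ : b₂ ≤ 5 * Q
      b₂≤ = ≤-trans (out-hits offs v W!) (≤-trans (m≤m+n _ _) (out≤ v))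

      b₃≤ : b₃ ≤ 40 * Q
      b₃≤ = ≤-trans (in-hits offs v W!) (in≤ v)

      -- Double counting: at most 5 Q m pairs are offered, and a saturated vertex takes 40 Q of
      -- them.
      b₄≤ : 8 * b₄ ≤ m
      b₄≤ = *-cancelʳ-≤ (8 * b₄) m (5 * Q) (begin
        8 * b₄ * (5 * Q)       ≡⟨ lem b₄ Q ⟩
        b₄ * (40 * Q)          ≤⟨ markov (λ x → ¬? (W₄? x)) W (indeg offs) (40 * Q) ≮⇒≥ ⟩
        ∑ W (indeg offs)       ≤⟨ ∑-indeg offs ⟩
        length offs            ≤⟨ ≤-trans (m≤m+n _ _) total≤ ⟩
        Q * (5 * m)            ≡⟨ lem′ Q m ⟩
        m * (5 * Q)            ∎)
        where
        open ≤-Reasoning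
        lem : ∀ b c → 8 * b * (5 * c) ≡ b * (40 * c)
        lem = solve-∀
        lem′ : ∀ a m → a * (5 * m) ≡ m * (5 * a)
        lem′ = solve-∀

      m≤ : m ≤ length cands + b₅ + b₄ + b₃ + b₂ + b₁
      m≤ = begin
        m
          ≡⟨ length-filter-¬ W₁? W ⟩
        length (filter W₁? W) + b₁
          ≤⟨ +-monoˡ-≤ b₁ (length-filter-×-dec W₁? W₂? W) ⟩
        length (filter (λ y → W₁? y ×-dec W₂? y) W) + b₂ + b₁
          ≤⟨ +-monoˡ-≤ b₁ (+-monoˡ-≤ b₂ (length-filter-×-dec (λ y → W₁? y ×-dec W₂? y) W₃? W)) ⟩
        length (filter (λ y → (W₁? y ×-dec W₂? y) ×-dec W₃? y) W) + b₃ + b₂ + b₁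
          ≤⟨ +-monoˡ-≤ b₁ (+-monoˡ-≤ b₂ (+-monoˡ-≤ b₃
               (length-filter-×-dec (λ y → (W₁? y ×-dec W₂? y) ×-dec W₃? y) W₄? W))) ⟩
        length (filter (λ y → ((W₁? y ×-dec W₂? y) ×-dec W₃? y) ×-dec W₄? y) W) + b₄ + b₃ + b₂ + b₁
          ≤⟨ +-monoˡ-≤ b₁ (+-monoˡ-≤ b₂ (+-monoˡ-≤ b₃ (+-monoˡ-≤ b₄
               (length-filter-×-dec (λ y → ((W₁? y ×-dec W₂? y) ×-dec W₃? y) ×-dec W₄? y) W₅? W)))) ⟩
        length cands + b₅ + b₄ + b₃ + b₂ + b₁ ∎
        where open ≤-Reasoning

    enough : Q ≤ length cands
    enough = many-left Q m (length cands) b₁ b₂ b₃ b₄ b₅ (s≤s z≤n) m≤ b₁≤ b₂≤ b₃≤ b₄≤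
               (few-unsafe (items k) v cs arcs) W-large

    pool : List (Fin n)
    pool = take Q cands

    pool-length : length pool ≡ Q
    pool-length = trans (length-take Q cands) (m≤n⇒m⊓n≡m enough)

    pool-Unique : Unique pool
    pool-Unique = Uniqueₚ.take⁺ Q (Uniqueₚ.filter⁺ cand? W!)

    pool-∈W : ∀ {y} → y ∈ pool → y ∈ W
    pool-∈W i = proj₁ (∈-filter⁻ cand? {xs = W} (take-⊆ Q cands i))

    pool-Cand : ∀ {y} → y ∈ pool → Cand y
    pool-Cand i = proj₂ (∈-filter⁻ cand? {xs = W} (take-⊆ Q cands i))

    pool-free : ∀ {y} → y ∈ pool → Free P v y
    pool-free i =
      let (((y≢v , n₁) , n₂) , _) , _ = pool-Cand i
      in unoffered (centres (here refl)) (pool-∈W i) (y≢v ∘ sym) n₁ n₂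

    after : ∀ {P′} → AfterStar P v pool P′ → State P₀ cs P′
    after {P′} s = record
      { arcs      = (v , leaf) ∷ arcs
      ; offs      = map (v ,_) pool ++ offs
      ; adjacent  = λ { (here refl) → S.adjacent ; (there i) → Adj-⊆ S.client-⊆ (adjacent i) }
      ; targets   = λ { (here refl) → pool-∈W leaf∈ ; (there i) → targets i }
      ; unoffered = λ {u} {w} u∈ w∈ u≢w n₁ n₂ → S.keeps
          (unoffered u∈ w∈ u≢w (n₁ ∘ ∈-++⁺ʳ (map (v ,_) pool)) (n₂ ∘ ∈-++⁺ʳ (map (v ,_) pool)))
          (λ { (refl , j) → n₁ (∈-++⁺ˡ (∈-map⁺ (v ,_) j)) })
          (λ { (refl , j) → n₂ (∈-++⁺ˡ (∈-map⁺ (v ,_) j)) })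
      ; in≤       = in≤′
      ; out≤      = out≤′
      ; total≤    = ≤-trans (≤-reflexive total≡) total≤
      ; centres   = centres ∘ there
      -- Whichever leaf Client took is safe, as a member of the pool. The factor `m` that cancels is
      -- the one due to the centre `v`, now processed.
      ; potential = *-cancelˡ-< m _ _ (≤-<-trans
          (Φ-step (items k) v cs arcs (items-small k) (proj₂ (pool-Cand leaf∈))) potential)
      ; client-⊆  = S.client-⊆ ∘ client-⊆
      ; keeps     = λ f n → S.keeps (keeps f n)
          (λ { (refl , j) → n (centres (here refl) , pool-∈W j) })
          (λ { (refl , j) → n (pool-∈W j , centres (here refl)) })
      }
      where
      module S = AfterStar s
      open S using (leaf; leaf∈)
      open DecMembership (_≟_ {n}) using () renaming (_∈?_ to _∈ⱽ?_)
      in≤′ : ∀ y → indeg (map (v ,_) pool ++ offs) y ≤ 40 * Q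
      in≤′ y with y ∈ⱽ? pool
      ... | yes i = ≤-trans (≤-reflexive (indeg-++ (map (v ,_) pool) offs y))
                      (≤-trans (+-monoˡ-≤ _ (in-star v pool-Unique y)) (proj₂ (proj₁ (pool-Cand i))))
      ... | no ∉  = ≤-trans (≤-reflexive (trans (indeg-++ (map (v ,_) pool) offs y)
                      (cong (_+ indeg offs y) (in-star-∉ v ∉)))) (in≤ y)
      lem : ∀ a b c → a + b + a * c ≡ b + a * suc c
      lem = solve-∀
      out≤′ : ∀ u → outdeg (map (v ,_) pool ++ offs) u + Q * count u cs ≤ 5 * Q
      out≤′ u with v ≟ u | out≤ u
      ... | yes refl | o = ≤-trans (≤-reflexive (trans
              (cong (_+ Q * count v cs) (trans (outdeg-++ (map (v ,_) pool) offs v)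
                (cong (_+ outdeg offs v) (trans (out-star v pool) pool-length))))
              (lem Q (outdeg offs v) (count v cs)))) o
      ... | no v≢u | o = ≤-trans (≤-reflexive (cong (_+ Q * count u cs)
              (trans (outdeg-++ (map (v ,_) pool) offs u) (cong (_+ outdeg offs u) (out-star-≢ pool v≢u))))) o
      total≡ : length (map (v ,_) pool ++ offs) + Q * length cs ≡ length offs + Q * suc (length cs)
      total≡ = trans (cong (_+ Q * length cs) (trans (length-++ (map (v ,_) pool))
                 (cong (_+ length offs) (trans (length-map (v ,_) pool) pool-length))))
               (lem Q (length offs) (length cs))

  force-arcs : ∀ {P₀} cs {P} → State P₀ cs P → Force q (State P₀ []) P
  force-arcs []       st = done st
  force-arcs (v ∷ cs) st =
    force-star v pool pool-Unique pool-length pool-free >>= λ s → force-arcs cs (after s)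
    where open Candidates st

  initial-state : ∀ {P₀} → (∀ {u w} → u ∈ W → w ∈ W → u ≢ w → Free P₀ u w) → State P₀ schedule P₀
  initial-state free₀ = record
    { arcs      = []
    ; offs      = []
    ; adjacent  = λ ()
    ; targets   = λ ()
    ; unoffered = λ u∈ w∈ u≢w _ _ → free₀ u∈ w∈ u≢w
    ; in≤       = λ _ → z≤n
    ; out≤      = λ v → ≤-trans (*-monoʳ-≤ Q (count≤ v)) (≤-reflexive (*-comm Q 5))
    ; total≤    = ≤-reflexive (cong (Q *_) length-schedule)
    ; centres   = in-W
    ; potential = Φ-start k (≤-trans (s≤s z≤n) W-large) k-small
    ; client-⊆  = id
    ; keeps     = λ f _ → f
    }
    where
    count-W : ∀ v → count v W ≤ 1
    count-W v = Unique-all-≡ {x = v} (Uniqueₚ.filter⁺ (_≟ v) W!) (λ i → proj₂ (∈-filter⁻ (_≟ v) {xs = W} i))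
    count-++ : ∀ v xs ys → count v (xs ++ ys) ≡ count v xs + count v ys
    count-++ v xs ys = trans (cong length (filter-++ (_≟ v) xs ys)) (length-++ (filter (_≟ v) xs))
    add : ∀ {b} v xs → count v xs ≤ b → count v (W ++ xs) ≤ suc b
    add v xs h = ≤-trans (≤-reflexive (count-++ v W xs)) (+-mono-≤ (count-W v) h)
    count≤ : ∀ v → count v schedule ≤ 5
    count≤ v = add v (W ++ W ++ W ++ W) (add v (W ++ W ++ W) (add v (W ++ W) (add v W (count-W v))))
    absorb : ∀ {xs} → xs ⊆ W → W ++ xs ⊆ W
    absorb s i with ∈-++⁻ W i
    ... | inj₁ j = j
    ... | inj₂ j = s j
    in-W : schedule ⊆ W
    in-W = absorb (absorb (absorb (absorb id)))

  record Expander (P₀ P : Position n) : Set where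
    field
      arcs offs : Arcs
      adjacent  : ∀ {v y} → (v , y) ∈ arcs → Adj (client P) v y
      targets   : ∀ {v y} → (v , y) ∈ arcs → y ∈ W
      expands   : Expands k arcs
      unoffered : ∀ {u w} → u ∈ W → w ∈ W → u ≢ w → (u , w) ∉ offs → (w , u) ∉ offs → Free P u w
      in≤       : ∀ y → indeg offs y ≤ 40 * Q
      out≤      : ∀ v → outdeg offs v ≤ 5 * Q
      client-⊆  : client P₀ ⊆ client P
      keeps     : ∀ {u w} → Free P₀ u w → ¬ (u ∈ W × w ∈ W) → Free P u w

  force-expander : ∀ {P₀} → (∀ {u w} → u ∈ W → w ∈ W → u ≢ w → Free P₀ u w) →
                   Force q (Expander P₀) P₀
  force-expander {P₀} free₀ = force-map f (force-arcs schedule (initial-state free₀))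
    where
    f : ∀ {P} → State P₀ [] P → Expander P₀ P
    f st = record
      { arcs = arcs ; offs = offs ; adjacent = adjacent ; targets = targets
      ; expands = Φ-end k arcs targets potential ; unoffered = unoffered
      ; in≤ = in≤ ; out≤ = λ v → ≤-trans (m≤m+n _ _) (out≤ v)
      ; client-⊆ = client-⊆ ; keeps = keeps }
      where open State st

-- Pósa rotations

Unique-resp-↭ : {xs ys : List A} → xs ↭ ys → Unique xs → Unique ys
Unique-resp-↭ {A = A} p = Permₚ.Unique-resp-↭ (setoid A) (↭⇒↭ₛ p)

data Next {A : Set ℓ} : List A → A → A → Set ℓ where
  here  : ∀ {x y l} → Next (x ∷ y ∷ l) x y
  there : ∀ {x l u v} → Next l u v → Next (x ∷ l) u v

Consec : {A : Set ℓ} → List A → A → A → Set ℓ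
Consec l u v = Next l u v ⊎ Next l v u

data Ends {A : Set ℓ} (w : A) : List A → Set ℓ where
  end   : Ends w (w ∷ [])
  there : ∀ {x l} → Ends w l → Ends w (x ∷ l)

Next-∈ˡ : ∀ {l} {u v : A} → Next l u v → u ∈ l
Next-∈ˡ here      = here refl
Next-∈ˡ (there i) = there (Next-∈ˡ i)

Next-∈ʳ : ∀ {x l} {u v : A} → Next (x ∷ l) u v → v ∈ l
Next-∈ʳ here                  = here refl
Next-∈ʳ {l = _ ∷ _} (there i) = there (Next-∈ʳ i)

Next-++ˡ : ∀ {l l′} {u v : A} → Next l u v → Next (l ++ l′) u v
Next-++ˡ here      = here
Next-++ˡ (there i) = there (Next-++ˡ i)

Next-++ʳ : ∀ l {l′} {u v : A} → Next l′ u v → Next (l ++ l′) u v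
Next-++ʳ []      i = i
Next-++ʳ (x ∷ l) i = there (Next-++ʳ l i)

-- Reversing `x ∷ xs` onto `ys` creates a single new adjacency, between `x` and the head of `ys`. In
-- a rotation this is the chord.
Next-ʳ++ : ∀ x xs {ys} {u v : A} → Next ((x ∷ xs) ʳ++ ys) u v →
           Next (x ∷ xs) v u ⊎ Next (x ∷ ys) u v
Next-ʳ++ x []        i = inj₂ i
Next-ʳ++ x (x′ ∷ xs) i with Next-ʳ++ x′ xs i
... | inj₁ j         = inj₁ (there j)
... | inj₂ here      = inj₁ here
... | inj₂ (there j) = inj₂ j

Next⇒R : ∀ {R : A → A → Set} {l u v} → Linked R l → Next l u v → R u v
Next⇒R (r ∷ rs) here      = r
Next⇒R (r ∷ rs) (there i) = Next⇒R rs i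
Next⇒R [-]      (there ())

R⇒Linked : ∀ {R : A → A → Set} l → (∀ {u v} → Next l u v → R u v) → Linked R l
R⇒Linked []          h = []
R⇒Linked (x ∷ [])    h = [-]
R⇒Linked (x ∷ y ∷ l) h = h here ∷ R⇒Linked (y ∷ l) (h ∘ there)

Ends-++⁻ : ∀ {w : A} l {x l′} → Ends w (l ++ x ∷ l′) → Ends w (x ∷ l′)
Ends-++⁻ []          e         = e
Ends-++⁻ (y ∷ [])    (there e) = e
Ends-++⁻ (y ∷ z ∷ l) (there e) = Ends-++⁻ (z ∷ l) e

Ends-ʳ++ : ∀ {w : A} l {l′} → Ends w l′ → Ends w (l ʳ++ l′)
Ends-ʳ++ []      e = e
Ends-ʳ++ (x ∷ l) e = Ends-ʳ++ l (there e)

module Posa {V : Set} (_≟_ : DecidableEquality V) (W : List V) (W! : Unique W) (k : ℕ) (1≤k : 1 ≤ k)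
            (w₁ : V) {R : V → V → Set} (R-sym : ∀ {u v} → R u v → R v u) (arcs : List (V × V))
            (arcs-R : ∀ {v y} → (v , y) ∈ arcs → R v y)
            (arcs-W : ∀ {v y} → (v , y) ∈ arcs → y ∈ W)
            (expands : Expansion.Expands _≟_ W W! k arcs) where

  open DecMembership _≟_ using (_∈?_)

  record IsPath (p : List V) : Set where
    field
      distinct : Unique p
      inside   : p ⊆ W
      linked   : Linked R p
      ends     : Ends w₁ p

  nexts-from prevs-from : V → List V → V → List V
  nexts-from x []      s = []
  nexts-from x (y ∷ l) s with x ≟ s
  ... | yes _ = [ y ]
  ... | no  _ = nexts-from y l s
  prevs-from x []      s = []
  prevs-from x (y ∷ l) s with y ≟ s
  ... | yes _ = [ x ]
  ... | no  _ = prevs-from y l s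

  nexts prevs : List V → V → List V
  nexts []      s = []
  nexts (x ∷ l) s = nexts-from x l s
  prevs []      s = []
  prevs (x ∷ l) s = prevs-from x l s

  ∈-nexts : ∀ {p s v} → Unique p → Next p s v → v ∈ nexts p s
  ∈-nexts {x ∷ y ∷ l} u here with x ≟ x
  ... | yes _ = here refl
  ... | no ≢  = ⊥-elim (≢ refl)
  ∈-nexts {x ∷ y ∷ l} {s} u@(_ ∷ u′) (there i) with x ≟ s
  ... | yes refl = ⊥-elim (Unique-∉ u (Next-∈ˡ i))
  ... | no _     = ∈-nexts u′ i

  ∈-prevs : ∀ {p s v} → Unique p → Next p v s → v ∈ prevs p s
  ∈-prevs {x ∷ y ∷ l} {s} u here with y ≟ y
  ... | yes _ = here refl
  ... | no ≢  = ⊥-elim (≢ refl)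
  ∈-prevs {x ∷ y ∷ l} {s} (_ ∷ u′) (there i) with y ≟ s
  ... | yes refl = ⊥-elim (Unique-∉ u′ (Next-∈ʳ i))
  ... | no _     = ∈-prevs u′ i

  length-nexts-from : ∀ x l s → length (nexts-from x l s) ≤ 1
  length-nexts-from x []      s = z≤n
  length-nexts-from x (y ∷ l) s with x ≟ s
  ... | yes _ = ≤-refl
  ... | no  _ = length-nexts-from y l s

  length-prevs-from : ∀ x l s → length (prevs-from x l s) ≤ 1
  length-prevs-from x []      s = z≤n
  length-prevs-from x (y ∷ l) s with y ≟ s
  ... | yes _ = ≤-refl
  ... | no  _ = length-prevs-from y l s

  length-nexts : ∀ p s → length (nexts p s) ≤ 1
  length-nexts []      s = z≤n
  length-nexts (x ∷ l) s = length-nexts-from x l s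

  length-prevs : ∀ p s → length (prevs p s) ≤ 1
  length-prevs []      s = z≤n
  length-prevs (x ∷ l) s = length-prevs-from x l s

  -- `S` with its successors and predecessors on `p`, the set that an arc given by expansion has to
  -- leave. `nexts` and `prevs` are lists of length at most one so that they can be concatenated.
  closure : List V → List V → List V
  closure p S = concatMap (λ s → s ∷ nexts p s ++ prevs p s) S

  length-closure : ∀ p S → length (closure p S) ≤ 3 * length S
  length-closure p []      = z≤n
  length-closure p (s ∷ S) = ≤-trans (≤-reflexive (length-++ (s ∷ nexts p s ++ prevs p s)))
    (≤-trans (+-mono-≤ (s≤s (≤-trans (≤-reflexive (length-++ (nexts p s)))
      (+-mono-≤ (length-nexts p s) (length-prevs p s)))) (length-closure p S)) (≤-reflexive (sym (*-suc 3 (length S)))))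

  ∈-closure : ∀ p {S s z} → s ∈ S → z ∈ s ∷ nexts p s ++ prevs p s → z ∈ closure p S
  ∈-closure p s∈ i = ∈-concatMap⁺ (λ s → s ∷ nexts p s ++ prevs p s) (Any.map (λ { refl → i }) s∈)

  Consec-closure : ∀ {p S s z} → Unique p → s ∈ S → Consec p z s → z ∈ closure p S
  Consec-closure {p} {s = s} u s∈ (inj₁ i) = ∈-closure p s∈ (there (∈-++⁺ʳ (nexts p s) (∈-prevs {p} u i)))
  Consec-closure {p} u s∈ (inj₂ i) = ∈-closure p s∈ (there (∈-++⁺ˡ (∈-nexts {p} u i)))

  -- The field local is the invariant of Pósa's lemma: an edge at y which is not an edge
  -- of p was made by a rotation, and then y or one of its neighbours on p is in S.
  record Rotated (p S : List V) (s : V) : Set where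
    field
      tail   : List V
      isPath : IsPath (s ∷ tail)
      perm   : s ∷ tail ↭ p
      local  : ∀ {y u} → Consec (s ∷ tail) y u → Consec p y u ⊎ y ∈ closure p S

  Rotated-∷ : ∀ {p S s z} → Rotated p S s → Rotated p (z ∷ S) s
  Rotated-∷ {p} {z = z} r = record
    { tail = tail ; isPath = isPath ; perm = perm
    ; local = λ c → [ inj₁ , inj₂ ∘ ∈-++⁺ʳ (z ∷ nexts p z ++ prevs p z) ]′ (local c) }
    where open Rotated r

  record Rotations (p S : List V) : Set where
    field
      distinct : Unique S
      inside   : S ⊆ W
      rotated  : ∀ {s} → s ∈ S → Rotated p S s

  Longer : List V → Set
  Longer p = ∃[ p′ ] (IsPath p′ × length p′ ≡ suc (length p) × p ⊆ p′)

  snoc-view : ∀ (x : V) xs → ∃[ ys ] ∃[ z ] (x ∷ xs ≡ ys ++ [ z ])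
  snoc-view x []        = [] , x , refl
  snoc-view x (x′ ∷ xs) = let ys , z , eq = snoc-view x′ xs in x ∷ ys , z , cong (x ∷_) eq

  -- The chord `v y` replaces the edge `z y` of the current path, which makes `z` the first vertex.
  -- Since `y` is outside the closure, `local` shows that `z y` is an edge of `p`; if `z` were in
  -- `S`, then `y` would be in the closure. Hence `z` is new.
  rotate-at : ∀ {p S v y} as bs → Unique p → Rotations p S → (v , y) ∈ arcs → v ∈ S → y ∉ closure p S →
              IsPath ((v ∷ as) ++ y ∷ bs) → (v ∷ as) ++ y ∷ bs ↭ p →
              (∀ {x u} → Consec ((v ∷ as) ++ y ∷ bs) x u → Consec p x u ⊎ x ∈ closure p S) →
              ∃[ z ] Rotations p (z ∷ S)
  rotate-at {p} {S} {v} {y} as bs p! rs a v∈S y∉T path perm local with snoc-view v as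
  ... | cs , z , eq = z , record
    { distinct = ∉-Unique z∉S distinct
    ; inside   = λ { (here refl) → Pth.inside (Next-∈ˡ zy) ; (there i) → inside i }
    ; rotated  = λ { (here refl) → new ; (there i) → Rotated-∷ (rotated i) }
    }
    where
    open Rotations rs
    module Pth = IsPath path
    straight turned : List V
    straight = (v ∷ as) ++ y ∷ bs
    turned   = (v ∷ as) ʳ++ (y ∷ bs)
    zy : Next straight z y
    zy = subst (λ l → Next l z y) (sym (trans (cong (_++ y ∷ bs) eq) (++-assoc cs [ z ] (y ∷ bs))))
           (Next-++ʳ cs here)
    zy-p : Consec p y z
    zy-p = [ id , (λ i → ⊥-elim (y∉T i)) ]′ (local (inj₂ zy))
    z∉S : z ∉ S
    z∉S z∈ = y∉T (Consec-closure p! z∈ zy-p)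
    turned-≡ : turned ≡ z ∷ (cs ʳ++ (y ∷ bs))
    turned-≡ = trans (cong (_ʳ++ (y ∷ bs)) eq) (++-ʳ++ cs)
    perm′ : turned ↭ straight
    perm′ = ↭-sym (++↭ʳ++ (v ∷ as) (y ∷ bs))
    edges′ : ∀ {x u} → Next turned x u → Next straight u x ⊎ Next straight x u ⊎ (x ≡ v × u ≡ y)
    edges′ i with Next-ʳ++ v as i
    ... | inj₁ j         = inj₁ (Next-++ˡ j)
    ... | inj₂ here      = inj₂ (inj₂ (refl , refl))
    ... | inj₂ (there j) = inj₂ (inj₁ (Next-++ʳ (v ∷ as) j))
    path′ : IsPath turned
    path′ = record
      { distinct = Unique-resp-↭ (↭-sym perm′) Pth.distinct
      ; inside   = Pth.inside ∘ ∈-resp-↭ perm′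
      ; linked   = R⇒Linked turned λ i → [ R-sym ∘ Next⇒R Pth.linked , [ Next⇒R Pth.linked ,
                     (λ { (refl , refl) → arcs-R a }) ]′ ]′ (edges′ i)
      ; ends     = Ends-ʳ++ (v ∷ as) (Ends-++⁻ (v ∷ as) Pth.ends)
      }
    weaken : ∀ {x} → x ∈ closure p S → x ∈ closure p (z ∷ S)
    weaken {x} = ∈-++⁺ʳ {v = x} (z ∷ nexts p z ++ prevs p z)
    old : ∀ {x u} → Consec straight x u → Consec p x u ⊎ x ∈ closure p (z ∷ S)
    old c = [ inj₁ , inj₂ ∘ weaken ]′ (local c)
    -- The chord is not claimed to be an edge of `p`, so both of its ends must lie in the new
    -- closure: `v` is in `S`, and `y` is a neighbour of `z` on `p`.
    v∈T : v ∈ closure p (z ∷ S)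
    v∈T = weaken (∈-closure p {S} v∈S (here refl))
    y∈T : y ∈ closure p (z ∷ S)
    y∈T = Consec-closure {S = z ∷ S} p! (here refl) zy-p
    local′ : ∀ {x u} → Consec turned x u → Consec p x u ⊎ x ∈ closure p (z ∷ S)
    local′ (inj₁ i) with edges′ i
    ... | inj₁ j                    = old (inj₂ j)
    ... | inj₂ (inj₁ j)             = old (inj₁ j)
    ... | inj₂ (inj₂ (refl , refl)) = inj₂ v∈T
    local′ (inj₂ i) with edges′ i
    ... | inj₁ j                    = old (inj₁ j)
    ... | inj₂ (inj₁ j)             = old (inj₂ j)
    ... | inj₂ (inj₂ (refl , refl)) = inj₂ y∈T
    new : Rotated p (z ∷ S) z
    new = record
      { tail   = cs ʳ++ (y ∷ bs)
      ; isPath = subst IsPath turned-≡ path′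
      ; perm   = subst (_↭ p) turned-≡ (↭-trans perm′ perm)
      ; local  = λ {x} {u} → subst (λ l → Consec l x u → Consec p x u ⊎ x ∈ closure p (z ∷ S)) turned-≡ local′
      }

  rotate : ∀ {p S v y} → Unique p → Rotations p S → (v , y) ∈ arcs → v ∈ S → y ∉ closure p S →
           y ∈ p → ∃[ z ] Rotations p (z ∷ S)
  rotate {p} {S} {v} {y} p! rs a v∈S y∉T y∈p with Rotations.rotated rs v∈S
  ... | record { tail = t ; isPath = path ; perm = perm ; local = local } = go (∈-∃++ (∈-resp-↭ (↭-sym perm) y∈p)) path perm local
    where
    go : ∀ {t} → ∃[ as ] ∃[ bs ] (v ∷ t ≡ as ++ [ y ] ++ bs) → IsPath (v ∷ t) → v ∷ t ↭ p →
         (∀ {x u} → Consec (v ∷ t) x u → Consec p x u ⊎ x ∈ closure p S) → ∃[ z ] Rotations p (z ∷ S)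
    go ([]     , bs , refl) _ _ _ = ⊥-elim (y∉T (∈-closure p v∈S (here refl)))
    go (_ ∷ as , bs , refl) path perm local = rotate-at as bs p! rs a v∈S y∉T path perm local

  -- Expansion yields an arc from `S` that leaves the closure. If it goes off the path it prolongs
  -- the path that starts at its tail; otherwise it gives one more end.
  grow : ∀ {p S} → IsPath p → Rotations p S → 1 ≤ length S → length S ≤ k →
         Longer p ⊎ ∃[ z ] Rotations p (z ∷ S)
  grow {p} {S} path rs 1≤S S≤k
    with expands {S} {closure p S} (Rotations.distinct rs) (Rotations.inside rs) 1≤S S≤k (length-closure p S)
  ... | v , y , a , v∈S , y∉T with y ∈? p
  ...   | yes y∈p = inj₂ (rotate (IsPath.distinct path) rs a v∈S y∉T y∈p)
  ...   | no  y∉p = inj₁ (y ∷ v ∷ tail , record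
      { distinct = ∉-Unique (y∉p ∘ ∈-resp-↭ perm) distinct
      ; inside   = λ { (here refl) → arcs-W a ; (there i) → inside i }
      ; linked   = R-sym (arcs-R a) ∷ linked
      ; ends     = there ends
      } , cong suc (↭-length perm) , there ∘ ∈-resp-↭ (↭-sym perm))
    where
    open Rotated (Rotations.rotated rs v∈S)
    open IsPath isPath

  rotations₀ : ∀ {s t} → IsPath (s ∷ t) → Rotations (s ∷ t) [ s ]
  rotations₀ {s} {t} path = record
    { distinct = [] ∷ []
    ; inside   = λ { (here refl) → IsPath.inside path (here refl) }
    ; rotated  = λ { (here refl) → record { tail = t ; isPath = path ; perm = ↭-refl ; local = inj₁ } }
    }

  ManyEnds : List V → Set
  ManyEnds p = ∃[ S ] (Rotations p S × length S ≡ suc k)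

  collect : ∀ j {p S} → IsPath p → Rotations p S → 1 ≤ length S → length S + j ≡ suc k →
            Longer p ⊎ ManyEnds p
  collect zero    path rs _ eq = inj₂ (_ , rs , trans (sym (+-identityʳ _)) eq)
  collect (suc j) {S = S} path rs 1≤ eq
    with grow path rs 1≤ (s≤s⁻¹ (≤-trans (≤-trans (m≤m+n _ j) (≤-reflexive (sym (+-suc (length S) j)))) (≤-reflexive eq)))
  ... | inj₁ l        = inj₁ l
  ... | inj₂ (z , rs′) = collect j path rs′ (s≤s z≤n) (trans (sym (+-suc (length S) j)) eq)

  maximise : ∀ f {p} → IsPath p → length p + f ≡ length W →
             ∃[ p′ ] (IsPath p′ × length p ≤ length p′ × p ⊆ p′ × ManyEnds p′)
  maximise f {s ∷ t} path eq with collect k path (rotations₀ path) ≤-refl refl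
  ... | inj₂ e = s ∷ t , path , ≤-refl , id , e
  maximise zero {s ∷ t} path eq | inj₁ (p′ , path′ , l , _) = ⊥-elim (<⇒≱ ≤-refl (≤-trans
    (≤-trans (≤-reflexive (sym l)) (Unique-⊆-length (IsPath.distinct path′) (IsPath.inside path′)))
    (≤-reflexive (trans (sym eq) (+-identityʳ _)))))
  maximise (suc f) {s ∷ t} path eq | inj₁ (p′ , path′ , l , p⊆) =
    let p″ , path″ , le , p′⊆ , e = maximise f path′ (trans (cong (_+ f) l) (trans (sym (+-suc _ f)) eq))
    in p″ , path″ , ≤-trans (≤-trans (n≤1+n _) (≤-reflexive (sym l))) le , p′⊆ ∘ p⊆ , e
  maximise f {[]} path eq with () ← IsPath.ends path

-- Forcing Hamilton paths

module Hamilton {n : ℕ} (q : ℕ) (W : List (Fin n)) (W! : Unique W) (k : ℕ) (46Q≤k : 46 * suc q ≤ k)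
                (large : κ * k ≤ length W) {w₁ : Fin n} (w₁∈W : w₁ ∈ W) where

  private
    Q : ℕ
    Q = suc q

    1≤k : 1 ≤ k
    1≤k = ≤-trans (s≤s z≤n) 46Q≤k

    100Q≤W : 100 * Q ≤ length W
    100Q≤W = ≤-trans (*-monoˡ-≤ Q (≤ᵇ⇒≤ 100 138 _)) (≤-trans (≤-reflexive (*-assoc 3 46 Q))
      (≤-trans (*-monoʳ-≤ 3 46Q≤k) (≤-trans (*-monoˡ-≤ k 3≤κ) large)))

    open module X = ExpanderGame {n} q W W! k large 100Q≤W using (Expander; force-expander; out-hits; in-hits)
    open DecMembership (_≟_ {n}) using (_∈?_)
    open DecMembership (×-≡-dec (_≟_ {n}) (_≟_ {n})) using () renaming (_∈?_ to _∈²?_)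

  -- A single path would not do: the edge that closes the cycle is offered to Q first vertices at
  -- once, and some first vertices may be spoiled by earlier offers.
  record HamiltonPaths (P₀ P : Position n) : Set where
    field
      ends      : List (Fin n)
      ends!     : Unique ends
      ends⊆     : ends ⊆ W
      many      : length ends ≡ suc k
      tail      : ∀ {s} → s ∈ ends → List (Fin n)
      distinct  : ∀ {s} (i : s ∈ ends) → Unique (s ∷ tail i)
      inside    : ∀ {s} (i : s ∈ ends) → s ∷ tail i ⊆ W
      full      : ∀ {s} (i : s ∈ ends) → length (s ∷ tail i) ≡ length W
      linked    : ∀ {s} (i : s ∈ ends) → Linked (Adj (client P)) (s ∷ tail i)
      ends-at   : ∀ {s} (i : s ∈ ends) → Ends w₁ (s ∷ tail i)
      client-⊆  : client P₀ ⊆ client P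
      keeps     : ∀ {u w} → Free P₀ u w → ¬ (u ∈ W × w ∈ W) → Free P u w

  module _ {P₀ P₁ : Position n} (ex : Expander P₀ P₁) where
    private
      module E₁ = Expander ex
      module Pós (P : Position n) (s : client P₁ ⊆ client P) =
        Posa _≟_ W W! k 1≤k w₁ {Adj (client P)} Adj-sym E₁.arcs
             (λ i → Adj-⊆ s (E₁.adjacent i)) E₁.targets E₁.expands

    -- `unoffered` is restricted to `w` off the path. An absorbing star has a centre that joins the
    -- path and leaves that lie on it, so it spoils no edge at a vertex that stays outside.
    record Progress (p : List (Fin n)) (P : Position n) : Set where
      field
        client-⊆  : client P₁ ⊆ client P
        distinct  : Unique p
        inside    : p ⊆ W
        linked    : Linked (Adj (client P)) p
        ends-at   : Ends w₁ p
        unoffered : ∀ {u w} → w ∈ W → w ∉ p → u ∈ W → w ≢ u → (w , u) ∉ E₁.offs → (u , w) ∉ E₁.offs →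
                    Free P w u
        keeps     : ∀ {u w} → Free P₁ u w → ¬ (u ∈ W × w ∈ W) → Free P u w

    module Extend {p P} (pr : Progress p P) where
      open Progress pr
      open Pós P client-⊆ public

      path₀ : IsPath p
      path₀ = record { distinct = distinct ; inside = inside ; linked = linked ; ends = ends-at }

      maximal : ∃[ p′ ] (IsPath p′ × length p ≤ length p′ × p ⊆ p′ × ManyEnds p′)
      maximal = maximise (length W ∸ length p) path₀
        (m+[n∸m]≡n (Unique-⊆-length distinct inside))

      module Absorb {p′ w} (path : IsPath p′) (many : ManyEnds p′) (w∈W : w ∈ W) (w∉p′ : w ∉ p′)
                    (w∉p : w ∉ p) where
        S : List (Fin n)
        S = proj₁ many
        open Rotations (proj₁ (proj₂ many)) using (rotated) renaming (distinct to S!; inside to S⊆W)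

        private
          A? : Decidable (λ x → (w , x) ∉ E₁.offs)
          A? x = ¬? ((w , x) ∈²? E₁.offs)
          B? : Decidable (λ x → (x , w) ∉ E₁.offs)
          B? x = ¬? ((x , w) ∈²? E₁.offs)
          both? : Decidable (λ x → (w , x) ∉ E₁.offs × (x , w) ∉ E₁.offs)
          both? x = A? x ×-dec B? x

        cands : List (Fin n)
        cands = filter both? S

        -- Among more than 46 Q ends, at most 40 Q have been centres of stars offered to `w`, and at
        -- most 5 Q have been offered from `w`. This is the origin of 46.
        enough : Q ≤ length cands
        enough = +-cancelʳ-≤ (45 * Q) Q (length cands) (begin
          Q + 45 * Q
            ≤⟨ ≤-trans 46Q≤k (n≤1+n k) ⟩
          suc k
            ≡⟨ sym (proj₂ (proj₂ many)) ⟩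
          length S
            ≡⟨ length-filter-¬ A? S ⟩
          length (filter A? S) + length (filter (λ x → ¬? (A? x)) S)
            ≤⟨ +-monoˡ-≤ _ (length-filter-×-dec A? B? S) ⟩
          length cands + length (filter (λ x → ¬? (B? x)) S) + length (filter (λ x → ¬? (A? x)) S)
            ≤⟨ +-mono-≤ (+-monoʳ-≤ (length cands) (≤-trans (in-hits E₁.offs w S!) (E₁.in≤ w)))
                        (≤-trans (out-hits E₁.offs w S!) (E₁.out≤ w)) ⟩
          length cands + 40 * Q + 5 * Q
            ≡⟨ trans (+-assoc (length cands) (40 * Q) (5 * Q)) (cong (length cands +_) (sym (*-distribʳ-+ Q 40 5))) ⟩
          length cands + 45 * Q ∎)
          where open ≤-Reasoning

        pool : List (Fin n)
        pool = take Q cands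

        pool-∈ : ∀ {y} → y ∈ pool → y ∈ S × (w , y) ∉ E₁.offs × (y , w) ∉ E₁.offs
        pool-∈ i = ∈-filter⁻ both? {xs = S} (take-⊆ Q cands i)

        S⊆p′ : S ⊆ p′
        S⊆p′ i = ∈-resp-↭ (Rotated.perm (rotated i)) (here refl)

        force : Force q (AfterStar P w pool) P
        force = force-star w pool (Uniqueₚ.take⁺ Q (Uniqueₚ.filter⁺ both? S!))
          (trans (length-take Q cands) (m≤n⇒m⊓n≡m enough))
          (λ i → let y∈S , n₁ , n₂ = pool-∈ i in
             unoffered w∈W w∉p (S⊆W y∈S) (λ { refl → w∉p′ (S⊆p′ y∈S) }) n₁ n₂)

        module After {P′} (st : AfterStar P w pool P′) where
          open AfterStar st using (leaf; leaf∈; adjacent) renaming (client-⊆ to cl; keeps to kp)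
          leaf∈S : leaf ∈ S
          leaf∈S = proj₁ (pool-∈ leaf∈)
          open Rotated (rotated leaf∈S) renaming (tail to t)
          module Pt = IsPath isPath

          longer : List (Fin n)
          longer = w ∷ leaf ∷ t

          length-longer : length longer ≡ suc (length p′)
          length-longer = cong suc (↭-length perm)

          progress : p ⊆ p′ → Progress longer P′
          progress p⊆ = record
            { client-⊆  = cl ∘ client-⊆
            ; distinct  = ∉-Unique (w∉p′ ∘ ∈-resp-↭ perm) Pt.distinct
            ; inside    = λ { (here refl) → w∈W ; (there i) → Pt.inside i }
            ; linked    = adjacent ∷ Linked.map (Adj-⊆ cl) Pt.linked
            ; ends-at   = there Pt.ends
            ; unoffered = λ {u} {x} x∈ x∉ u∈ x≢u n₁ n₂ →
                kp (unoffered x∈ (λ i → x∉ (there (∈-resp-↭ (↭-sym perm) (p⊆ i)))) u∈ x≢u n₁ n₂)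
                  (λ { (refl , _) → x∉ (here refl) })
                  (λ { (_ , i) → x∉ (there (∈-resp-↭ (↭-sym perm) (S⊆p′ (proj₁ (pool-∈ i))))) })
            ; keeps     = λ f n → kp (keeps f n)
                (λ { (refl , i) → n (w∈W , S⊆W (proj₁ (pool-∈ i))) })
                (λ { (refl , i) → n (S⊆W (proj₁ (pool-∈ i)) , w∈W) })
            }

    module Maximal {p P} (pr : Progress p P) {p′} (path : Extend.IsPath pr p′) (p≤p′ : length p ≤ length p′)
                   (p⊆p′ : p ⊆ p′) (many : Extend.ManyEnds pr p′) where
      open Extend pr
      private module Rots = Rotations (proj₁ (proj₂ many))

      finish : ¬ Any.Any (_∉ p′) W → HamiltonPaths P₀ P
      finish all-in = record
        { ends     = proj₁ many
        ; ends!    = Rots.distinct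
        ; ends⊆    = Rots.inside
        ; many     = proj₂ (proj₂ many)
        ; tail     = λ i → Rotated.tail (Rots.rotated i)
        ; distinct = λ i → IsPath.distinct (Rotated.isPath (Rots.rotated i))
        ; inside   = λ i → IsPath.inside (Rotated.isPath (Rots.rotated i))
        ; full     = λ i → trans (↭-length (Rotated.perm (Rots.rotated i))) full
        ; linked   = λ i → IsPath.linked (Rotated.isPath (Rots.rotated i))
        ; ends-at  = λ i → IsPath.ends (Rotated.isPath (Rots.rotated i))
        ; client-⊆ = Progress.client-⊆ pr ∘ E₁.client-⊆
        ; keeps    = λ f n → Progress.keeps pr (E₁.keeps f n) n
        }
        where
        full : length p′ ≡ length W
        full = ≤-antisym (Unique-⊆-length (IsPath.distinct path) (IsPath.inside path))
          (Unique-⊆-length W! (λ {x} x∈ → decidable-stable (x ∈? p′) (λ x∉ → all-in (lose x∈ x∉))))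

      fuel-left : ∀ {w} → w ∈ W → w ∉ p′ → ¬ (length W ≤ length p + 0)
      fuel-left w∈W w∉p′ W≤ =
        <⇒≱ (Unique-⊆-length {ys = W} (∉-Unique w∉p′ (IsPath.distinct path))
               (λ { (here refl) → w∈W ; (there i) → IsPath.inside path i }))
            (≤-trans W≤ (≤-trans (≤-reflexive (+-identityʳ _)) p≤p′))

      absorb : ∀ {w} → w ∈ W → w ∉ p′ →
               Force q (λ P′ → ∃[ p″ ] (Progress p″ P′ × suc (length p) ≤ length p″)) P
      absorb w∈W w∉p′ = force-map f force
        where
        open Absorb path many w∈W w∉p′ (w∉p′ ∘ p⊆p′)
        f : ∀ {P′} → AfterStar P _ pool P′ → ∃[ p″ ] (Progress p″ P′ × suc (length p) ≤ length p″)
        f st = longer , progress p⊆p′ , ≤-trans (s≤s p≤p′) (≤-reflexive (sym length-longer))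
          where open After st

    -- `f` bounds the number of vertices still to be absorbed. The path is maximised anew after each
    -- star, because a set of ends belongs to one vertex set only.
    force-paths : ∀ f {p P} → Progress p P → length W ≤ length p + f → Force q (HamiltonPaths P₀) P
    force-paths f {p} {P} pr W≤ = continue (Extend.maximal pr)
      where
      continue : ∃[ p′ ] (Extend.IsPath pr p′ × length p ≤ length p′ × p ⊆ p′ × Extend.ManyEnds pr p′) →
                 Force q (HamiltonPaths P₀) P
      continue (p′ , path , p≤p′ , p⊆p′ , many) = by-cases f W≤ (Any.any? (λ w → ¬? (w ∈? p′)) W)
        where
        open Maximal pr path p≤p′ p⊆p′ many
        by-cases : ∀ f → length W ≤ length p + f → Dec (Any.Any (_∉ p′) W) → Force q (HamiltonPaths P₀) P
        by-cases f       W≤ (no all-in) = done (finish all-in)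
        by-cases zero    W≤ (yes some)  = ⊥-elim (fuel-left (proj₁ (proj₂ (find some))) (proj₂ (proj₂ (find some))) W≤)
        by-cases (suc f) W≤ (yes some)  = absorb (proj₁ (proj₂ (find some))) (proj₂ (proj₂ (find some))) >>=
          λ (p″ , pr″ , longer) → force-paths f pr″
            (≤-trans W≤ (≤-trans (≤-reflexive (+-suc (length p) f)) (+-monoˡ-≤ f longer)))

  force-hamilton : ∀ {P₀} → (∀ {u w} → u ∈ W → w ∈ W → u ≢ w → Free P₀ u w) →
                   Force q (HamiltonPaths P₀) P₀
  force-hamilton free₀ = force-expander free₀ >>= λ ex →
    force-paths ex (length W) {w₁ ∷ []} (record
      { client-⊆  = id
      ; distinct  = [] ∷ []
      ; inside    = λ { (here refl) → w₁∈W }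
      ; linked    = [-]
      ; ends-at   = end
      ; unoffered = λ w∈ _ u∈ w≢u n₁ n₂ → Expander.unoffered ex w∈ u∈ w≢u n₁ n₂
      ; keeps     = λ f _ → f
      }) (n≤1+n _)

-- Forcing a long path and crossing chords

Linked-++ʳ : ∀ {R : A → A → Set} xs {ys} → Linked R (xs ++ ys) → Linked R ys
Linked-++ʳ xs {ys} l = R⇒Linked ys (Next⇒R l ∘ Next-++ʳ xs)

Linked-++ˡ : ∀ {R : A → A → Set} xs {ys} → Linked R (xs ++ ys) → Linked R xs
Linked-++ˡ xs l = R⇒Linked xs (Next⇒R l ∘ Next-++ˡ)

Linked-glue : ∀ {R : A → A → Set} xs {u v ys} → Linked R (xs ++ [ u ]) → R u v → Linked R (v ∷ ys) →
              Linked R (xs ++ u ∷ v ∷ ys)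
Linked-glue []           _       r l = r ∷ l
Linked-glue (x ∷ [])     (s ∷ k) r l = s ∷ Linked-glue [] k r l
Linked-glue (x ∷ y ∷ xs) (s ∷ k) r l = s ∷ Linked-glue (y ∷ xs) k r l

Linked-overlap : ∀ {R : A → A → Set} xs {u ys} → Linked R (xs ++ [ u ]) → Linked R (u ∷ ys) →
                 Linked R (xs ++ u ∷ ys)
Linked-overlap []           _       l = l
Linked-overlap (x ∷ [])     (s ∷ _) l = s ∷ l
Linked-overlap (x ∷ y ∷ xs) (s ∷ k) l = s ∷ Linked-overlap (y ∷ xs) k l

Linked-reverse : ∀ {R : A → A → Set} → (∀ {u v} → R u v → R v u) → ∀ {l} → Linked R l → Linked R (reverse l)
Linked-reverse s {[]}     _ = []
Linked-reverse s {x ∷ xs} l = R⇒Linked ((x ∷ xs) ʳ++ []) λ i → [ s ∘ Next⇒R l , (λ { (there ()) }) ]′ (Next-ʳ++ x xs i)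

Ends⇒∷ʳ : ∀ {w : A} {l} → Ends w l → ∃[ l′ ] (l ≡ l′ ++ [ w ])
Ends⇒∷ʳ end           = [] , refl
Ends⇒∷ʳ (there {x} e) = let l′ , eq = Ends⇒∷ʳ e in x ∷ l′ , cong (x ∷_) eq

Unique-++ˡ : ∀ (xs : List A) {ys} → Unique (xs ++ ys) → Unique xs
Unique-++ˡ []       _ = []
Unique-++ˡ (x ∷ xs) u@(_ ∷ u′) = ∉-Unique (Unique-∉ u ∘ ∈-++⁺ˡ) (Unique-++ˡ xs u′)

Unique-++ʳ : ∀ (xs : List A) {ys} → Unique (xs ++ ys) → Unique ys
Unique-++ʳ []       u       = u
Unique-++ʳ (x ∷ xs) (_ ∷ u) = Unique-++ʳ xs u

Unique-++-≢ : ∀ (xs : List A) {ys x y} → Unique (xs ++ ys) → x ∈ xs → y ∈ ys → x ≢ y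
Unique-++-≢ (x ∷ xs) u       (here refl) j refl = Unique-∉ u (∈-++⁺ʳ xs j)
Unique-++-≢ (x ∷ xs) (_ ∷ u) (there i)   j      = Unique-++-≢ xs u i j

record PathFrom {n} (P₀ : Position n) (v : Fin n) (U : List (Fin n)) (r : ℕ) (P : Position n) : Set where
  field
    path rest : List (Fin n)
    tip       : Fin n
    size      : length path ≡ r
    linked    : Linked (Adj (client P)) (v ∷ path)
    perm      : path ++ rest ↭ U
    tip-end   : Ends tip (v ∷ path)
    all-free  : ∀ {u w} → u ∈ tip ∷ rest → w ∈ tip ∷ rest → u ≢ w → Free P u w
    client-⊆  : client P₀ ⊆ client P
    keeps     : ∀ {u w} → Free P₀ u w → ¬ (u ∈ v ∷ U × w ∈ v ∷ U) → Free P u w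

force-path : ∀ r {P : Position n} v U → Unique (v ∷ U) →
             (∀ {u w} → u ∈ v ∷ U → w ∈ v ∷ U → u ≢ w → Free P u w) → r + q ≤ length U →
             Force q (PathFrom P v U r) P
force-path zero v U v∷U! free l = done record
  { path = [] ; rest = U ; tip = v ; size = refl ; linked = [-] ; perm = ↭-refl ; tip-end = end
  ; all-free = free ; client-⊆ = id ; keeps = λ f _ → f }
force-path {n} {q} (suc r) {P} v U v∷U!@(_ ∷ U!) free l =
  force-star v pool (Uniqueₚ.take⁺ (suc q) U!)
    (trans (length-take (suc q) U) (m≤n⇒m⊓n≡m (≤-trans (s≤s (m≤n+m q r)) l)))
    (λ i → free (here refl) (there (take-⊆ (suc q) U i)) (λ { refl → Unique-∉ v∷U! (take-⊆ (suc q) U i) }))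
  >>= next
  where
  pool : List (Fin n)
  pool = take (suc q) U
  next : ∀ {P₁} → AfterStar P v pool P₁ → Force q (PathFrom P v U (suc r)) P₁
  next {P₁} st = go (∈-∃++ (take-⊆ (suc q) U leaf∈))
    where
    open AfterStar st renaming (client-⊆ to cl; keeps to kp)
    go : ∃[ as ] ∃[ bs ] (U ≡ as ++ [ leaf ] ++ bs) → Force q (PathFrom P v U (suc r)) P₁
    go (as , bs , eq) = force-map finish (force-path r leaf (as ++ bs) leaf! free₁ l₁)
      where
      perm₀ : leaf ∷ as ++ bs ↭ U
      perm₀ = ↭-trans (↭-sym (shift leaf as bs)) (↭-reflexive (sym eq))
      leaf! : Unique (leaf ∷ as ++ bs)
      leaf! = Unique-resp-↭ (↭-sym perm₀) U!
      sub : leaf ∷ as ++ bs ⊆ U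
      sub = ∈-resp-↭ perm₀
      v∉ : ∀ {u} → u ∈ leaf ∷ as ++ bs → u ≢ v
      v∉ i refl = Unique-∉ v∷U! (sub i)
      free₁ : ∀ {u w} → u ∈ leaf ∷ as ++ bs → w ∈ leaf ∷ as ++ bs → u ≢ w → Free P₁ u w
      free₁ i j u≢w = kp (free (there (sub i)) (there (sub j)) u≢w) (v∉ i ∘ proj₁) (v∉ j ∘ proj₁)
      l₁ : r + q ≤ length (as ++ bs)
      l₁ = s≤s⁻¹ (≤-trans l (≤-reflexive (sym (↭-length perm₀))))
      finish : ∀ {P′} → PathFrom P₁ leaf (as ++ bs) r P′ → PathFrom P v U (suc r) P′
      finish pf = record
        { path = leaf ∷ path ; rest = rest ; tip = tip ; size = cong suc size
        ; linked = Adj-⊆ cl′ adjacent ∷ linked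
        ; perm = ↭-trans (prep leaf perm) perm₀
        ; tip-end = there tip-end ; all-free = all-free ; client-⊆ = cl′ ∘ cl
        ; keeps = λ f no → keeps (kp f (λ { (refl , j) → no (here refl , there (take-⊆ (suc q) U j)) })
                                        (λ { (refl , j) → no (there (take-⊆ (suc q) U j) , here refl) }))
                                 (λ (i , j) → no (there (sub i) , there (sub j))) }
        where open PathFrom pf renaming (client-⊆ to cl′)

-- A Hamilton path is forced later on w ∷ rest; pre are the vertices offered to a at the start.
record Frame {n} (q t : ℕ) (P : Position n) : Set where
  field
    a link w       : Fin n
    as ys rest pre : List (Fin n)
    length-as      : length (a ∷ as) ≡ 2 * suc q
    length-ys      : length ys ≡ suc (t + q)
    length-pre     : length pre ≡ suc q
    linked         : Linked (Adj (client P)) ((a ∷ as) ++ link ∷ ys ++ [ w ])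
    distinct       : Unique ((a ∷ as) ++ link ∷ ys ++ w ∷ rest)
    total          : length ((a ∷ as) ++ link ∷ ys ++ w ∷ rest) ≡ n
    free-xy        : ∀ {x y} → x ∈ a ∷ as → y ∈ ys → Free P x y
    free-rest      : ∀ {u v} → u ∈ w ∷ rest → v ∈ w ∷ rest → u ≢ v → Free P u v
    free-a         : ∀ {u} → u ∈ w ∷ rest → u ∉ pre → Free P a u

-- The x's come from one block of vertices and the y's from another, and stars stay within a block,
-- so no edge between x's and y's is offered. Only `tip` plays into the second block; hence it
-- becomes `link` and counts as neither. The star at `a` is played separately to remember its leaves
-- `pre`, since `a` is to be joined to a Hamilton path later.
force-frame : ∀ n q t → 3 * suc q + suc (suc (t + q)) + q ≤ n → Force q (Frame {n} q t) (initial n)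
force-frame n q t big = go As refl
  where
  Q : ℕ
  Q = suc q
  As Bs : List (Fin n)
  -- 2 Q + 1 vertices for the path up to `tip`, and the q vertices left over by its last star.
  As = take (3 * Q) (allFin n)
  Bs = drop (3 * Q) (allFin n)
  split : As ++ Bs ≡ allFin n
  split = take++drop≡id (3 * Q) (allFin n)
  all! : Unique (As ++ Bs)
  all! = subst Unique (sym split) (Uniqueₚ.allFin⁺ n)
  length-all : length (allFin n) ≡ n
  length-all = length-tabulate id
  length-As : length As ≡ 3 * Q
  length-As = trans (length-take (3 * Q) (allFin n)) (m≤n⇒m⊓n≡m
    (≤-trans (≤-trans (m≤m+n (3 * Q) _) (m≤m+n _ q)) (≤-trans big (≤-reflexive (sym length-all)))))
  length-Bs : suc (suc (t + q)) + q ≤ length Bs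
  length-Bs = +-cancelˡ-≤ (3 * Q) _ _ (≤-trans (≤-reflexive (sym (+-assoc (3 * Q) _ q)))
    (≤-trans big (≤-reflexive (sym (trans (cong (_+ length Bs) (sym length-As))
      (trans (sym (length-++ As)) (trans (cong length split) length-all)))))))
  Bs! : Unique Bs
  Bs! = Unique-++ʳ As all!

  go : ∀ As′ → As ≡ As′ → Force q (Frame {n} q t) (initial n)
  go [] eq with () ← trans (sym length-As) (cong length eq)
  go (a ∷ A′) eq = force-star a pre (Uniqueₚ.take⁺ Q A′!)
      (trans (length-take Q A′) (m≤n⇒m⊓n≡m (≤-trans (s≤s (m≤m+n q _)) (≤-reflexive (sym length-A′)))))
      (λ i → edge∈K λ { refl → Unique-∉ A! (take-⊆ Q A′ i) }) >>= λ st → second st (∈-∃++ (take-⊆ Q A′ (AfterStar.leaf∈ st)))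
    where
    pre : List (Fin n)
    pre = take Q A′
    A! : Unique (a ∷ A′)
    A! = subst Unique eq (Unique-++ˡ As all!)
    A′! : Unique A′
    A′! = Unique-++ʳ [ a ] A!
    lem : ∀ q → 3 * suc q ≡ suc (suc (q + suc (q + q)))
    lem = solve-∀
    length-A′ : length A′ ≡ suc (q + suc (q + q))
    length-A′ = suc-injective (trans (trans (sym (cong length eq)) length-As) (lem q))
    AB-≢ : ∀ {x y} → x ∈ a ∷ A′ → y ∈ Bs → x ≢ y
    AB-≢ i = Unique-++-≢ As all! (subst (_ ∈_) (sym eq) i)
    second : ∀ {P₁} (st : AfterStar (initial n) a pre P₁) →
             ∃[ ls ] ∃[ rs ] (A′ ≡ ls ++ [ AfterStar.leaf st ] ++ rs) → Force q (Frame {n} q t) P₁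
    second {P₁} st (ls , rs , eqA) =
      force-path (suc (q + q)) leaf U U! (λ i j u≢v → free₁ (a∉U i) (a∉U j) u≢v) lengthU >>= third
      where
      open AfterStar st renaming (client-⊆ to cl₁; keeps to kp₁)
      U : List (Fin n)
      U = ls ++ rs
      permU : leaf ∷ U ↭ A′
      permU = ↭-trans (↭-sym (shift leaf ls rs)) (↭-reflexive (sym eqA))
      U! : Unique (leaf ∷ U)
      U! = Unique-resp-↭ (↭-sym permU) A′!
      lengthU : suc (q + q) + q ≤ length U
      lengthU = ≤-reflexive (suc-injective (trans (lem′ q) (trans (sym length-A′) (sym (↭-length permU)))))
        where
        lem′ : ∀ q → suc (suc (q + q) + q) ≡ suc (q + suc (q + q))
        lem′ = solve-∀
      a∉U : ∀ {u} → u ∈ leaf ∷ U → u ≢ a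
      a∉U i refl = Unique-∉ A! (∈-resp-↭ permU i)
      a∉B : ∀ {u} → u ∈ Bs → u ≢ a
      a∉B i refl = AB-≢ (here refl) i refl
      free₁ : ∀ {u v} → u ≢ a → v ≢ a → u ≢ v → Free P₁ u v
      free₁ u≢a v≢a u≢v = kp₁ (edge∈K u≢v) (u≢a ∘ proj₁) (v≢a ∘ proj₁)
      free-a₁ : ∀ {u} → u ≢ a → u ∉ pre → Free P₁ a u
      free-a₁ u≢a u∉ = kp₁ (edge∈K (u≢a ∘ sym)) (u∉ ∘ proj₂) (u≢a ∘ proj₁)
      third : ∀ {P₂} → PathFrom P₁ leaf U (suc (q + q)) P₂ → Force q (Frame {n} q t) P₂
      third {P₂} pf = force-map fourth (force-path (suc (suc (t + q))) tip Bs
          (∉-Unique (λ i → AB-≢ tip∈A i refl) Bs!) free₂ length-Bs)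
        where
        open PathFrom pf renaming (client-⊆ to cl₂; keeps to kp₂)
        path∈A : ∀ {x} → x ∈ leaf ∷ path → x ∈ a ∷ A′
        path∈A (here refl) = there (∈-resp-↭ permU (here refl))
        path∈A (there i)   = there (∈-resp-↭ permU (there (∈-resp-↭ perm (∈-++⁺ˡ i))))
        rest∈A : ∀ {x} → x ∈ rest → x ∈ a ∷ A′
        rest∈A i = there (∈-resp-↭ permU (there (∈-resp-↭ perm (∈-++⁺ʳ path i))))
        cut : ∃[ as ] (leaf ∷ path ≡ as ++ [ tip ])
        cut = Ends⇒∷ʳ tip-end
        as : List (Fin n)
        as = proj₁ cut
        tip∈A : tip ∈ a ∷ A′
        tip∈A = path∈A (subst (tip ∈_) (sym (proj₂ cut)) (∈-++⁺ʳ as (here refl)))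
        ¬B∈U : ∀ {x} → x ∈ Bs → x ∉ leaf ∷ U
        ¬B∈U j i = AB-≢ (there (∈-resp-↭ permU i)) j refl
        leaf≢a : ∀ {x} → x ∈ leaf ∷ path → x ≢ a
        leaf≢a (here refl) = a∉U (here refl)
        leaf≢a (there i)   = a∉U (there (∈-resp-↭ perm (∈-++⁺ˡ i)))
        tip∈ : tip ∈ leaf ∷ path
        tip∈ = subst (tip ∈_) (sym (proj₂ cut)) (∈-++⁺ʳ as (here refl))
        tip≢a : tip ≢ a
        tip≢a = leaf≢a tip∈
        as∈ : ∀ {x} → x ∈ as → x ∈ leaf ∷ path
        as∈ i = subst (_ ∈_) (sym (proj₂ cut)) (∈-++⁺ˡ i)
        free₂ : ∀ {u v} → u ∈ tip ∷ Bs → v ∈ tip ∷ Bs → u ≢ v → Free P₂ u v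
        free₂ (here refl) (here refl) u≢v = ⊥-elim (u≢v refl)
        free₂ (here refl) (there j)   u≢v = kp₂ (free₁ tip≢a (a∉B j) u≢v) (¬B∈U j ∘ proj₂)
        free₂ (there i)   (here refl) u≢v = kp₂ (free₁ (a∉B i) tip≢a u≢v) (¬B∈U i ∘ proj₁)
        free₂ (there i)   (there j)   u≢v = kp₂ (free₁ (a∉B i) (a∉B j) u≢v) (¬B∈U i ∘ proj₁)
        lengthA : length (a ∷ as) ≡ 2 * suc q
        lengthA = trans (suc-injective (trans (sym (trans (cong (λ l → suc (length l)) (proj₂ cut))
          (trans (cong suc (length-++ as)) (cong suc (+-comm (length as) 1))))) (cong (2 +_) size))) (lem″ q)
          where
          lem″ : ∀ q → suc (suc (q + q)) ≡ 2 * suc q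
          lem″ = solve-∀
        tip∉ : ∀ {x} → x ∈ rest → x ≢ tip
        tip∉ i = Unique-++-≢ (leaf ∷ path)
          (Unique-resp-↭ (prep leaf (↭-sym perm)) U!) tip∈ i ∘ sym
        fourth : ∀ {P₃} → PathFrom P₂ tip Bs (suc (suc (t + q))) P₃ → Frame q t P₃
        fourth {P₃} record { path = [] ; size = () }
        fourth {P₃} record { path = b ∷ bs ; rest = rest₂ ; tip = w ; size = size₂ ; linked = linked₂ ; perm = perm₂
                      ; tip-end = there tip-end₂ ; all-free = all-free₂ ; client-⊆ = cl₃ ; keeps = kp₃ } = record
          { a = a ; link = tip ; w = w ; as = as ; ys = ys ; rest = rest₂ ++ rest ; pre = pre
          ; length-as = lengthA
          ; length-ys = suc-injective (trans (sym (trans (cong length bs≡) (trans (length-++ ys) (+-comm (length ys) 1)))) size₂)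
          ; length-pre = trans (length-take Q A′) (m≤n⇒m⊓n≡m (≤-trans (s≤s (m≤m+n q _)) (≤-reflexive (sym length-A′))))
          ; linked = subst (λ l → Linked (Adj (client P₃)) ((a ∷ as) ++ tip ∷ l)) bs≡
              (Linked-overlap (a ∷ as) (subst (λ l → Linked (Adj (client P₃)) (a ∷ l)) (proj₂ cut)
                (Adj-⊆ (cl₃ ∘ cl₂) adjacent ∷ Linked.map (Adj-⊆ cl₃) linked)) linked₂)
          ; distinct = Unique-resp-↭ (↭-sym perm-all) all!
          ; total = trans (↭-length perm-all) (trans (cong length split) length-all)
          ; free-xy = xy
          ; free-rest = rr
          ; free-a = λ i u∉ → kp₃ (kp₂ (free-a₁ (W≢a i) u∉) (λ (j , _) → a∉U j refl)) (λ (j , _) → a∉tB j)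
          }
          where
          ys : List (Fin n)
          ys = proj₁ (Ends⇒∷ʳ tip-end₂)
          bs≡ : b ∷ bs ≡ ys ++ [ w ]
          bs≡ = proj₂ (Ends⇒∷ʳ tip-end₂)
          perm-all : (a ∷ as) ++ tip ∷ ys ++ w ∷ rest₂ ++ rest ↭ As ++ Bs
          perm-all = ↭-trans (↭-reflexive eq₁) (↭-trans (++⁺ˡ (a ∷ leaf ∷ path) (++-comm ((b ∷ bs) ++ rest₂) rest))
            (↭-trans (↭-reflexive (sym (++-assoc (a ∷ leaf ∷ path) rest _))) (++⁺ permA perm₂)))
            where
            permA : a ∷ leaf ∷ path ++ rest ↭ As
            permA = ↭-trans (prep a (↭-trans (prep leaf perm) permU)) (↭-reflexive (sym eq))
            eq₁ : (a ∷ as) ++ tip ∷ ys ++ w ∷ rest₂ ++ rest ≡ (a ∷ leaf ∷ path) ++ ((b ∷ bs) ++ rest₂) ++ rest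
            eq₁ = trans (cong (a ∷_) (sym (++-assoc as [ tip ] _))) (cong₂ (λ l l′ → a ∷ l ++ l′) (sym (proj₂ cut))
              (trans (sym (++-assoc ys (w ∷ rest₂) rest)) (cong (_++ rest) (trans (sym (++-assoc ys [ w ] rest₂)) (cong (_++ rest₂) (sym bs≡))))))
          w∈B : ∀ {x} → x ∈ w ∷ rest₂ → x ∈ Bs
          w∈B (here refl) = ∈-resp-↭ perm₂ (∈-++⁺ˡ (subst (w ∈_) (sym bs≡) (∈-++⁺ʳ ys (here refl))))
          w∈B (there i)   = ∈-resp-↭ perm₂ (∈-++⁺ʳ (b ∷ bs) i)
          y∈B : ∀ {x} → x ∈ ys → x ∈ Bs
          y∈B i = ∈-resp-↭ perm₂ (∈-++⁺ˡ (subst (_ ∈_) (sym bs≡) (∈-++⁺ˡ i)))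
          W-cases : ∀ {x} → x ∈ w ∷ rest₂ ++ rest → x ∈ w ∷ rest₂ ⊎ x ∈ rest
          W-cases = ∈-++⁻ (w ∷ rest₂)
          rest≢a : ∀ {x} → x ∈ rest → x ≢ a
          rest≢a i = a∉U (there (∈-resp-↭ perm (∈-++⁺ʳ path i)))
          W≢a : ∀ {x} → x ∈ w ∷ rest₂ ++ rest → x ≢ a
          W≢a i = [ a∉B ∘ w∈B , rest≢a ]′ (W-cases i)
          a∉tB : a ∉ tip ∷ Bs
          a∉tB (here refl) = tip≢a refl
          a∉tB (there i)   = a∉B i refl
          rest∉tB : ∀ {x} → x ∈ rest → x ∉ tip ∷ Bs
          rest∉tB i (here refl) = tip∉ i refl
          rest∉tB i (there j)   = AB-≢ (rest∈A i) j refl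
          as! : Unique (as ++ [ tip ])
          as! = subst Unique (proj₂ cut) (Unique-++ˡ (leaf ∷ path) (Unique-resp-↭ (prep leaf (↭-sym perm)) U!))
          as∉tB : ∀ {x} → x ∈ as → x ∉ tip ∷ Bs
          as∉tB i (here refl) = Unique-++-≢ as as! i (here refl) refl
          as∉tB i (there j)   = AB-≢ (path∈A (as∈ i)) j refl
          xy : ∀ {x y} → x ∈ a ∷ as → y ∈ ys → Free P₃ x y
          xy (here refl) j = kp₃ (kp₂ (free-a₁ (a∉B (y∈B j)) (λ i → AB-≢ (there (take-⊆ Q A′ i)) (y∈B j) refl))
                                      (λ (i , _) → a∉U i refl)) (λ (i , _) → a∉tB i)
          xy (there i) j = kp₃ (kp₂ (free₁ (leaf≢a (as∈ i)) (a∉B (y∈B j)) (AB-≢ (path∈A (as∈ i)) (y∈B j)))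
                                    (¬B∈U (y∈B j) ∘ proj₂)) (as∉tB i ∘ proj₁)
          mixed : ∀ {u v} → u ∈ rest → v ∈ w ∷ rest₂ → Free P₃ u v
          mixed i j = kp₃ (kp₂ (free₁ (rest≢a i) (a∉B (w∈B j)) (AB-≢ (rest∈A i) (w∈B j)))
                               (¬B∈U (w∈B j) ∘ proj₂)) (rest∉tB i ∘ proj₁)
          rr : ∀ {u v} → u ∈ w ∷ rest₂ ++ rest → v ∈ w ∷ rest₂ ++ rest → u ≢ v → Free P₃ u v
          rr i j u≢v with W-cases i | W-cases j
          ... | inj₁ i′ | inj₁ j′ = all-free₂ i′ j′ u≢v
          ... | inj₂ i′ | inj₁ j′ = mixed i′ j′
          ... | inj₁ i′ | inj₂ j′ = Free-sym {P = P₃} (u≢v ∘ sym) (mixed j′ i′)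
          ... | inj₂ i′ | inj₂ j′ = kp₃ (all-free (there i′) (there j′) u≢v) (rest∉tB i′ ∘ proj₁)

-- The value past the end of the list is the default d.
nth : A → List A → ℕ → A
nth d []       _       = d
nth d (x ∷ xs) zero    = x
nth d (x ∷ xs) (suc i) = nth d xs i

nth-∈ : ∀ d (xs : List A) {i} → i < length xs → nth d xs i ∈ xs
nth-∈ d (x ∷ xs) {zero}  _       = here refl
nth-∈ d (x ∷ xs) {suc i} (s≤s l) = there (nth-∈ d xs l)

nth-injective : ∀ d {xs : List A} → Unique xs → ∀ {i j} → i < length xs → j < length xs →
                nth d xs i ≡ nth d xs j → i ≡ j
nth-injective d {x ∷ xs} u       {zero}  {zero}  _       _       _  = refl
nth-injective d {x ∷ xs} u       {zero}  {suc j} _       (s≤s l) eq = ⊥-elim (Unique-∉ u (subst (_∈ xs) (sym eq) (nth-∈ d xs l)))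
nth-injective d {x ∷ xs} u       {suc i} {zero}  (s≤s l) _       eq = ⊥-elim (Unique-∉ u (subst (_∈ xs) eq (nth-∈ d xs l)))
nth-injective d {x ∷ xs} (_ ∷ u) {suc i} {suc j} (s≤s k) (s≤s l) eq = cong suc (nth-injective d u k l eq)

nth-split : ∀ d (xs : List A) {i} → i < length xs →
            ∃[ ls ] ∃[ rs ] (xs ≡ ls ++ nth d xs i ∷ rs × length ls ≡ i)
nth-split d (x ∷ xs) {zero}  _       = [] , xs , refl , refl
nth-split d (x ∷ xs) {suc i} (s≤s l) =
  let ls , rs , eq , len = nth-split d xs l in x ∷ ls , rs , cong (x ∷_) eq , cong suc len

-- Rungs and chords between the two halves of the path

module Crossing {n : ℕ} (q t : ℕ) (d : Fin n) (xs ys : List (Fin n)) (xsys! : Unique (xs ++ ys))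
                (length-xs : length xs ≡ 2 * suc q) (length-ys : length ys ≡ suc (t + q)) where

  Q : ℕ
  Q = suc q

  x y : ℕ → Fin n
  x = nth d xs
  y = nth d ys

  2i< : ∀ {i} → i < Q → suc (2 * i) < length xs
  2i< {i} i<Q = ≤-trans (≤-trans (≤-reflexive (lem i)) (*-monoʳ-≤ 2 i<Q)) (≤-reflexive (sym length-xs))
    where
    lem : ∀ i → suc (suc (2 * i)) ≡ 2 * suc i
    lem = solve-∀

  -- A chord reaches at most to index q + t, which explains the length t + q + 1 of `ys`.
  j< : ∀ {j s} → j < Q → s ≤ t → j + s < length ys
  j< {j} {s} (s≤s j≤q) s≤t = ≤-trans (s≤s (≤-trans (+-mono-≤ j≤q s≤t) (≤-reflexive (+-comm q t)))) (≤-reflexive (sym length-ys))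

  private
    xs! : Unique xs
    xs! = Unique-++ˡ xs xsys!
    ys! : Unique ys
    ys! = Unique-++ʳ xs xsys!

    2i<′ : ∀ {i} → i < Q → 2 * i < length xs
    2i<′ i<Q = ≤-trans (n≤1+n _) (2i< i<Q)

    j<′ : ∀ {j} → j < Q → j < length ys
    j<′ {j} j<Q = ≤-trans (s≤s (m≤m+n j 0)) (j< j<Q z≤n)

  x∈ : ∀ {i} → i < length xs → x i ∈ xs
  x∈ = nth-∈ d xs

  y∈ : ∀ {j} → j < length ys → y j ∈ ys
  y∈ = nth-∈ d ys

  ≢-xy : ∀ {u v} → u ∈ xs → v ∈ ys → u ≢ v
  ≢-xy = Unique-++-≢ xs xsys!

  -- x's with even index carry rungs and those with odd index carry chords, so the edges kept as
  -- `closers` are untouched by this stage. `foot i` is the index of the y where rung `i` ends, a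
  -- choice of Client.
  record Rungs (P₀ : Position n) (b : ℕ) (P : Position n) : Set where
    field
      foot     : ℕ → ℕ
      foot<    : ∀ {i} → i < b → foot i < Q
      rung     : ∀ {i} → i < b → Adj (client P) (x (2 * i)) (y (foot i))
      unused   : ∀ {i j} → b ≤ i → i < Q → j < length ys → Free P (x (2 * i)) (y j)
      closers  : ∀ {i j} → i < Q → j < length ys → Free P (x (suc (2 * i))) (y j)
      client-⊆ : client P₀ ⊆ client P
      keeps    : ∀ {u v} → Free P₀ u v → ¬ (u ∈ xs × v ∈ ys) → ¬ (v ∈ xs × u ∈ ys) → Free P u v

  module _ {P₀ : Position n} {b P} (b<Q : b < Q) (rs : Rungs P₀ b P) where
    open Rungs rs

    private
      pool : List (Fin n)
      pool = map y (upTo Q)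

      pool∈ : ∀ {v} → v ∈ pool → ∃[ j ] (j < Q × v ≡ y j)
      pool∈ i = let j , j∈ , eq = ∈-map⁻ y i in j , ∈-upTo⁻ j∈ , eq

      pool⊆ys : ∀ {v} → v ∈ pool → v ∈ ys
      pool⊆ys i with pool∈ i
      ... | j , j<Q , refl = y∈ (j<′ j<Q)

      pool! : Unique pool
      pool! = Unique-map y (λ i j eq → nth-injective d ys! (j<′ (∈-upTo⁻ i)) (j<′ (∈-upTo⁻ j)) eq) (Uniqueₚ.upTo⁺ Q)

    next-rung : Force q (Rungs P₀ (suc b)) P
    next-rung = force-map f (force-star (x (2 * b)) pool pool! (trans (length-map y (upTo Q)) (length-upTo Q)) free-pool)
      where
      free-pool : ∀ {v} → v ∈ pool → Free P (x (2 * b)) v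
      free-pool i with pool∈ i
      ... | j , j<Q , refl = unused ≤-refl b<Q (j<′ j<Q)
      f : ∀ {P′} → AfterStar P (x (2 * b)) pool P′ → Rungs P₀ (suc b) P′
      f {P′} st with pool∈ (AfterStar.leaf∈ st)
      ... | j₀ , j₀<Q , leaf≡ = record
        { foot     = foot′
        ; foot<    = foot<′
        ; rung     = rung′
        ; unused   = λ {i} {j} b<i i<Q j<l → kp (unused (<⇒≤ b<i) i<Q j<l)
            (λ (eq , _) → <⇒≢ b<i (sym (*-cancelˡ-≡ i b 2 (nth-injective d xs! (2i<′ i<Q) (2i<′ b<Q) eq))))
            (λ (eq , _) → ≢-xy (x∈ (2i<′ b<Q)) (y∈ j<l) (sym eq))
        ; closers  = λ {i} {j} i<Q j<l → kp (closers i<Q j<l)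
            (λ (eq , _) → even≢odd b i (sym (nth-injective d xs! (2i< i<Q) (2i<′ b<Q) eq)))
            (λ (eq , _) → ≢-xy (x∈ (2i<′ b<Q)) (y∈ j<l) (sym eq))
        ; client-⊆ = cl ∘ client-⊆
        ; keeps    = λ fr n₁ n₂ → kp (keeps fr n₁ n₂)
            (λ { (refl , i) → n₁ (x∈ (2i<′ b<Q) , pool⊆ys i) })
            (λ { (refl , i) → n₂ (x∈ (2i<′ b<Q) , pool⊆ys i) })
        }
        where
        open AfterStar st renaming (client-⊆ to cl; keeps to kp)
        foot′ : ℕ → ℕ
        foot′ i with i ℕ.≟ b
        ... | yes _ = j₀
        ... | no  _ = foot i
        below : ∀ {i} → i < suc b → i ≢ b → i < b
        below (s≤s i≤b) i≢b = ≤∧≢⇒< i≤b i≢b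
        foot<′ : ∀ {i} → i < suc b → foot′ i < Q
        foot<′ {i} i< with i ℕ.≟ b
        ... | yes _ = j₀<Q
        ... | no i≢ = foot< (below i< i≢)
        rung′ : ∀ {i} → i < suc b → Adj (client P′) (x (2 * i)) (y (foot′ i))
        rung′ {i} i< with i ℕ.≟ b
        ... | yes refl = subst (Adj (client P′) (x (2 * b))) leaf≡ adjacent
        ... | no i≢ = Adj-⊆ cl (rung (below i< i≢))

  force-rungs : ∀ {P₀} c {b P} → b + c ≡ Q → Rungs P₀ b P → Force q (Rungs P₀ Q) P
  force-rungs {P₀} zero    {b} eq rs = done (subst (λ b → Rungs P₀ b _) (trans (sym (+-identityʳ b)) eq) rs)
  force-rungs (suc c) {b} eq rs =
    next-rung (≤-trans (s≤s (m≤m+n b c)) (≤-reflexive (trans (sym (+-suc b c)) eq))) rs >>=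
    force-rungs c (trans (sym (+-suc b c)) eq)

  record Crossings (P₀ : Position n) (foot : ℕ → ℕ) (b : ℕ) (P : Position n) : Set where
    field
      rung     : ∀ {i} → i < Q → Adj (client P) (x (2 * i)) (y (foot i))
      closed   : ∀ {s} → s < b → ∃[ i ] (i < Q × Adj (client P) (x (suc (2 * i))) (y (foot i + s)))
      unused   : ∀ {i s} → i < Q → b ≤ s → s ≤ t → Free P (x (suc (2 * i))) (y (foot i + s))
      client-⊆ : client P₀ ⊆ client P
      keeps    : ∀ {u v} → Free P₀ u v → ¬ (u ∈ xs × v ∈ ys) → ¬ (v ∈ xs × u ∈ ys) → Free P u v

  module _ {P₀ : Position n} {foot b P} (foot< : ∀ {i} → i < Q → foot i < Q) (b≤t : b ≤ t)
           (cs : Crossings P₀ foot b P) where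
    open Crossings cs

    private
      e : ℕ → Edge n
      e i = edge (x (suc (2 * i))) (y (foot i + b))

      y-in : ∀ {i s} → i < Q → s ≤ t → foot i + s < length ys
      y-in i<Q s≤t = j< (foot< i<Q) s≤t

      -- The x-end of the edge determines `i`, hence the foot, and then the y-end determines the
      -- shift. So the edges of one offer are distinct, and offers for different shifts are
      -- disjoint.
      e-injective : ∀ {i s i′} → i < Q → s ≤ t → i′ < Q →
                    edge (x (suc (2 * i))) (y (foot i + s)) ≡ e i′ → i ≡ i′ × s ≡ b
      e-injective {i} {s} {i′} i<Q s≤t i′<Q eq with edge-injective eq
      ... | inj₂ (p , _) = ⊥-elim (≢-xy (x∈ (2i< i<Q)) (y∈ (y-in i′<Q b≤t)) p)
      ... | inj₁ (p , p′) with *-cancelˡ-≡ i i′ 2 (suc-injective (nth-injective d xs! (2i< i<Q) (2i< i′<Q) p))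
      ...   | refl = refl , +-cancelˡ-≡ (foot i) s b (nth-injective d ys! (y-in i<Q s≤t) (y-in i<Q b≤t) p′)

    next-crossing : Force q (Crossings P₀ foot (suc b)) P
    next-crossing = force-map f (force-offer (map e (upTo Q)) (Unique-map e (λ i j eq → proj₁ (e-injective (∈-upTo⁻ i) b≤t (∈-upTo⁻ j) eq)) (Uniqueₚ.upTo⁺ Q))
        (trans (length-map e (upTo Q)) (length-upTo Q)) sub)
      where
      sub : map e (upTo Q) ⊆ free P
      sub k with ∈-map⁻ e k
      ... | i , i∈ , refl = unused (∈-upTo⁻ i∈) ≤-refl b≤t
      f : ∀ {P′} → AfterOffer P (map e (upTo Q)) P′ → Crossings P₀ foot (suc b) P′
      f {P′} ao with ∈-map⁻ e (AfterOffer.choice∈ ao)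
      ... | i₀ , i₀∈ , refl = record
        { rung     = λ i<Q → Adj-⊆ cl (rung i<Q)
        ; closed   = closed′
        ; unused   = λ {i} {s} i<Q b<s s≤t → AfterOffer.keeps ao (unused i<Q (<⇒≤ b<s) s≤t)
            (λ k → let i′ , i′∈ , eq = ∈-map⁻ e k in
               <⇒≢ b<s (sym (proj₂ (e-injective i<Q s≤t (∈-upTo⁻ i′∈) eq))))
        ; client-⊆ = cl ∘ client-⊆
        ; keeps    = λ {u} {v} fr n₁ n₂ → AfterOffer.keeps ao (keeps fr n₁ n₂) (λ k → other n₁ n₂ (∈-map⁻ e k))
        }
        where
        cl : client P ⊆ client P′
        cl = AfterOffer.client-⊆ ao
        closed′ : ∀ {s} → s < suc b → ∃[ i ] (i < Q × Adj (client P′) (x (suc (2 * i))) (y (foot i + s)))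
        closed′ {s} (s≤s s≤b) with m≤n⇒m<n∨m≡n s≤b
        ... | inj₁ s<b = let i , i<Q , a = closed s<b in i , i<Q , Adj-⊆ cl a
        ... | inj₂ refl = i₀ , ∈-upTo⁻ i₀∈ ,
          edge⇒Adj (subst (e i₀ ∈_) (sym (AfterOffer.client≡ ao)) (here refl))
        other : ∀ {u v} → ¬ (u ∈ xs × v ∈ ys) → ¬ (v ∈ xs × u ∈ ys) →
                ¬ (∃[ i ] (i ∈ upTo Q × edge u v ≡ e i))
        other n₁ n₂ (i , i∈ , eq) with edge-injective eq
        ... | inj₁ (refl , refl) = n₁ (x∈ (2i< (∈-upTo⁻ i∈)) , y∈ (y-in (∈-upTo⁻ i∈) b≤t))
        ... | inj₂ (refl , refl) = n₂ (x∈ (2i< (∈-upTo⁻ i∈)) , y∈ (y-in (∈-upTo⁻ i∈) b≤t))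

  force-crossings-from : ∀ {P₀ foot} → (∀ {i} → i < Q → foot i < Q) → ∀ c {b P} → b + c ≡ suc t →
                         Crossings P₀ foot b P → Force q (Crossings P₀ foot (suc t)) P
  force-crossings-from {P₀} {foot} foot< zero    {b} eq cs =
    done (subst (λ b → Crossings P₀ foot b _) (trans (sym (+-identityʳ b)) eq) cs)
  force-crossings-from foot< (suc c) {b} eq cs =
    next-crossing foot< (≤-trans (m≤m+n b c) (≤-reflexive (suc-injective (trans (sym (+-suc b c)) eq)))) cs >>=
    force-crossings-from foot< c (trans (sym (+-suc b c)) eq)

  record Ladder (P₀ P : Position n) : Set where
    field
      cross    : ∀ {s} → s ≤ t → ∃[ i ] ∃[ j ] (i < Q × j < Q ×
                   Adj (client P) (x (2 * i)) (y j) × Adj (client P) (x (suc (2 * i))) (y (j + s)))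
      client-⊆ : client P₀ ⊆ client P
      keeps    : ∀ {u v} → Free P₀ u v → ¬ (u ∈ xs × v ∈ ys) → ¬ (v ∈ xs × u ∈ ys) → Free P u v

  force-ladder : ∀ {P₀} → (∀ {u v} → u ∈ xs → v ∈ ys → Free P₀ u v) → Force q (Ladder P₀) P₀
  force-ladder {P₀} free₀ = force-rungs {P₀} Q {0} refl no-rungs >>= cross-all
    where
    no-rungs : Rungs P₀ 0 P₀
    no-rungs = record
      { foot = λ _ → 0 ; foot< = λ () ; rung = λ ()
      ; unused = λ _ i<Q j< → free₀ (x∈ (2i<′ i<Q)) (y∈ j<)
      ; closers = λ i<Q j< → free₀ (x∈ (2i< i<Q)) (y∈ j<)
      ; client-⊆ = id ; keeps = λ f _ _ → f }
    cross-all : ∀ {P} → Rungs P₀ Q P → Force q (Ladder P₀) P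
    cross-all {P} rs = force-map finish (force-crossings-from foot< (suc t) {0} refl record
        { rung = rung ; closed = λ () ; unused = λ i<Q _ s≤t → closers i<Q (j< (foot< i<Q) s≤t)
        ; client-⊆ = client-⊆ ; keeps = keeps })
      where
      open Rungs rs
      finish : ∀ {P′} → Crossings P₀ foot (suc t) P′ → Ladder P₀ P′
      finish cs = record
        { cross = λ s≤t → let i , i<Q , a = Crossings.closed cs (s≤s s≤t) in
            i , foot i , i<Q , foot< i<Q , Crossings.rung cs i<Q , a
        ; client-⊆ = Crossings.client-⊆ cs ; keeps = Crossings.keeps cs }

-- Cycles of all lengths

Unique-drop : ∀ (xs ys : List A) {zs} → Unique (xs ++ ys ++ zs) → Unique (xs ++ zs)
Unique-drop []       ys u        = Unique-++ʳ ys u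
Unique-drop (x ∷ xs) ys u@(_ ∷ u′) = ∉-Unique (Unique-∉ u ∘ widen) (Unique-drop xs ys u′)
  where
  widen : ∀ {z} → z ∈ xs ++ _ → z ∈ xs ++ ys ++ _
  widen i with ∈-++⁻ xs i
  ... | inj₁ j = ∈-++⁺ˡ j
  ... | inj₂ j = ∈-++⁺ʳ xs (∈-++⁺ʳ ys j)

nth-split₂ : ∀ d (xs : List A) {i} → suc i < length xs →
             ∃[ ls ] ∃[ rs ] (xs ≡ ls ++ nth d xs i ∷ nth d xs (suc i) ∷ rs)
nth-split₂ d (x ∷ x′ ∷ xs) {zero}  _       = [] , xs , refl
nth-split₂ d (x ∷ xs)      {suc i} (s≤s l) =
  let ls , rs , eq = nth-split₂ d xs l in x ∷ ls , rs , cong (x ∷_) eq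
nth-split₂ d (x ∷ [])      {zero}  (s≤s ())

nth-split-gap : ∀ d (xs : List A) j {s} → j + suc s < length xs →
                ∃[ ls ] ∃[ cs ] ∃[ rs ] (xs ≡ ls ++ nth d xs j ∷ cs ++ nth d xs (j + suc s) ∷ rs × length cs ≡ s)
nth-split-gap d (x ∷ xs) zero    (s≤s l) =
  let cs , rs , eq , len = nth-split d xs l in [] , cs , rs , cong (x ∷_) eq , len
nth-split-gap d (x ∷ xs) (suc j) (s≤s l) =
  let ls , cs , rs , eq , len = nth-split-gap d xs j l in x ∷ ls , cs , rs , cong (x ∷_) eq , len

module _ {n : ℕ} {H : Graph n} where

  private
    R : Fin n → Fin n → Set
    R = Adj H

    R-sym : ∀ {u v} → R u v → R v u
    R-sym = Adj-sym

  triangle : ∀ {x x′ y : Fin n} → Unique (x′ ∷ x ∷ y ∷ []) → R x x′ → R x y → R x′ y → Cycle H 3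
  triangle u xx′ xy x′y = record
    { first = _ ; others = _ ∷ _ ∷ [] ; distinct = u ; closed = R-sym xx′ ∷ xy ∷ R-sym x′y ∷ [-]
    ; size = refl ; 3≤k = ≤-refl }

  short-cycle : ∀ {x x′ y y′ : Fin n} cs → Unique (x′ ∷ x ∷ y ∷ cs ++ [ y′ ]) → R x x′ → R x y → R x′ y′ →
                Linked R (y ∷ cs ++ [ y′ ]) → Cycle H (suc (length cs) + 3)
  short-cycle {x} {x′} {y} {y′} cs u xx′ xy x′y′ l = record
    { first = x′ ; others = x ∷ y ∷ cs ++ [ y′ ] ; distinct = u
    ; closed = R-sym xx′ ∷ xy ∷ subst (λ z → Linked R (y ∷ z)) (sym (++-assoc cs [ y′ ] [ x′ ]))
        (Linked-glue (y ∷ cs) l (R-sym x′y′) [-])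
    ; size = trans (cong (3 +_) (length-++ cs)) (lem (length cs))
    ; 3≤k = m≤n+m 3 (suc (length cs)) }
    where
    lem : ∀ c → 3 + (c + 1) ≡ suc c + 3
    lem = solve-∀

  -- The two chords cross, so the cycle traverses the part between them backwards and skips cs.
  long-cycle : ∀ {a as w rest s tail link x x′ y y′} l₁ l₂ m₁ cs m₂ →
    a ∷ as ≡ l₁ ++ x ∷ x′ ∷ l₂ →
    Unique ((a ∷ as) ++ link ∷ (m₁ ++ y ∷ cs ++ y′ ∷ m₂) ++ w ∷ rest) →
    length ((a ∷ as) ++ link ∷ (m₁ ++ y ∷ cs ++ y′ ∷ m₂) ++ w ∷ rest) ≡ n →
    Linked R ((a ∷ as) ++ link ∷ (m₁ ++ y ∷ cs ++ y′ ∷ m₂) ++ [ w ]) →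
    Unique (s ∷ tail) → s ∷ tail ⊆ w ∷ rest → length (s ∷ tail) ≡ length (w ∷ rest) →
    Linked R (s ∷ tail) → Ends w (s ∷ tail) → R a s → R x y → R x′ y′ →
    ∀ {k} → 3 ≤ k → k + length cs ≡ n → Cycle H k
  long-cycle {a} {as} {w} {rest} {s} {tail} {link} {x} {x′} {y} {y′} l₁ l₂ m₁ cs m₂
    eqx all! total linked p! p⊆ p-full p-linked p-ends as-adj xy x′y′ {k} 3≤k k+c = record
    { first    = w
    ; others   = r′ ++ N
    ; distinct = subst (λ l → Unique (l ++ N)) r≡ L!
    ; closed   = subst (Linked R) (trans (sym (++-assoc r N [ w ])) (cong (λ l → (l ++ N) ++ [ w ]) r≡)) closed-L
    ; size     = trans (cong (λ l → length (l ++ N)) (sym r≡)) size-L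
    ; 3≤k      = 3≤k
    }
    where
    r mid N back Z : List (Fin n)
    r = reverse (s ∷ tail)
    mid = l₂ ++ link ∷ m₁
    back = reverse (x′ ∷ mid ++ [ y ])
    Z = y′ ∷ m₂
    -- The cycle runs through `W` from `w` to `s`, then from `a` to `x`, along the rung to `y`, back
    -- to `x′`, along the other chord to `y′`, and forward to `w`.
    N = l₁ ++ x ∷ back ++ Z

    back≡ : back ≡ y ∷ reverse mid ++ [ x′ ]
    back≡ = trans (unfold-reverse x′ (mid ++ [ y ])) (cong (_++ [ x′ ]) (reverse-++ mid [ y ]))

    cut : ∃[ l ] (s ∷ tail ≡ l ++ [ w ])
    cut = Ends⇒∷ʳ p-ends
    r′ : List (Fin n)
    r′ = reverse (proj₁ cut)
    r≡ : r ≡ w ∷ r′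
    r≡ = trans (cong reverse (proj₂ cut)) (reverse-++ (proj₁ cut) [ w ])

    E₁ : List (Fin n)
    E₁ = (a ∷ as) ++ link ∷ (m₁ ++ y ∷ cs ++ Z)

    split-at : ∀ T → (a ∷ as) ++ link ∷ (m₁ ++ y ∷ T) ≡ (l₁ ++ x ∷ (x′ ∷ mid ++ [ y ])) ++ T
    split-at T = trans (cong (_++ link ∷ (m₁ ++ y ∷ T)) eqx) (trans (++-assoc l₁ _ _)
      (trans (cong (λ l → l₁ ++ x ∷ x′ ∷ l) inner) (sym (++-assoc l₁ _ T))))
      where
      inner : l₂ ++ link ∷ (m₁ ++ y ∷ T) ≡ (mid ++ [ y ]) ++ T
      inner = trans (sym (++-assoc l₂ (link ∷ m₁) (y ∷ T))) (sym (++-assoc mid [ y ] T))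

    all≡ : (a ∷ as) ++ link ∷ (m₁ ++ y ∷ cs ++ Z) ++ w ∷ rest ≡ E₁ ++ w ∷ rest
    all≡ = sym (++-assoc (a ∷ as) _ _)

    E₁++W! : Unique (E₁ ++ w ∷ rest)
    E₁++W! = subst Unique all≡ all!

    E₁≡ : E₁ ≡ (l₁ ++ x ∷ (x′ ∷ mid ++ [ y ])) ++ cs ++ Z
    E₁≡ = split-at (cs ++ Z)

    N↭ : N ↭ (l₁ ++ x ∷ (x′ ∷ mid ++ [ y ])) ++ Z
    N↭ = ↭-trans (++⁺ˡ l₁ (prep x (++⁺ʳ Z (↭-reverse (x′ ∷ mid ++ [ y ])))))
                 (↭-reflexive (sym (++-assoc l₁ _ Z)))

    N! : Unique N
    N! = Unique-resp-↭ (↭-sym N↭) (Unique-drop (l₁ ++ x ∷ (x′ ∷ mid ++ [ y ])) cs {Z} (subst Unique E₁≡ (Unique-++ˡ E₁ E₁++W!)))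

    N⊆E₁ : N ⊆ E₁
    N⊆E₁ i = subst (_ ∈_) (sym E₁≡) (widen (∈-++⁻ (l₁ ++ x ∷ (x′ ∷ mid ++ [ y ])) (∈-resp-↭ N↭ i)))
      where
      widen : ∀ {z} → z ∈ l₁ ++ x ∷ (x′ ∷ mid ++ [ y ]) ⊎ z ∈ Z → z ∈ (l₁ ++ x ∷ (x′ ∷ mid ++ [ y ])) ++ cs ++ Z
      widen (inj₁ j) = ∈-++⁺ˡ j
      widen (inj₂ j) = ∈-++⁺ʳ (l₁ ++ x ∷ (x′ ∷ mid ++ [ y ])) (∈-++⁺ʳ cs j)

    L! : Unique (r ++ N)
    L! = Uniqueₚ.++⁺ (Unique-resp-↭ (↭-sym (↭-reverse (s ∷ tail))) p!) N!
      (λ (i , j) → Unique-++-≢ E₁ E₁++W! (N⊆E₁ j) (p⊆ (∈-resp-↭ (↭-reverse (s ∷ tail)) i)) refl)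

    size-L : length (r ++ N) ≡ k
    size-L = +-cancelʳ-≡ (length cs) _ _ (trans (begin
      length (r ++ N) + length cs
        ≡⟨ cong (_+ length cs) (length-++ r) ⟩
      length r + length N + length cs
        ≡⟨ cong₂ (λ u v → u + v + length cs) (trans (length-reverse (s ∷ tail)) p-full) (trans (↭-length N↭) (length-++ X)) ⟩
      length (w ∷ rest) + (length X + length Z) + length cs
        ≡⟨ lem (length (w ∷ rest)) (length X) (length Z) (length cs) ⟩
      length X + (length cs + length Z) + length (w ∷ rest)
        ≡⟨ cong (_+ length (w ∷ rest)) (sym (trans (cong length E₁≡) (trans (length-++ X) (cong (length X +_) (length-++ cs))))) ⟩
      length E₁ + length (w ∷ rest)
        ≡⟨ trans (sym (length-++ E₁)) (trans (cong length (sym all≡)) total) ⟩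
      n ∎) (sym k+c))
      where
      open ≡-Reasoning
      X : List (Fin n)
      X = l₁ ++ x ∷ (x′ ∷ mid ++ [ y ])
      lem : ∀ w x z c → w + (x + z) + c ≡ x + (c + z) + w
      lem = solve-∀

    M : List (Fin n)
    M = (a ∷ as) ++ link ∷ (m₁ ++ y ∷ cs ++ Z) ++ [ w ]
    M≡ : M ≡ (l₁ ++ x ∷ (x′ ∷ mid ++ [ y ])) ++ (cs ++ Z) ++ [ w ]
    M≡ = trans (cong (λ l → (a ∷ as) ++ link ∷ l) (++-assoc m₁ _ [ w ])) (split-at ((cs ++ Z) ++ [ w ]))
    linked′ : Linked R ((l₁ ++ x ∷ (x′ ∷ mid ++ [ y ])) ++ (cs ++ Z) ++ [ w ])
    linked′ = subst (Linked R) M≡ linked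

    part₁ : Linked R ((r ++ l₁) ++ [ x ])
    part₁ = Linked-++ˡ ((r ++ l₁) ++ [ x ]) {x′ ∷ l₂} (subst (Linked R) e
      (Linked-glue (reverse tail) (subst (Linked R) (unfold-reverse s tail) (Linked-reverse R-sym p-linked))
         (R-sym as-adj) (Linked-++ˡ (a ∷ as) linked)))
      where
      e : reverse tail ++ s ∷ a ∷ as ≡ ((r ++ l₁) ++ [ x ]) ++ x′ ∷ l₂
      e = trans (sym (++-assoc (reverse tail) [ s ] (a ∷ as)))
            (trans (cong₂ _++_ (sym (unfold-reverse s tail)) eqx)
              (trans (sym (++-assoc r l₁ _)) (sym (++-assoc (r ++ l₁) [ x ] _))))

    part₂ : Linked R (y ∷ reverse mid ++ [ x′ ])
    part₂ = subst (Linked R) back≡ (Linked-reverse R-sym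
      (Linked-++ʳ [ x ] (Linked-++ʳ l₁ (Linked-++ˡ (l₁ ++ x ∷ (x′ ∷ mid ++ [ y ])) linked′))))

    part₃ : Linked R (y′ ∷ m₂ ++ [ w ])
    part₃ = Linked-++ʳ cs (subst (Linked R) (++-assoc cs Z [ w ])
      (Linked-++ʳ (l₁ ++ x ∷ (x′ ∷ mid ++ [ y ])) linked′))

    closed-L : Linked R (r ++ N ++ [ w ])
    closed-L = subst (Linked R) e (Linked-glue (r ++ l₁) part₁ xy (Linked-glue (y ∷ reverse mid) part₂ x′y′ part₃))
      where
      e : (r ++ l₁) ++ x ∷ (y ∷ reverse mid) ++ x′ ∷ y′ ∷ m₂ ++ [ w ] ≡ r ++ N ++ [ w ]
      e = trans (++-assoc r l₁ _) (cong (r ++_) (sym (trans (++-assoc l₁ _ [ w ])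
            (cong (λ l → l₁ ++ x ∷ l) (trans (++-assoc back Z [ w ])
              (trans (cong (_++ Z ++ [ w ]) back≡) (++-assoc (y ∷ reverse mid) [ x′ ] _)))))))

-- Assembly of Waiter's strategy and the cycles it yields

module Finish {n q t : ℕ} {P₀ : Position n} (fr : Frame q t P₀) (k : ℕ) (46Q≤k : 46 * suc q ≤ k)
              (n≤2t+3 : n ≤ 2 * t + 3) where
  open Frame fr

  private
    Q : ℕ
    Q = suc q
    xs W : List (Fin n)
    xs = a ∷ as
    W = w ∷ rest

    xs++ys! : Unique (xs ++ ys)
    xs++ys! = Unique-drop xs [ link ] {ys} (Unique-++ˡ (xs ++ link ∷ ys)
      (subst Unique (sym (++-assoc xs (link ∷ ys) W)) distinct))

  W! : Unique W
  W! = Unique-++ʳ (link ∷ ys) (Unique-++ʳ xs distinct)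

  private
    xs∉W : ∀ {u} → u ∈ xs → u ∉ W
    xs∉W i j = Unique-++-≢ xs distinct i (∈-++⁺ʳ (link ∷ ys) j) refl
    ys∉W : ∀ {u} → u ∈ ys → u ∉ W
    ys∉W i j = Unique-++-≢ (link ∷ ys) (Unique-++ʳ xs distinct) (there i) j refl

    open module Cr = Crossing q t a xs ys xs++ys! length-as length-ys using (Ladder; force-ladder; x; y; 2i<; j<)

  module _ (large : κ * k ≤ length W) where
    private
      open module Ham = Hamilton q W W! k 46Q≤k large (here refl) using (HamiltonPaths; force-hamilton)
      open DecMembership (_≟_ {n}) using (_∈?_)

    module _ {P₁} (ld : Ladder P₀ P₁) where
      open Ladder ld renaming (client-⊆ to cl₁; keeps to kp₁)

      free-W : ∀ {u v} → u ∈ W → v ∈ W → u ≢ v → Free P₁ u v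
      free-W i j u≢v = kp₁ (free-rest i j u≢v) (λ (i′ , _) → xs∉W i′ i) (λ (j′ , _) → xs∉W j′ j)

      module _ {P₂} (hp : HamiltonPaths P₁ P₂) where
        open HamiltonPaths hp renaming (client-⊆ to cl₂; keeps to kp₂; distinct to path!; linked to path-linked)

        private
          new? : ∀ u → Dec (u ∉ pre)
          new? u = ¬? (u ∈? pre)
          cands pool : List (Fin n)
          cands = filter new? ends
          pool = take Q cands

        -- `a` is also the centre of a rung star, but the leaves of that star are in `ys`; from `a`
        -- into `W` only `pre` can have been offered.
        free-closing : ∀ {u} → u ∈ W → u ∉ pre → Free P₂ a u
        free-closing i u∉ = kp₂ (kp₁ (free-a i u∉) (λ (_ , j) → ys∉W j i) (λ (j , _) → xs∉W j i))
          (λ (j , _) → xs∉W (here refl) j)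

        enough : Q ≤ length cands
        enough = +-cancelʳ-≤ Q Q (length cands) (begin
          Q + Q
            ≤⟨ +-monoʳ-≤ Q (m≤m+n Q _) ⟩
          46 * Q
            ≤⟨ ≤-trans 46Q≤k (≤-trans (n≤1+n k) (≤-reflexive (sym many))) ⟩
          length ends
            ≡⟨ length-filter-¬ new? ends ⟩
          length cands + length (filter (λ u → ¬? (new? u)) ends)
            ≤⟨ +-monoʳ-≤ (length cands) (≤-trans (Unique-⊆-length (Uniqueₚ.filter⁺ (λ u → ¬? (new? u)) ends!)
                 (λ {u} i → decidable-stable (u ∈? pre) (proj₂ (∈-filter⁻ (λ u → ¬? (new? u)) {xs = ends} i))))
                 (≤-reflexive length-pre)) ⟩
          length cands + Q ∎)
          where open ≤-Reasoning

        pool∈ : ∀ {u} → u ∈ pool → u ∈ ends × u ∉ pre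
        pool∈ i = ∈-filter⁻ new? {xs = ends} (take-⊆ Q cands i)

        force-closing : Force q (AfterStar P₂ a pool) P₂
        force-closing = force-star a pool (Uniqueₚ.take⁺ Q (Uniqueₚ.filter⁺ new? ends!))
          (trans (length-take Q cands) (m≤n⇒m⊓n≡m enough))
          (λ i → free-closing (ends⊆ (proj₁ (pool∈ i))) (proj₂ (pool∈ i)))

        module _ {P₃} (st : AfterStar P₂ a pool P₃) where
          open AfterStar st renaming (client-⊆ to cl₃; keeps to kp₃)

          private
            leaf-end : leaf ∈ ends
            leaf-end = proj₁ (pool∈ leaf∈)

            frame-linked : Linked (Adj (client P₃)) (xs ++ link ∷ ys ++ [ w ])
            frame-linked = Linked.map (Adj-⊆ (cl₃ ∘ cl₂ ∘ cl₁)) linked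

            record Chords (s : ℕ) : Set where
              field
                {i j}     : ℕ
                l₁ l₂     : List (Fin n)
                xs≡       : xs ≡ l₁ ++ x (2 * i) ∷ x (suc (2 * i)) ∷ l₂
                j-in      : j + s < length ys
                rung      : Adj (client P₃) (x (2 * i)) (y j)
                chord     : Adj (client P₃) (x (suc (2 * i))) (y (j + s))

            chords : ∀ {s} → s ≤ t → Chords s
            chords s≤t =
              let i , j , i<Q , j<Q , r , c = cross s≤t
                  l₁ , l₂ , eq = nth-split₂ a xs (2i< i<Q)
              in record { i = i ; j = j ; l₁ = l₁ ; l₂ = l₂ ; xs≡ = eq ; j-in = j< j<Q s≤t
                        ; rung = Adj-⊆ (cl₃ ∘ cl₂) r ; chord = Adj-⊆ (cl₃ ∘ cl₂) c }

          module _ {s} (ch : Chords s) where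
            open Chords ch

            private
              x-edge : Adj (client P₃) (x (2 * i)) (x (suc (2 * i)))
              x-edge = Next⇒R (Linked-++ˡ xs frame-linked) (subst (λ l → Next l (x (2 * i)) (x (suc (2 * i)))) (sym xs≡) (Next-++ʳ l₁ here))

              x∈ : x (2 * i) ∈ xs
              x∈ = subst (x (2 * i) ∈_) (sym xs≡) (∈-++⁺ʳ l₁ (here refl))
              x′∈ : x (suc (2 * i)) ∈ xs
              x′∈ = subst (x (suc (2 * i)) ∈_) (sym xs≡) (∈-++⁺ʳ l₁ (there (here refl)))

              x≢x′ : x (suc (2 * i)) ≢ x (2 * i)
              x≢x′ eq = Unique-∉ (Unique-++ʳ l₁ (subst Unique xs≡ (Unique-++ˡ xs distinct))) (here (sym eq))

              extend-by-xx′ : ∀ {zs} → Unique zs → zs ⊆ ys → Unique (x (suc (2 * i)) ∷ x (2 * i) ∷ zs)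
              extend-by-xx′ u sub = ∉-Unique (λ { (here eq) → x≢x′ eq ; (there k) → Unique-++-≢ xs xs++ys! x′∈ (sub k) refl })
                (∉-Unique (λ k → Unique-++-≢ xs xs++ys! x∈ (sub k) refl) u)

            three : s ≡ 0 → Cycle (client P₃) 3
            three refl = triangle (extend-by-xx′ {[ y j ]} ([] ∷ []) (λ { (here refl) → nth-∈ a ys y-in })) x-edge rung
              (subst (λ j → Adj (client P₃) (x (suc (2 * i))) (y j)) (+-identityʳ j) chord)
              where
              y-in : j < length ys
              y-in = subst (_< length ys) (+-identityʳ j) j-in

            module _ {s′} (s≡ : s ≡ suc s′) where
              private
                gap : ∃[ ls ] ∃[ cs ] ∃[ rs ] (ys ≡ ls ++ y j ∷ cs ++ y (j + suc s′) ∷ rs × length cs ≡ s′)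
                gap = nth-split-gap a ys j (subst (λ s → j + s < length ys) s≡ j-in)
                m₁ cs m₂ : List (Fin n)
                m₁ = proj₁ gap
                cs = proj₁ (proj₂ gap)
                m₂ = proj₁ (proj₂ (proj₂ gap))
                ys≡ : ys ≡ m₁ ++ y j ∷ cs ++ y (j + suc s′) ∷ m₂
                ys≡ = proj₁ (proj₂ (proj₂ (proj₂ gap)))
                length-cs : length cs ≡ s′
                length-cs = proj₂ (proj₂ (proj₂ (proj₂ gap)))
                chord′ : Adj (client P₃) (x (suc (2 * i))) (y (j + suc s′))
                chord′ = subst (λ s → Adj (client P₃) (x (suc (2 * i))) (y (j + s))) s≡ chord
                seg : List (Fin n)
                seg = y j ∷ cs ++ [ y (j + suc s′) ]
                ys≡′ : ys ≡ m₁ ++ seg ++ m₂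
                ys≡′ = trans ys≡ (cong (λ l → m₁ ++ y j ∷ l) (sym (++-assoc cs _ m₂)))

              short : Cycle (client P₃) (suc s′ + 3)
              short = subst (λ c → Cycle (client P₃) (suc c + 3)) length-cs
                (short-cycle cs (extend-by-xx′
                   (Unique-++ˡ seg (Unique-++ʳ m₁ (subst Unique ys≡′ (Unique-++ʳ xs xs++ys!))))
                   (λ k → subst (_ ∈_) (sym ys≡′) (∈-++⁺ʳ m₁ (∈-++⁺ˡ k)))) x-edge rung chord′
                   (Linked-++ˡ seg (Linked-++ʳ m₁ (subst (Linked (Adj (client P₃))) ys≡′
                     (Linked-++ˡ ys (Linked-++ʳ [ link ] (Linked-++ʳ xs frame-linked)))))))

              long : ∀ {c} → 3 ≤ c → c + s′ ≡ n → Cycle (client P₃) c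
              long 3≤c eq = long-cycle {tail = tail leaf-end} l₁ l₂ m₁ cs m₂ xs≡
                (subst (λ l → Unique (xs ++ link ∷ l ++ W)) ys≡ distinct)
                (subst (λ l → length (xs ++ link ∷ l ++ W) ≡ n) ys≡ total)
                (subst (λ l → Linked (Adj (client P₃)) (xs ++ link ∷ l ++ [ w ])) ys≡ frame-linked)
                (path! leaf-end) (inside leaf-end) (full leaf-end)
                (Linked.map (Adj-⊆ cl₃) (path-linked leaf-end)) (ends-at leaf-end) adjacent rung chord′
                3≤c (trans (cong (_ +_) length-cs) eq)

          -- Lengths c up to t + 3 use the shift c - 3. For a longer cycle the shift n - c + 1 makes
          -- the shortcut skip n - c vertices, and it is at most t because c ≥ t + 4 and n ≤ 2 t +
          -- 3.
          pancyclic : Pancyclic (client P₃)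
          pancyclic c 3≤c c≤n with c ∸ 3 ℕ.≤? t
          ... | yes s≤t = by-short (c ∸ 3) refl (m∸n+n≡m 3≤c)
            where
            by-short : ∀ s → c ∸ 3 ≡ s → c ∸ 3 + 3 ≡ c → Cycle (client P₃) c
            by-short zero    eq c≡ = subst (Cycle (client P₃)) (trans (cong (_+ 3) (sym eq)) c≡) (three (chords s≤t) eq)
            by-short (suc s) eq c≡ = subst (Cycle (client P₃)) (trans (cong (_+ 3) (sym eq)) c≡) (short (chords s≤t) eq)
          ... | no s≰t = long (chords {suc (n ∸ c)} bound) refl 3≤c (m+[n∸m]≡n c≤n)
            where
            bound : suc (n ∸ c) ≤ t
            bound = +-cancelʳ-≤ (c ∸ 3) (suc (n ∸ c)) t (+-cancelʳ-≤ 3 _ _ (begin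
              suc (n ∸ c) + (c ∸ 3) + 3   ≡⟨ +-assoc (suc (n ∸ c)) (c ∸ 3) 3 ⟩
              suc (n ∸ c + (c ∸ 3 + 3))   ≡⟨ cong (λ z → suc (n ∸ c + z)) (m∸n+n≡m 3≤c) ⟩
              suc (n ∸ c + c)             ≡⟨ cong suc (m∸n+n≡m c≤n) ⟩
              suc n                       ≤⟨ s≤s n≤2t+3 ⟩
              suc (2 * t + 3)             ≡⟨ lem t ⟩
              t + suc t + 3               ≤⟨ +-monoˡ-≤ 3 (+-monoʳ-≤ t (≰⇒> s≰t)) ⟩
              t + (c ∸ 3) + 3             ∎))
              where
              open ≤-Reasoning
              lem : ∀ t → suc (2 * t + 3) ≡ t + suc t + 3
              lem = solve-∀

        force-end : Force q (Pancyclic ∘ client) P₂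
        force-end = force-map pancyclic force-closing

    force-pancyclic : Force q (Pancyclic ∘ client) P₀
    force-pancyclic = force-ladder free-xy >>= λ ld → force-hamilton (free-W ld) >>= force-end ld

-- Keeping the Client graph acyclic

tuples : ℕ → List A → List (List A)
tuples zero    xs = [ [] ]
tuples (suc j) xs = concatMap (λ x → map (x ∷_) (tuples j xs)) xs

length-concatMap : ∀ (f : A → List B) xs → length (concatMap f xs) ≡ ∑ xs (length ∘ f)
length-concatMap f []       = refl
length-concatMap f (x ∷ xs) = trans (length-++ (f x)) (cong (length (f x) +_) (length-concatMap f xs))

length-tuples : ∀ j (xs : List A) → length (tuples j xs) ≡ length xs ^ j
length-tuples zero    xs = refl
length-tuples (suc j) xs = trans (length-concatMap (λ x → map (x ∷_) (tuples j xs)) xs)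
  (trans (∑-cong xs (λ {x} _ → trans (length-map (x ∷_) (tuples j xs)) (length-tuples j xs))) (∑-const xs _))

∈-tuples : ∀ {xs : List A} l → l ⊆ xs → l ∈ tuples (length l) xs
∈-tuples []      _ = here refl
∈-tuples {xs = xs} (x ∷ l) s = ∈-concatMap⁺ (λ x → map (x ∷_) (tuples (length l) xs))
  (lose (s (here refl)) (∈-map⁺ (x ∷_) (∈-tuples l (s ∘ there))))

-- A discrete integral of x^j from a to a + n, each step being `^-suc-lower`. The start `a` is
-- general because the induction shifts the indices of `Fin`.
∑-tabulate-powers : ∀ j n a (f : Fin n → A) (h : A → ℕ) → (∀ i → h (f i) ≡ (a + toℕ i) ^ j) →
                    suc j * ∑ (tabulate f) h + a ^ suc j ≤ (a + n) ^ suc j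
∑-tabulate-powers j zero a f h eq = ≤-reflexive (cong₂ _+_ (*-zeroʳ (suc j)) (cong (_^ suc j) (sym (+-identityʳ a))))
∑-tabulate-powers j (suc n) a f h eq = begin
  suc j * (h (f Fin.zero) + S) + a ^ suc j
    ≡⟨ cong (λ z → suc j * (z + S) + a ^ suc j) (trans (eq Fin.zero) (cong (_^ j) (+-identityʳ a))) ⟩
  suc j * (a ^ j + S) + a ^ suc j
    ≡⟨ lem (suc j) (a ^ j) S (a ^ suc j) ⟩
  suc j * S + (a ^ suc j + suc j * a ^ j)
    ≤⟨ +-monoʳ-≤ (suc j * S) (^-suc-lower a j) ⟩
  suc j * S + suc a ^ suc j
    ≤⟨ ∑-tabulate-powers j n (suc a) (f ∘ Fin.suc) h (λ i → trans (eq (Fin.suc i)) (cong (_^ j) (+-suc a (toℕ i)))) ⟩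
  (suc a + n) ^ suc j
    ≡⟨ cong (_^ suc j) (sym (+-suc a n)) ⟩
  (a + suc n) ^ suc j ∎
  where
  open ≤-Reasoning
  S : ℕ
  S = ∑ (tabulate (f ∘ Fin.suc)) h
  lem : ∀ b x s y → b * (x + s) + y ≡ b * s + (y + b * x)
  lem = solve-∀

module _ {n : ℕ} where

  below : Fin n → List (Fin n)
  below x = filter (Fin._<? x) (allFin n)

  length-below : ∀ x → length (below x) ≤ toℕ x
  length-below x = ≤-trans (≤-reflexive (sym (length-map toℕ (below x))))
    (≤-trans (Unique-⊆-length (Uniqueₚ.map⁺ Finₚ.toℕ-injective (Uniqueₚ.filter⁺ (Fin._<? x) (Uniqueₚ.allFin⁺ n))) sub)
      (≤-reflexive (length-upTo (toℕ x))))
    where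
    sub : map toℕ (below x) ⊆ upTo (toℕ x)
    sub i with ∈-map⁻ toℕ i
    ... | y , y∈ , refl = ∈-upTo⁺ (proj₂ (∈-filter⁻ (Fin._<? x) {xs = allFin n} y∈))

  -- Closed walks, written from their largest vertex.
  rooted : ℕ → List (Fin n × List (Fin n))
  rooted j = concatMap (λ x → map (x ,_) (tuples j (below x))) (allFin n)

  -- A root x leaves at most x choices for each of the other j vertices. Summing x^j gains the
  -- factor 1 / (j + 1), as good as identifying the rotations of a cycle.
  length-rooted : ∀ j → suc j * length (rooted j) ≤ n ^ suc j
  length-rooted j = ≤-trans (*-monoʳ-≤ (suc j) (≤-trans
      (≤-reflexive (length-concatMap (λ x → map (x ,_) (tuples j (below x))) (allFin n)))
      (∑-mono (allFin n) (λ {x} _ → ≤-trans (≤-reflexive (trans (length-map (x ,_) (tuples j (below x))) (length-tuples j (below x))))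
        (^-monoˡ-≤ j (length-below x))))))
    (≤-trans (m≤m+n _ (0 ^ suc j)) (∑-tabulate-powers j n 0 id (λ x → toℕ x ^ j) (λ _ → refl)))

  ∈-rooted : ∀ {x l} → (∀ {y} → y ∈ l → y Fin.< x) → (x , l) ∈ rooted (length l)
  ∈-rooted {x} {l} h = ∈-concatMap⁺ (λ x → map (x ,_) (tuples (length l) (below x)))
    (lose (∈-allFin x) (∈-map⁺ (x ,_) (∈-tuples l (λ {y} i → ∈-filter⁺ (Fin._<? x) (∈-allFin y) (h i)))))

  walk : Fin n → List (Fin n) → Fin n → List (Edge n)
  walk x []      z = [ edge x z ]
  walk x (y ∷ l) z = edge x y ∷ walk y l z

  length-walk : ∀ x l z → length (walk x l z) ≡ suc (length l)
  length-walk x []      z = refl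
  length-walk x (y ∷ l) z = cong suc (length-walk y l z)

  walk-ends : ∀ x l z {v w} → edge v w ∈ walk x l z → v ∈ x ∷ l ++ [ z ]
  walk-ends x [] z (here eq) with edge-injective eq
  ... | inj₁ (refl , _) = here refl
  ... | inj₂ (refl , _) = there (here refl)
  walk-ends x (y ∷ l) z (here eq) with edge-injective eq
  ... | inj₁ (refl , _) = here refl
  ... | inj₂ (refl , _) = there (here refl)
  walk-ends x (y ∷ l) z (there i) = there (walk-ends y l z i)

  walk-Unique : ∀ x l z → Unique (x ∷ l ++ [ z ]) → Unique (walk x l z)
  walk-Unique x []      z u = [] ∷ []
  walk-Unique x (y ∷ l) z u@(_ ∷ u′) = ∉-Unique (Unique-∉ u ∘ walk-ends y l z) (walk-Unique y l z u′)

  -- Needed because walks that repeat an edge weigh 0. Three vertices are required: the walk x y x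
  -- uses its edge twice.
  closed-walk-Unique : ∀ x y y′ l → Unique (x ∷ y ∷ y′ ∷ l) → Unique (walk x (y ∷ y′ ∷ l) x)
  closed-walk-Unique x y y′ l u@(_ ∷ u′) = ∉-Unique x∉ (walk-Unique y (y′ ∷ l) x path!)
    where
    path! : Unique (y ∷ y′ ∷ l ++ [ x ])
    path! = Unique-resp-↭ (++-comm [ x ] (y ∷ y′ ∷ l)) u
    x∉ : edge x y ∉ walk y (y′ ∷ l) x
    x∉ (here eq) with edge-injective eq
    ... | inj₁ (refl , _) = Unique-∉ u (here refl)
    ... | inj₂ (refl , _) = Unique-∉ u (there (here refl))
    x∉ (there i) = Unique-∉ path! (walk-ends y′ l x (subst (_∈ walk y′ l x) (edge-comm (λ { refl → Unique-∉ u (here refl) })) i))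

  Oriented : List (Edge n) → Set
  Oriented H = ∀ {i j} → (i , j) ∈ H → i Fin.< j

  Adj⇒edge : ∀ {H u v} → Oriented H → Adj H u v → edge u v ∈ H
  Adj⇒edge {H} o (inj₁ i) = subst (_∈ H) (sym (edge-< (o i))) i
  Adj⇒edge {H} o (inj₂ i) = subst (_∈ H) (sym (edge-≮ (Finₚ.<-asym (o i)))) i

  walk-⊆ : ∀ {H} → Oriented H → ∀ x l z → Linked (Adj H) (x ∷ l ++ [ z ]) → walk x l z ⊆ H
  walk-⊆ o x []      z (a ∷ _) (here refl) = Adj⇒edge o a
  walk-⊆ o x (y ∷ l) z (a ∷ _) (here refl) = Adj⇒edge o a
  walk-⊆ o x (y ∷ l) z (_ ∷ k) (there i)   = walk-⊆ o y l z k i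

  maximum : ∀ (x : Fin n) l → ∃[ y ] (y ∈ x ∷ l × (∀ {z} → z ∈ x ∷ l → z Fin.≤ y))
  maximum x [] = x , here refl , λ { (here refl) → ≤-refl }
  maximum x (x′ ∷ l) with maximum x′ l
  ... | y , y∈ , y-max with toℕ x ℕ.≤? toℕ y
  ...   | yes x≤y = y , there y∈ , λ { (here refl) → x≤y ; (there i) → y-max i }
  ...   | no  x≰y = x , here refl , λ { (here refl) → ≤-refl ; (there i) → ≤-trans (y-max i) (<⇒≤ (≰⇒> x≰y)) }

  -- The form in which `rooted` lists cycles. A cycle has one such form for each direction.
  record RootedCycle (H : Graph n) (k : ℕ) : Set where
    field
      root   : Fin n
      others : List (Fin n)
      unique : Unique (root ∷ others)
      closed : Linked (Adj H) (root ∷ others ++ [ root ])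
      size   : suc (length others) ≡ k
      top    : ∀ {y} → y ∈ others → y Fin.< root

  root-cycle : ∀ {H k} → Cycle H k → RootedCycle H k
  root-cycle {H} {k} C = go (maximum first others)
    where
    open Cycle C
    go : ∃[ y ] (y ∈ first ∷ others × (∀ {z} → z ∈ first ∷ others → z Fin.≤ y)) → RootedCycle H k
    go (x , x∈ , x-max) with ∈-∃++ x∈
    ... | as , bs , eq = record
      { root   = x
      ; others = bs ++ as
      ; unique = rot!
      ; closed = rotate as eq
      ; size   = trans (trans (sym (↭-length perm)) (cong length (sym eq))) size
      ; top    = λ i → Finₚ.≤∧≢⇒< (x-max (subst (_ ∈_) (sym eq) (∈-resp-↭ (↭-sym perm) (there i))))
                         (λ { refl → Unique-∉ rot! i })
      }
      where
      perm : as ++ x ∷ bs ↭ x ∷ bs ++ as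
      perm = ++-comm as (x ∷ bs)
      rot! : Unique (x ∷ bs ++ as)
      rot! = Unique-resp-↭ perm (subst Unique eq distinct)
      rotate : ∀ as → first ∷ others ≡ as ++ x ∷ bs → Linked (Adj H) (x ∷ (bs ++ as) ++ [ x ])
      rotate [] refl = subst (λ l → Linked (Adj H) (x ∷ l ++ [ x ])) (sym (++-identityʳ bs)) closed
      rotate (f ∷ as) refl = subst (Linked (Adj H)) (cong (x ∷_) (sym (++-assoc bs (f ∷ as) [ x ])))
        (Linked-overlap (x ∷ bs) (Linked-++ʳ (f ∷ as) whole) (Linked-++ˡ ((f ∷ as) ++ [ x ]) {bs ++ [ f ]}
          (subst (Linked (Adj H)) (sym (++-assoc (f ∷ as) [ x ] _)) whole)))
        where
        whole : Linked (Adj H) ((f ∷ as) ++ x ∷ bs ++ [ f ])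
        whole = subst (Linked (Adj H)) (++-assoc (f ∷ as) (x ∷ bs) [ f ]) closed

  reverse-cycle : ∀ {H k} → RootedCycle H k → RootedCycle H k
  reverse-cycle {H} C = record
    { root   = root
    ; others = reverse others
    ; unique = Unique-resp-↭ (prep root (↭-sym (↭-reverse others))) unique
    ; closed = subst (Linked (Adj H)) (trans (unfold-reverse root (others ++ [ root ]))
        (cong (_++ [ root ]) (reverse-++ others [ root ]))) (Linked-reverse (λ {u} {v} → Adj-sym {H = H} {u} {v}) closed)
    ; size   = trans (cong suc (length-reverse others)) size
    ; top    = top ∘ ∈-resp-↭ (↭-reverse others)
    }
    where open RootedCycle C

  -- Otherwise the first entry would also be the last. Thus the two directions of a cycle are
  -- different items, and its weight counts twice.
  reverse-≢ : ∀ (x y : Fin n) l → Unique (x ∷ y ∷ l) → x ∷ y ∷ l ≢ reverse (x ∷ y ∷ l)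
  reverse-≢ x y l u eq = bad (reverse (y ∷ l)) (λ i → ∈-resp-↭ (↭-reverse (y ∷ l)) i)
      (λ e → <⇒≢ (s≤s z≤n) (trans (sym (cong length e)) (length-reverse (y ∷ l)))) (trans eq (unfold-reverse x (y ∷ l)))
    where
    bad : ∀ r → r ⊆ y ∷ l → r ≢ [] → x ∷ y ∷ l ≢ r ++ [ x ]
    bad []      _ r≢ _    = r≢ refl
    bad (z ∷ r) s _  e = Unique-∉ u (subst (_∈ y ∷ l) (sym (∷-injectiveˡ e)) (s (here refl)))

∑-single : ∀ {xs : List A} {x} → Unique xs → x ∈ xs → ∀ g → (∀ {z} → z ∈ xs → z ≢ x → g z ≡ 0) → ∑ xs g ≤ g x
∑-single {xs = x ∷ xs} u@(_ ∷ _) (here refl) g h = ≤-reflexive (trans (cong (g x +_) (trans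
  (∑-cong xs (λ {z} i → h (there i) (λ { refl → Unique-∉ u i }))) (trans (∑-const xs 0) (*-zeroʳ (length xs))))) (+-identityʳ _))
∑-single {xs = y ∷ xs} u@(_ ∷ u′) (there i) g h = ≤-trans
  (≤-reflexive (cong (_+ ∑ xs g) (h (here refl) (λ { refl → Unique-∉ u i })))) (∑-single u′ i g (h ∘ there))

-- Estimating the series of cycle weights

range : ℕ → ℕ → List ℕ
range j zero    = []
range j (suc c) = j ∷ range (suc j) c

∈-range : ∀ {j k} c → j ≤ k → k < j + c → k ∈ range j c
∈-range {j} zero    j≤k k< = ⊥-elim (<⇒≱ k< (≤-trans (≤-reflexive (+-identityʳ j)) j≤k))
∈-range {j} (suc c) j≤k k< with m≤n⇒m<n∨m≡n j≤k
... | inj₁ j<k  = there (∈-range c j<k (≤-trans k< (≤-reflexive (+-suc j c))))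
... | inj₂ refl = here refl

-- 11 = 1 / (1 - 10/11). The ratio is assumed only below `N`, as it is applied to a `g` with
-- exponent `N ∸ k`.
∑-geometric : ∀ (g : ℕ → ℕ) N j c → (∀ {i} → j ≤ i → i < N → 11 * g (suc i) ≤ 10 * g i) → j + c ≤ suc N →
              ∑ (range j c) g ≤ 11 * g j
∑-geometric g N j zero          h le = z≤n
∑-geometric g N j (suc zero)    h le = ≤-trans (≤-reflexive (+-identityʳ (g j))) (m≤m+n (g j) _)
∑-geometric g N j (suc (suc c)) h le = +-monoʳ-≤ (g j) (≤-trans
  (∑-geometric g N (suc j) (suc c) (λ i → h (<⇒≤ i)) (≤-trans (≤-reflexive (sym (+-suc j (suc c)))) le))
  (h ≤-refl (s≤s⁻¹ (≤-trans (s≤s (s≤s (m≤m+n j c)))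
     (≤-trans (≤-reflexive (sym (trans (+-suc j (suc c)) (cong suc (+-suc j c))))) le)))))

range-≥ : ∀ {j k} c → k ∈ range j c → j ≤ k
range-≥ (suc c) (here refl) = ≤-refl
range-≥ (suc c) (there i)   = <⇒≤ (range-≥ c i)

-- Passes to the preceding term of the series, with the coefficient 10 c / 11 rounded up to an
-- integer `d`.
scale-step : ∀ {T} x y c d → T ≤ c * x → 11 * x ≤ 10 * y → 10 * c ≤ 11 * d → T ≤ d * y
scale-step {T} x y c d T≤ x≤ c≤ = *-cancelˡ-≤ 11 (begin
  11 * T          ≤⟨ *-monoʳ-≤ 11 T≤ ⟩
  11 * (c * x)    ≡⟨ *-swapˡ 11 c x ⟩
  c * (11 * x)    ≤⟨ *-monoʳ-≤ c x≤ ⟩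
  c * (10 * y)    ≡⟨ lem′ c 10 y ⟩
  10 * c * y      ≤⟨ *-monoˡ-≤ y c≤ ⟩
  11 * d * y      ≡⟨ *-assoc 11 d y ⟩
  11 * (d * y)    ∎)
  where
  open ≤-Reasoning
  lem′ : ∀ c a y → c * (a * y) ≡ a * c * y
  lem′ = solve-∀

-- (1/3) x³ + (1/4) x⁴ + (1/5) (x⁵ + x⁶ + ...) < 2 at x = 10/11.
series-bound : ∀ {a b s g₀ g₁ g₂ g₃ g₄ g₅} → 3 * a ≤ g₃ → 4 * b ≤ g₄ → 5 * s ≤ 11 * g₅ →
  11 * g₁ ≤ 10 * g₀ → 11 * g₂ ≤ 10 * g₁ → 11 * g₃ ≤ 10 * g₂ → 11 * g₄ ≤ 10 * g₃ → 11 * g₅ ≤ 10 * g₄ →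
  0 < g₀ → a + (b + s) < 2 * g₀
series-bound {a} {b} {s} {g₀} {g₁} {g₂} {g₃} {g₄} {g₅} ha hb hs h₁ h₂ h₃ h₄ h₅ 0<g₀ =
  *-cancelˡ-< 60 _ _ (begin-strict
    -- 60 clears the denominators 3, 4 and 5. Descending from g₃ to g₀ the coefficients are 143,
    -- 130, 119 and 109, the last below 120 = 60 · 2.
    60 * (a + (b + s))   ≤⟨ scale-step g₁ g₀ 119 109 at₁ h₁ (≤ᵇ⇒≤ 1190 1199 _) ⟩
    109 * g₀             <⟨ *-monoˡ-< g₀ {{>-nonZero 0<g₀}} (≤ᵇ⇒≤ 110 120 _) ⟩
    120 * g₀             ≡⟨ *-assoc 60 2 g₀ ⟩
    60 * (2 * g₀)        ∎)
  where
  open ≤-Reasoning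
  lem : ∀ a b s → 60 * (a + (b + s)) ≡ 20 * (3 * a) + 15 * (4 * b) + 12 * (5 * s)
  lem = solve-∀
  lem′ : ∀ x y → 20 * x + 15 * y + 12 * (10 * y) ≡ 20 * x + 135 * y
  lem′ = solve-∀
  at₃ : 60 * (a + (b + s)) ≤ 143 * g₃
  at₃ = begin
    60 * (a + (b + s))                          ≡⟨ lem a b s ⟩
    20 * (3 * a) + 15 * (4 * b) + 12 * (5 * s)  ≤⟨ +-mono-≤ (+-mono-≤ (*-monoʳ-≤ 20 ha) (*-monoʳ-≤ 15 hb)) (*-monoʳ-≤ 12 (≤-trans hs h₅)) ⟩
    20 * g₃ + 15 * g₄ + 12 * (10 * g₄)          ≡⟨ lem′ g₃ g₄ ⟩
    20 * g₃ + 135 * g₄                          ≤⟨ +-monoʳ-≤ (20 * g₃) (scale-step g₄ g₃ 135 123 ≤-refl h₄ (≤ᵇ⇒≤ 1350 1353 _)) ⟩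
    20 * g₃ + 123 * g₃                          ≡⟨ sym (*-distribʳ-+ g₃ 20 123) ⟩
    143 * g₃                                    ∎
  at₁ : 60 * (a + (b + s)) ≤ 119 * g₁
  at₁ = scale-step g₂ g₁ 130 119 (scale-step g₃ g₂ 143 130 at₃ h₃ ≤-refl) h₂ (≤ᵇ⇒≤ 1300 1309 _)

-- The potential function of Client

module Danger {n : ℕ} (q : ℕ) where

  open DecMembership (_≟ᴱ_ {n}) using (_∈?_)
  open DecUnique (_≟ᴱ_ {n}) using (unique?)

  private
    Q : ℕ
    Q = suc q

  -- A free edge will be Client's with probability about 1 / Q; all weights are scaled by a power of Q.
  value : (fr cl : List (Edge n)) → Edge n → ℕ
  value fr cl f = factor (f ∈? cl) Q (𝟙 (f ∈? fr))

  -- A repeated edge would multiply the weight by Q twice when Client takes it, and the averaging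
  -- argument would break; hence the value 0.
  walk-weight : (fr cl : List (Edge n)) → List (Edge n) → ℕ
  walk-weight fr cl E = factor (unique? E) (∏ E (value fr cl)) 0

  Item : Set
  Item = ℕ × Fin n × List (Fin n)

  items : List Item
  items = concatMap (λ k → map (k ,_) (rooted (pred k))) (range 3 (n ∸ 2))

  -- The power of Q puts all lengths on one scale: a finished cycle weighs Q^n whatever its length.
  weight : (fr cl : List (Edge n)) → Item → ℕ
  weight fr cl (k , x , l) = Q ^ (n ∸ k) * walk-weight fr cl (walk x l x)

  danger : (fr cl : List (Edge n)) → ℕ
  danger fr cl = ∑ items (weight fr cl)

  remove : List (Edge n) → List (Edge n) → List (Edge n)
  remove X = filter (λ f → ¬? (f ∈? X))

  value-∈cl : ∀ {fr cl f} → f ∈ cl → value fr cl f ≡ Q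
  value-∈cl {fr} {cl} {f} i with f ∈? cl
  ... | yes _ = refl
  ... | no ∉  = ⊥-elim (∉ i)

  value-≤Q : ∀ fr cl f → value fr cl f ≤ Q
  value-≤Q fr cl f with f ∈? cl
  ... | yes _ = ≤-refl
  ... | no _  = ≤-trans (𝟙-≤1 (f ∈? fr)) (s≤s z≤n)

  module _ {fr cl X : List (Edge n)} (X! : Unique X) (X⊆ : X ⊆ fr) (disjoint : ∀ {f} → f ∈ fr → f ∉ cl) where

    private
      value′ : Edge n → Edge n → ℕ
      value′ e = value (remove X fr) (e ∷ cl)

      value-∉ : ∀ {e f} → e ∈ X → f ∉ X → value′ e f ≤ value fr cl f
      value-∉ {e} {f} e∈ f∉ = factor-mono (f ∈? (e ∷ cl)) (f ∈? cl)
        (λ { (here refl) → ⊥-elim (f∉ e∈) ; (there i) → i })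
        (≤-trans (𝟙-≤1 (f ∈? remove X fr)) (s≤s z≤n))
        (𝟙-mono (f ∈? remove X fr) (f ∈? fr) (λ i → proj₁ (∈-filter⁻ (λ f → ¬? (f ∈? X)) {xs = fr} i)))

      value-0 : ∀ {e f} → f ∈ X → e ≢ f → value′ e f ≡ 0
      value-0 {e} {f} f∈ e≢f = trans
        (factor-no (f ∈? (e ∷ cl)) λ { (here refl) → e≢f refl ; (there i) → disjoint (X⊆ f∈) i })
        (𝟙-no (f ∈? remove X fr) λ i → proj₂ (∈-filter⁻ (λ f → ¬? (f ∈? X)) {xs = fr} i) f∈)

      1≤value : ∀ {f} → f ∈ X → 1 ≤ value fr cl f
      1≤value {f} f∈ with f ∈? cl
      ... | yes _ = s≤s z≤n
      ... | no _ with f ∈? fr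
      ...   | yes _ = ≤-refl
      ...   | no ∉  = ⊥-elim (∉ (X⊆ f∈))

      value-≤ : ∀ {e f} → e ∈ X → e ≢ f → value′ e f ≤ value fr cl f
      value-≤ {e} {f} e∈ e≢f with f ∈? X
      ... | yes f∈ = ≤-trans (≤-reflexive (value-0 f∈ e≢f)) z≤n
      ... | no  f∉ = value-∉ e∈ f∉

    -- If an edge `f` of the walk is offered, every choice but `f` kills the walk, and the choice of
    -- `f` raises its factor to Q while no other factor grows. If `f` is not offered, its factor
    -- does not grow and can be taken out.
    ∑-∏-value : length X ≡ Q → ∀ E → Unique E → ∑ X (λ e → ∏ E (value′ e)) ≤ Q * ∏ E (value fr cl)
    ∑-∏-value len []      _ = ≤-reflexive (trans (∑-const X 1) (cong (_* 1) len))
    ∑-∏-value len (f ∷ E) u@(_ ∷ u′) with f ∈? X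
    ... | yes f∈ = begin
      ∑ X (λ e → value′ e f * ∏ E (value′ e))
        ≤⟨ ∑-single X! f∈ (λ e → value′ e f * ∏ E (value′ e))
             (λ {e} _ e≢f → cong (_* ∏ E (value′ e)) (value-0 f∈ e≢f)) ⟩
      value′ f f * ∏ E (value′ f)
        ≤⟨ *-mono-≤ (value-≤Q (remove X fr) (f ∷ cl) f) (∏-mono E (λ {f′} i → value-≤ f∈ (λ { refl → Unique-∉ u i }))) ⟩
      Q * ∏ E (value fr cl)
        ≤⟨ *-monoʳ-≤ Q (m≤n*m _ (value fr cl f) {{>-nonZero (1≤value f∈)}}) ⟩
      Q * (value fr cl f * ∏ E (value fr cl)) ∎
      where open ≤-Reasoning
    ... | no f∉ = begin
      ∑ X (λ e → value′ e f * ∏ E (value′ e))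
        ≤⟨ ∑-mono X (λ {e} e∈ → *-monoˡ-≤ (∏ E (value′ e)) (value-∉ e∈ f∉)) ⟩
      ∑ X (λ e → value fr cl f * ∏ E (value′ e))
        ≡⟨ ∑-*ˡ X (value fr cl f) _ ⟩
      value fr cl f * ∑ X (λ e → ∏ E (value′ e))
        ≤⟨ *-monoʳ-≤ (value fr cl f) (∑-∏-value len E u′) ⟩
      value fr cl f * (Q * ∏ E (value fr cl))
        ≡⟨ *-swapˡ (value fr cl f) Q _ ⟩
      Q * (value fr cl f * ∏ E (value fr cl)) ∎
      where open ≤-Reasoning

    ∑-walk-weight : length X ≡ Q → ∀ E → ∑ X (λ e → walk-weight (remove X fr) (e ∷ cl) E) ≤ Q * walk-weight fr cl E
    ∑-walk-weight len E with unique? E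
    ... | yes u = ∑-∏-value len E u
    ... | no  _ = ≤-trans (≤-reflexive (trans (∑-const X 0) (*-zeroʳ (length X)))) z≤n

    ∑-danger : length X ≡ Q → ∑ X (λ e → danger (remove X fr) (e ∷ cl)) ≤ length X * danger fr cl
    ∑-danger len = begin
      ∑ X (λ e → danger (remove X fr) (e ∷ cl))
        ≡⟨ ∑-swap X items (λ e → weight (remove X fr) (e ∷ cl)) ⟩
      ∑ items (λ it → ∑ X (λ e → weight (remove X fr) (e ∷ cl) it))
        ≤⟨ ∑-mono items (λ {it} _ → each it) ⟩
      ∑ items (λ it → Q * weight fr cl it)
        ≡⟨ ∑-*ˡ items Q _ ⟩
      Q * danger fr cl
        ≡⟨ cong (_* danger fr cl) (sym len) ⟩
      length X * danger fr cl ∎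
      where
      open ≤-Reasoning
      each : ∀ it → ∑ X (λ e → weight (remove X fr) (e ∷ cl) it) ≤ Q * weight fr cl it
      each (k , x , l) = ≤-trans (≤-reflexive (∑-*ˡ X (Q ^ (n ∸ k)) _))
        (≤-trans (*-monoʳ-≤ (Q ^ (n ∸ k)) (∑-walk-weight len (walk x l x))) (≤-reflexive (*-swapˡ (Q ^ (n ∸ k)) Q _)))

  danger-sweep : ∀ fr cl → danger [] cl ≤ danger fr cl
  danger-sweep fr cl = ∑-mono items (λ { {k , x , l} _ → *-monoʳ-≤ (Q ^ (n ∸ k)) (each (walk x l x)) })
    where
    value-mono : ∀ f → value [] cl f ≤ value fr cl f
    value-mono f with f ∈? cl
    ... | yes _ = ≤-refl
    ... | no  _ = z≤n
    each : ∀ E → walk-weight [] cl E ≤ walk-weight fr cl E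
    each E with unique? E
    ... | yes _ = ∏-mono E (λ {f} _ → value-mono f)
    ... | no  _ = z≤n

  danger-start : ∀ fr → danger fr [] ≤ ∑ (range 3 (n ∸ 2)) (λ k → Q ^ (n ∸ k) * length (rooted {n} (pred k)))
  danger-start fr = begin
    ∑ items (weight fr [])
      ≡⟨ ∑-concatMap (λ k → map (k ,_) (rooted (pred k))) (range 3 (n ∸ 2)) (weight fr []) ⟩
    ∑ (range 3 (n ∸ 2)) (λ k → ∑ (map (k ,_) (rooted (pred k))) (weight fr []))
      ≡⟨ ∑-cong (range 3 (n ∸ 2)) (λ {k} _ → ∑-map (k ,_) (rooted (pred k)) (weight fr [])) ⟩
    ∑ (range 3 (n ∸ 2)) (λ k → ∑ (rooted (pred k)) (λ it → weight fr [] (k , it)))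
      ≤⟨ ∑-mono (range 3 (n ∸ 2)) (λ {k} _ → ∑-mono (rooted (pred k))
           (λ { {x , l} _ → ≤-trans (*-monoʳ-≤ (Q ^ (n ∸ k)) (each (walk x l x))) (≤-reflexive (*-identityʳ _)) })) ⟩
    ∑ (range 3 (n ∸ 2)) (λ k → ∑ (rooted {n} (pred k)) (λ _ → Q ^ (n ∸ k)))
      ≡⟨ ∑-cong (range 3 (n ∸ 2)) (λ {k} _ → trans (∑-const (rooted {n} (pred k)) (Q ^ (n ∸ k))) (*-comm (length (rooted {n} (pred k))) (Q ^ (n ∸ k)))) ⟩
    ∑ (range 3 (n ∸ 2)) (λ k → Q ^ (n ∸ k) * length (rooted {n} (pred k))) ∎
    where
    open ≤-Reasoning
    each : ∀ E → walk-weight fr [] E ≤ 1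
    each E with unique? E
    ... | no  _ = z≤n
    ... | yes _ = ≤-trans (∏-mono E {g = λ _ → 1} (λ {f} _ → 𝟙-≤1 (f ∈? fr)))
                    (≤-reflexive (trans (∏-const E 1 (λ _ → refl)) (^-zeroˡ (length E))))

  rooted-weight : ∀ {fr H k} → Oriented H → 3 ≤ k → k ≤ n → (C : RootedCycle H k) →
                  weight fr H (k , RootedCycle.root C , RootedCycle.others C) ≡ Q ^ n
  rooted-weight {fr} {H} {k} o 3≤k k≤n C = trans (cong (Q ^ (n ∸ k) *_) full)
    (trans (sym (^-distribˡ-+-* Q (n ∸ k) k)) (cong (Q ^_) (m∸n+n≡m k≤n)))
    where
    open RootedCycle C
    walk! : ∀ l → Unique (root ∷ l) → 3 ≤ suc (length l) → Unique (walk root l root)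
    walk! []           u (s≤s ())
    walk! (y ∷ [])     u (s≤s (s≤s ()))
    walk! (y ∷ y′ ∷ l) u _ = closed-walk-Unique root y y′ l u
    full : walk-weight fr H (walk root others root) ≡ Q ^ k
    full with unique? (walk root others root)
    ... | no ¬u = ⊥-elim (¬u (walk! others unique (≤-trans 3≤k (≤-reflexive (sym size)))))
    ... | yes _ = trans (∏-const (walk root others root) Q (λ i → value-∈cl {fr} {H} (walk-⊆ o root others root closed i)))
                    (cong (Q ^_) (trans (length-walk root others root) size))

  item∈ : ∀ {H k} → 3 ≤ k → k ≤ n → (C : RootedCycle H k) → (k , RootedCycle.root C , RootedCycle.others C) ∈ items
  item∈ {k = k} 3≤k k≤n C = ∈-concatMap⁺ (λ k → map (k ,_) (rooted (pred k)))
      (lose (∈-range (n ∸ 2) 3≤k (s≤s (≤-trans k≤n (≤-reflexive (sym (m+[n∸m]≡n (≤-trans (n≤1+n 2) (≤-trans 3≤k k≤n))))))))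
        (∈-map⁺ (k ,_) (subst (λ j → (root , others) ∈ rooted j) (cong pred size) (∈-rooted top))))
    where open RootedCycle C

  -- A cycle of Client appears as two distinct items, one per direction, each of weight Q^n.
  danger<⇒Acyclic : ∀ {fr H} → Oriented H → danger fr H < 2 * Q ^ n → Acyclic H
  danger<⇒Acyclic {fr} {H} o small k C = <⇒≱ small (≤-trans (≤-reflexive sum≡)
      (≤-∑₂ (weight fr H) (item∈ 3≤k k≤n C₁) (item∈ 3≤k k≤n C₂) (λ eq → differ (,-injectiveʳ (,-injectiveʳ eq)))))
    where
    open Cycle C using (3≤k)
    C₁ C₂ : RootedCycle H k
    C₁ = root-cycle C
    C₂ = reverse-cycle C₁
    open RootedCycle C₁
    k≤n : k ≤ n
    k≤n = ≤-trans (≤-reflexive (sym size)) (≤-trans (Unique-⊆-length {ys = allFin n} unique (λ {x} _ → ∈-allFin x))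
            (≤-reflexive (length-tabulate id)))
    differ : others ≢ reverse others
    differ = go others unique (≤-trans 3≤k (≤-reflexive (sym size)))
      where
      go : ∀ l → Unique (root ∷ l) → 3 ≤ suc (length l) → l ≢ reverse l
      go []           _       (s≤s ())
      go (y ∷ [])     _       (s≤s (s≤s ()))
      go (y ∷ y′ ∷ l) (_ ∷ u) _ = reverse-≢ y y′ l u
    sum≡ : 2 * Q ^ n ≡ weight fr H (k , root , others) + weight fr H (k , root , reverse others)
    sum≡ = trans (cong (Q ^ n +_) (+-identityʳ (Q ^ n)))
      (cong₂ _+_ (sym (rooted-weight {fr} o 3≤k k≤n C₁)) (sym (rooted-weight {fr} o 3≤k k≤n C₂)))

-- The strategy of Client

module _ {n : ℕ} where
  record Sound (P : Position n) : Set where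
    field
      disjoint : ∀ {f} → f ∈ free P → f ∉ client P
      free<    : Oriented (free P)
      client<  : Oriented (client P)

  sound : ∀ {q P} → Play n q P → Sound P
  sound start = record
    { disjoint = λ _ () ; free< = λ i → proj₂ (∈-filter⁻ (λ (i , j) → i Fin.<? j) {xs = cartesianProduct (allFin n) (allFin n)} i) ; client< = λ () }
  sound (round {P} h m O (e , e∈)) = record
    { disjoint = λ { i (here refl) → proj₂ (kept i) e∈ ; i (there j) → disjoint (proj₁ (kept i)) j }
    ; free<    = free< ∘ proj₁ ∘ kept
    ; client<  = λ { (here refl) → free< (Offer.⊆free O e∈) ; (there i) → client< i }
    }
    where
    open Sound (sound h)
    open DecMembership (_≟ᴱ_ {n}) using (_∈?_)
    kept : ∀ {f} → f ∈ filter (λ f → ¬? (f ∈? edges O)) (free P) → f ∈ free P × f ∉ edges O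
    kept = ∈-filter⁻ (λ f → ¬? (f ∈? edges O))
  sound (sweep h _ _) = record { disjoint = λ () ; free< = λ () ; client< = Sound.client< (sound h) }

module _ (n′ q : ℕ) (sparse : 11 * (5 + n′) ≤ 10 * suc q) where

  private
    N Q : ℕ
    N = 5 + n′
    Q = suc q
    open Danger {N} q

    -- (N / Q)^k on the scale Q^N, an upper bound for k times the weight of all items of length k at
    -- the start.
    g : ℕ → ℕ
    g k = N ^ k * Q ^ (N ∸ k)

    g-step : ∀ {i} → i < N → 11 * g (suc i) ≤ 10 * g i
    g-step {i} i<N = begin
      11 * (N * N ^ i * Q ^ (N ∸ suc i))   ≡⟨ lem 11 N (N ^ i) _ ⟩
      11 * N * (N ^ i * Q ^ (N ∸ suc i))   ≤⟨ *-monoˡ-≤ (N ^ i * Q ^ (N ∸ suc i)) sparse ⟩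
      10 * Q * (N ^ i * Q ^ (N ∸ suc i))   ≡⟨ lem′ 10 Q (N ^ i) _ ⟩
      10 * (N ^ i * (Q * Q ^ (N ∸ suc i))) ≡⟨ cong (λ e → 10 * (N ^ i * Q ^ e)) (suc[N∸suc] i<N) ⟩
      10 * g i ∎
      where
      open ≤-Reasoning
      lem : ∀ a N x y → a * (N * x * y) ≡ a * N * (x * y)
      lem = solve-∀
      lem′ : ∀ a N x y → a * N * (x * y) ≡ a * (x * (N * y))
      lem′ = solve-∀
      suc[N∸suc] : ∀ {i N} → i < N → suc (N ∸ suc i) ≡ N ∸ i
      suc[N∸suc] {zero}  {suc N} _       = refl
      suc[N∸suc] {suc i} {suc N} (s≤s l) = suc[N∸suc] l

    term : ℕ → ℕ
    term k = Q ^ (N ∸ k) * length (rooted {N} (pred k))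

    term-≤ : ∀ j → suc j * term (suc j) ≤ g (suc j)
    term-≤ j = ≤-trans (≤-reflexive (*-swapˡ (suc j) (Q ^ (N ∸ suc j)) _))
      (≤-trans (*-monoʳ-≤ (Q ^ (N ∸ suc j)) (length-rooted {N} j)) (≤-reflexive (*-comm (Q ^ (N ∸ suc j)) (N ^ suc j))))

    ∑-terms : 5 * ∑ (range 5 (suc n′)) term ≤ 11 * g 5
    ∑-terms = begin
      5 * ∑ (range 5 (suc n′)) term
        ≡⟨ sym (∑-*ˡ (range 5 (suc n′)) 5 term) ⟩
      ∑ (range 5 (suc n′)) (λ k → 5 * term k)
        ≤⟨ ∑-mono (range 5 (suc n′)) (λ i → each (range-≥ (suc n′) i)) ⟩
      ∑ (range 5 (suc n′)) g
        ≤⟨ ∑-geometric g N 5 (suc n′) (λ _ → g-step) (≤-reflexive (+-suc 5 n′)) ⟩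
      11 * g 5 ∎
      where
      open ≤-Reasoning
      each : ∀ {k} → 5 ≤ k → 5 * term k ≤ g k
      each {suc j} 5≤ = ≤-trans (*-monoˡ-≤ (term (suc j)) 5≤) (term-≤ j)

    -- With `N` of the form 5 + n′ the sum over lengths unfolds to the terms 3 and 4 and a tail from
    -- 5 on, to which `series-bound` applies.
    start-small : danger (K N) [] < 2 * Q ^ N
    start-small = ≤-<-trans (danger-start (K N)) (subst (λ z → term 3 + (term 4 + ∑ (range 5 (suc n′)) term) < 2 * z)
      (*-identityˡ (Q ^ N))
      (series-bound {term 3} {term 4} {∑ (range 5 (suc n′)) term} {g 0} {g 1} {g 2} {g 3} {g 4} {g 5} (term-≤ 2) (term-≤ 3) ∑-terms
        (g-step (s≤s z≤n)) (g-step (s≤s (s≤s z≤n))) (g-step (s≤s (s≤s (s≤s z≤n))))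
        (g-step (s≤s (s≤s (s≤s (s≤s z≤n))))) (g-step (s≤s (s≤s (s≤s (s≤s (s≤s z≤n))))))
        (≤-trans (m^n>0 Q N) (≤-reflexive (sym (*-identityˡ (Q ^ N)))))))

    after : List (Edge N) → Position N → Edge N → ℕ
    after X P e = danger (remove X (free P)) (e ∷ client P)

    best : ∀ {P} X → length X ≡ Q → ∑ X (after X P) ≤ length X * danger (free P) (client P) →
           ∃[ e ] (e ∈ X × after X P e ≤ danger (free P) (client P))
    best {P} (e ∷ X) _ h = ≤-average e X (after (e ∷ X) P) (danger (free P) (client P)) h

    choose : ∀ {P} → Play N q P → (O : Offer q P) →
             ∃[ e ] (e ∈ edges O × after (edges O) P e ≤ danger (free P) (client P))
    choose {P} h O = best {P} (edges O) (Offer.size O)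
      (∑-danger (Offer.distinct O) (Offer.⊆free O) (Sound.disjoint (sound h)) (Offer.size O))

    σ : ClientStrategy N q
    σ h _ O = proj₁ (choose h O) , proj₁ (proj₂ (choose h O))

    stays-small : ∀ {P} (h : Play N q P) → ClientFollows (λ {P} → σ {P}) h → danger (free P) (client P) < 2 * Q ^ N
    stays-small start                   _        = start-small
    stays-small (round {P} h m O c) (f , eq) = ≤-<-trans
      (subst (λ e → after (edges O) P e ≤ danger (free P) (client P)) (sym eq) (proj₂ (proj₂ (choose h O))))
      (stays-small h f)
    stays-small (sweep {P} h _ _)       f        = ≤-<-trans (danger-sweep (free P) (client P)) (stays-small h f)

  client-stays-acyclic : ClientCanMaintain N q Acyclic
  client-stays-acyclic = (λ {P} → σ {P}) , keeps
    where
    keeps : ∀ {P} (h : Play N q P) → ClientFollows (λ {P} → σ {P}) h → Acyclic (client P)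
    keeps {P} h f = danger<⇒Acyclic {free P} (Sound.client< (sound h)) (stays-small h f)

-- Arithmetic of the constants

toℚᵘ-/-* : ∀ a d n → toℚᵘ ((ℤ.+ a ℚ./ suc d) ℚ.* fromℕ n) ℚᵘ.≃ mkℚᵘ (ℤ.+ a) d ℚᵘ.* mkℚᵘ (ℤ.+ n) 0
toℚᵘ-/-* a d n = ℚᵘₚ.≃-trans (ℚₚ.toℚᵘ-homo-* (ℤ.+ a ℚ./ suc d) (fromℕ n))
  (ℚᵘₚ.*-cong (ℚₚ.toℚᵘ-fromℚᵘ (mkℚᵘ (ℤ.+ a) d)) (ℚₚ.toℚᵘ-fromℚᵘ (mkℚᵘ (ℤ.+ n) 0)))

toℚᵘ-fromℕ : ∀ n → toℚᵘ (fromℕ n) ℚᵘ.≃ mkℚᵘ (ℤ.+ n) 0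
toℚᵘ-fromℕ n = ℚₚ.toℚᵘ-fromℚᵘ (mkℚᵘ (ℤ.+ n) 0)

≤-fraction⇒ : ∀ a d n q → fromℕ q ℚ.≤ (ℤ.+ a ℚ./ suc d) ℚ.* fromℕ n → suc d * q ≤ a * n
≤-fraction⇒ a d n q h
  with ℚᵘₚ.≤-respˡ-≃ (toℚᵘ-fromℕ q) (ℚᵘₚ.≤-respʳ-≃ (toℚᵘ-/-* a d n) (ℚₚ.toℚᵘ-mono-≤ h))
... | *≤* le = subst₂ _≤_ (trans (cong (q *_) (*-identityʳ (suc d))) (*-comm q (suc d))) (*-identityʳ (a * n))
  (ℤₚ.drop‿+≤+ (subst₂ ℤ._≤_ (sym (ℤₚ.pos-* q (suc d * 1)))
    (trans (cong (ℤ._* ℤ.+ 1) (sym (ℤₚ.pos-* a n))) (sym (ℤₚ.pos-* (a * n) 1))) le))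

fraction-≤⇒ : ∀ a d n q → (ℤ.+ a ℚ./ suc d) ℚ.* fromℕ n ℚ.≤ fromℕ q → a * n ≤ suc d * q
fraction-≤⇒ a d n q h
  with ℚᵘₚ.≤-respʳ-≃ (toℚᵘ-fromℕ q) (ℚᵘₚ.≤-respˡ-≃ (toℚᵘ-/-* a d n) (ℚₚ.toℚᵘ-mono-≤ h))
... | *≤* le = subst₂ _≤_ (*-identityʳ (a * n)) (trans (cong (q *_) (*-identityʳ (suc d))) (*-comm q (suc d)))
  (ℤₚ.drop‿+≤+ (subst₂ ℤ._≤_ (trans (cong (ℤ._* ℤ.+ 1) (sym (ℤₚ.pos-* a n))) (sym (ℤₚ.pos-* (a * n) 1)))
    (sym (ℤₚ.pos-* q (suc d * 1))) le))

module _ (n q : ℕ) (1≤q : 1 ≤ q) (small : 200 * κ * q ≤ n) where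

  private
    t Q : ℕ
    t = ⌊ n /2⌋
    Q = suc q

    Q≤2q : Q ≤ 2 * q
    Q≤2q = ≤-trans (+-monoˡ-≤ q 1≤q) (≤-reflexive (lem q))
      where
      lem : ∀ q → q + q ≡ 2 * q
      lem = solve-∀

    n≤2t+1 : n ≤ 2 * t + 1
    n≤2t+1 = go n
      where
      go : ∀ n → n ≤ 2 * ⌊ n /2⌋ + 1
      go 0             = z≤n
      go 1             = ≤-refl
      go (suc (suc n)) = ≤-trans (s≤s (s≤s (go n))) (≤-reflexive (lem ⌊ n /2⌋))
        where
        lem : ∀ t → suc (suc (2 * t + 1)) ≡ 2 * suc t + 1
        lem = solve-∀

    2t≤n : 2 * t ≤ n
    2t≤n = ≤-trans (≤-reflexive (cong (λ z → t + z) (+-identityʳ t)))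
      (≤-trans (+-monoʳ-≤ t (⌊n/2⌋≤⌈n/2⌉ n)) (≤-reflexive (⌊n/2⌋+⌈n/2⌉≡n n)))

    -- `W` must keep κ · 46 Q vertices, and at most n / 2 + 5 Q vertices lie outside it; doubling
    -- clears the half. By Q ≤ 2 q the first term is at most 184 κ q, and 3 ≤ κ fits the other into
    -- the remaining 16 κ q.
    92κQ+10Q≤n : 2 * (κ * (46 * Q)) + 10 * Q ≤ n
    92κQ+10Q≤n = begin
      2 * (κ * (46 * Q)) + 10 * Q
        ≤⟨ +-mono-≤ (*-monoʳ-≤ 2 (*-monoʳ-≤ κ (*-monoʳ-≤ 46 Q≤2q))) (*-monoʳ-≤ 10 Q≤2q) ⟩
      2 * (κ * (46 * (2 * q))) + 10 * (2 * q)
        ≤⟨ m≤m+n _ (28 * q) ⟩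
      2 * (κ * (46 * (2 * q))) + 10 * (2 * q) + 28 * q
        ≡⟨ lem κ q ⟩
      184 * κ * q + 3 * (16 * q)
        ≤⟨ +-monoʳ-≤ (184 * κ * q) (*-monoˡ-≤ (16 * q) 3≤κ) ⟩
      184 * κ * q + κ * (16 * q)
        ≡⟨ lem′ κ q ⟩
      200 * κ * q
        ≤⟨ small ⟩
      n ∎
      where
      open ≤-Reasoning
      lem : ∀ κ q → 2 * (κ * (46 * (2 * q))) + 10 * (2 * q) + 28 * q ≡ 184 * κ * q + 3 * (16 * q)
      lem = solve-∀
      lem′ : ∀ κ q → 184 * κ * q + κ * (16 * q) ≡ 200 * κ * q
      lem′ = solve-∀

    room : 3 * Q + suc (suc (t + q)) + q ≤ n
    room = *-cancelˡ-≤ 2 (begin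
      2 * (3 * Q + suc (suc (t + q)) + q)
        ≡⟨ lem q t ⟩
      10 * Q + 2 * t
        ≤⟨ +-mono-≤ (≤-trans (m≤n+m _ _) 92κQ+10Q≤n) 2t≤n ⟩
      n + n
        ≡⟨ cong (n +_) (sym (+-identityʳ n)) ⟩
      2 * n ∎)
      where
      open ≤-Reasoning
      lem : ∀ q t → 2 * (3 * suc q + suc (suc (t + q)) + q) ≡ 10 * suc q + 2 * t
      lem = solve-∀

    left-over : ∀ {P} (fr : Frame q t P) → κ * (46 * Q) ≤ length (Frame.w fr ∷ Frame.rest fr)
    left-over fr = *-cancelˡ-≤ 2 (+-cancelʳ-≤ (10 * Q) _ _ (≤-trans 92κQ+10Q≤n (+-cancelʳ-≤ n n _ (begin
      n + n
        ≡⟨ cong₂ _+_ (sym count) (sym count) ⟩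
      (2 * Q + suc (suc (t + q) + L)) + (2 * Q + suc (suc (t + q) + L))
        ≤⟨ m≤m+n _ (2 + 4 * q) ⟩
      (2 * Q + suc (suc (t + q) + L)) + (2 * Q + suc (suc (t + q) + L)) + (2 + 4 * q)
        ≡⟨ lem q t L ⟩
      2 * L + 10 * Q + 2 * t
        ≤⟨ +-monoʳ-≤ (2 * L + 10 * Q) 2t≤n ⟩
      2 * L + 10 * Q + n ∎))))
      where
      open ≤-Reasoning
      open Frame fr
      L : ℕ
      L = length (w ∷ rest)
      lem : ∀ q t L → (2 * suc q + suc (suc (t + q) + L)) + (2 * suc q + suc (suc (t + q) + L)) + (2 + 4 * q)
                      ≡ 2 * L + 10 * suc q + 2 * t
      lem = solve-∀
      count : 2 * Q + suc (suc (t + q) + L) ≡ n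
      count = trans (cong₂ (λ u v → u + suc (v + L)) (sym length-as) (sym length-ys))
        (trans (cong (λ z → length (a ∷ as) + suc z) (sym (length-++ ys))) (trans (sym (length-++ (a ∷ as))) total))

  waiter-forces-pancyclic : WaiterCanForce n q Pancyclic
  waiter-forces-pancyclic = force⇒canForce Pancyclic Pancyclic-∷
    (force-frame n q t room >>= λ fr →
      Finish.force-pancyclic fr (46 * Q) ≤-refl (≤-trans n≤2t+1 (+-monoʳ-≤ (2 * t) (s≤s z≤n))) (left-over fr))
    where
    Pancyclic-∷ : ∀ {e} {H : Graph n} → Pancyclic H → Pancyclic (e ∷ H)
    Pancyclic-∷ pan k 3≤k k≤n = record
      { first = first ; others = others ; distinct = distinct
      ; closed = Linked.map (Adj-⊆ there) closed ; size = size ; 3≤k = 3≤k }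
      where open Cycle (pan k 3≤k k≤n) hiding (3≤k)

open import Data.Integer using (+_)

theorem1p4 : ∃[ n₀ ]
    ( (∀ n q → n₀ ≤ n → 1 ≤ q →
    (+ 11 ℚ./ 10) ℚ.* fromℕ n ℚ.≤ fromℕ q →
    ClientCanMaintain n q Acyclic)
    × (∃[ c ] (0ℚ ℚ.< c × (∀ n q → n₀ ≤ n → 1 ≤ q →
    fromℕ q ℚ.≤ c ℚ.* fromℕ n →
    WaiterCanForce n q Pancyclic))) )
-- 5 comes from splitting off the cycle lengths 3 and 4 in the series for Client. The denominator is
-- a successor so that it is visibly nonzero; the surplus `q` this creates is dropped in `part-ii`.
theorem1p4 = 5 , part-i , ℤ.+ 1 ℚ./ suc (200 * κ) , 0<c , part-ii
  where
  part-i : ∀ n q → 5 ≤ n → 1 ≤ q → (+ 11 ℚ./ 10) ℚ.* fromℕ n ℚ.≤ fromℕ q → ClientCanMaintain n q Acyclic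
  part-i (suc (suc (suc (suc (suc n′))))) q _ _ h =
    client-stays-acyclic n′ q (≤-trans (fraction-≤⇒ 11 9 (5 ℕ.+ n′) q h) (*-monoʳ-≤ 10 (n≤1+n q)))
  part-i 1 q (s≤s ())
  part-i 2 q (s≤s (s≤s ()))
  part-i 3 q (s≤s (s≤s (s≤s ())))
  part-i 4 q (s≤s (s≤s (s≤s (s≤s ()))))
  0<c : 0ℚ ℚ.< + 1 ℚ./ suc (200 * κ)
  0<c = ℚₚ.positive⁻¹ (+ 1 ℚ./ suc (200 * κ)) {{ℚₚ.normalize-pos 1 (suc (200 * κ))}}
  part-ii : ∀ n q → 5 ≤ n → 1 ≤ q → fromℕ q ℚ.≤ (+ 1 ℚ./ suc (200 * κ)) ℚ.* fromℕ n → WaiterCanForce n q Pancyclic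
  part-ii n q _ 1≤q h = waiter-forces-pancyclic n q 1≤q
    (≤-trans (m≤n+m (200 * κ * q) q) (≤-trans (≤-fraction⇒ 1 (200 * κ) n q h) (≤-reflexive (*-identityˡ n))))
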